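{- Let $\mathcal L$ be a Cameron–Liebler line class in $PG(3,4)$ with parameter $x=7$. Then there exist a point $P$, a plane $\pi$ not containing $P$, and a hyperoval $O$ in $\pi$ such that, with $C$ the set of the six lines joining $P$ to the points of $O$, $\mathcal L$ consists exactly of: the lines of $C$; the lines not through $P$ and containing no point of $O$ that meet two lines of $C$ (the $2$-secants of $C$); and the lines contained in $\pi$ that contain no point of $O$. In other words, a Cameron–Liebler line class with parameter $7$ in $PG(3,4)$ is unique, namely the one arising from this construction.
   Context: A set $\mathcal L$ of lines of $PG(3,q)$ is a Cameron–Liebler line class with parameter $x$ (an integer) if for every line $l$, $|\{m\in\mathcal L\setminus\{l\}: m \text{ meets } l\}| = (q+1)x+(q^2-1)\chi_{\mathcal L}(l)$, where $\chi_{\mathcal L}$ is the characteristic function of $\mathcal L$. A hyperoval in a projective plane of order $q$ is a set of $q+2$ points no three of which are collinear. -}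

module Defs where

open import Data.Bool using (Bool; true; false; _∧_; _∨_; not; if_then_else_; T)
open import Data.Nat using (ℕ; zero; suc; _+_; _*_; _∸_; _^_)
open import Data.Product using (Σ; _×_; _,_; proj₁; proj₂)
open import Data.List using (List; []; _∷_; concatMap; map; filterᵇ; length; mapMaybe)
open import Data.Bool.ListAction using (any)
open import Data.Maybe using (Maybe; just; nothing)
open import Data.Vec using (Vec; []; _∷_; zipWith)
open import Relation.Binary.PropositionalEquality using (_≡_; _≢_)
open import Relation.Nullary using (¬_)

data GF4 : Set where
  𝟎 𝟏 ω ω² : GF4

infixl 6 _⊕_
infixl 7 _⊗_

_⊕_ : GF4 → GF4 → GF4
𝟎  ⊕ y  = y
𝟏  ⊕ 𝟎  = 𝟏
𝟏  ⊕ 𝟏  = 𝟎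
𝟏  ⊕ ω  = ω²
𝟏  ⊕ ω² = ω
ω  ⊕ 𝟎  = ω
ω  ⊕ 𝟏  = ω²
ω  ⊕ ω  = 𝟎
ω  ⊕ ω² = 𝟏
ω² ⊕ 𝟎  = ω²
ω² ⊕ 𝟏  = ω
ω² ⊕ ω  = 𝟏
ω² ⊕ ω² = 𝟎

_⊗_ : GF4 → GF4 → GF4
𝟎  ⊗ y  = 𝟎
𝟏  ⊗ y  = y
ω  ⊗ 𝟎  = 𝟎
ω  ⊗ 𝟏  = ω
ω  ⊗ ω  = ω²
ω  ⊗ ω² = 𝟏
ω² ⊗ 𝟎  = 𝟎
ω² ⊗ 𝟏  = ω²
ω² ⊗ ω  = 𝟏
ω² ⊗ ω² = ω

_==_ : GF4 → GF4 → Bool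
𝟎  == 𝟎  = true
𝟏  == 𝟏  = true
ω  == ω  = true
ω² == ω² = true
_  == _  = false

allGF4 : List GF4
allGF4 = 𝟎 ∷ 𝟏 ∷ ω ∷ ω² ∷ []

q : ℕ
q = 4

Vec4 : Set
Vec4 = Vec GF4 4

allVecs : (n : ℕ) → List (Vec GF4 n)
allVecs zero    = [] ∷ []
allVecs (suc n) = concatMap (λ a → map (a ∷_) (allVecs n)) allGF4

_==v_ : ∀ {n} → Vec GF4 n → Vec GF4 n → Bool
[]       ==v []       = true
(a ∷ as) ==v (b ∷ bs) = (a == b) ∧ (as ==v bs)

scale : ∀ {n} → GF4 → Vec GF4 n → Vec GF4 n
scale a []       = []
scale a (x ∷ xs) = a ⊗ x ∷ scale a xs

_+v_ : ∀ {n} → Vec GF4 n → Vec GF4 n → Vec GF4 n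
_+v_ = zipWith _⊕_

dot : ∀ {n} → Vec GF4 n → Vec GF4 n → GF4
dot []       []       = 𝟎
dot (x ∷ xs) (y ∷ ys) = x ⊗ y ⊕ dot xs ys

isZeroVec : ∀ {n} → Vec GF4 n → Bool
isZeroVec []       = true
isZeroVec (x ∷ xs) = (x == 𝟎) ∧ isZeroVec xs

isNormalized : ∀ {n} → Vec GF4 n → Bool
isNormalized []        = false
isNormalized (𝟎 ∷ xs)  = isNormalized xs
isNormalized (𝟏 ∷ xs)  = true
isNormalized (ω ∷ xs)  = false
isNormalized (ω² ∷ xs) = false

-- A 2×4 matrix (rows r₁, r₂) in reduced row echelon form of rank 2.
-- Recursion on columns: both rows still before their pivots, or r₁ has passed
-- its pivot and r₂ has not.
isRREF : ∀ {n} → Vec GF4 n → Vec GF4 n → Bool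
isRREFafter : ∀ {n} → Vec GF4 n → Vec GF4 n → Bool
isRREF []       []       = false
isRREF (𝟎 ∷ xs) (𝟎 ∷ ys) = isRREF xs ys
isRREF (𝟏 ∷ xs) (𝟎 ∷ ys) = isRREFafter xs ys
isRREF (_ ∷ xs) (_ ∷ ys) = false
isRREFafter []       []       = false
isRREFafter (x ∷ xs) (𝟎 ∷ ys) = isRREFafter xs ys
isRREFafter (𝟎 ∷ xs) (𝟏 ∷ ys) = true
isRREFafter (_ ∷ xs) (_ ∷ ys) = false

decT : (b : Bool) → Maybe (T b)
decT true  = just _
decT false = nothing

-- Points: 1-dimensional subspaces of GF(4)^4, via their normalized spanning vector.
Point : Set
Point = Σ Vec4 (λ v → T (isNormalized v))

-- Lines: 2-dimensional subspaces of GF(4)^4, via the RREF basis (r₁ , r₂).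
Line : Set
Line = Σ (Vec4 × Vec4) (λ r → T (isRREF (proj₁ r) (proj₂ r)))

-- Planes: 3-dimensional subspaces of GF(4)^4, i.e. kernels {v | a·v = 0}
-- of a nonzero functional a, given by its normalized coefficient vector.
Plane : Set
Plane = Σ Vec4 (λ a → T (isNormalized a))

allPoints : List Point
allPoints = mapMaybe (λ v → Data.Maybe.map (v ,_) (decT (isNormalized v))) (allVecs 4)

allLines : List Line
allLines = concatMap
  (λ r₁ → mapMaybe (λ r₂ → Data.Maybe.map ((r₁ , r₂) ,_) (decT (isRREF r₁ r₂))) (allVecs 4))
  (allVecs 4)

onLine : Point → Line → Bool
onLine (p , _) ((r₁ , r₂) , _) =
  any (λ a → any (λ b → (scale a r₁ +v scale b r₂) ==v p) allGF4) allGF4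

onPlane : Point → Plane → Bool
onPlane (p , _) (a , _) = dot a p == 𝟎

sameLine : Line → Line → Bool
sameLine ((r₁ , r₂) , _) ((s₁ , s₂) , _) = (r₁ ==v s₁) ∧ (r₂ ==v s₂)

meets : Line → Line → Bool
meets l m = any (λ P → onLine P l ∧ onLine P m) allPoints

OnLine : Point → Line → Set
OnLine P l = onLine P l ≡ true

InPlane : Point → Plane → Set
InPlane P π = onPlane P π ≡ true

Meets : Line → Line → Set
Meets l m = Σ Point (λ Q → OnLine Q l × OnLine Q m)

LineInPlane : Line → Plane → Set
LineInPlane l π = ∀ (Q : Point) → OnLine Q l → InPlane Q π

χ : (Line → Bool) → Line → ℕ
χ L l = if L l then 1 else 0

countMeeting : (Line → Bool) → Line → ℕ
countMeeting L l = length (filterᵇ (λ m → L m ∧ not (sameLine m l) ∧ meets m l) allLines)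

IsCameronLiebler : ℕ → (Line → Bool) → Set
IsCameronLiebler x L =
  ∀ (l : Line) → countMeeting L l ≡ (q + 1) * x + (q ^ 2 ∸ 1) * χ L l

IsHyperovalIn : Plane → (Point → Bool) → Set
IsHyperovalIn π O =
  (∀ (Q : Point) → O Q ≡ true → InPlane Q π)
  × (length (filterᵇ O allPoints) ≡ q + 2)
  × (∀ (Q₁ Q₂ Q₃ : Point) → O Q₁ ≡ true → O Q₂ ≡ true → O Q₃ ≡ true →
       proj₁ Q₁ ≢ proj₁ Q₂ → proj₁ Q₁ ≢ proj₁ Q₃ → proj₁ Q₂ ≢ proj₁ Q₃ →
       ¬ Σ Line (λ l → OnLine Q₁ l × OnLine Q₂ l × OnLine Q₃ l))

InC : Point → (Point → Bool) → Line → Set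
InC P O l = OnLine P l × Σ Point (λ Q → O Q ≡ true × OnLine Q l)

MissesO : (Point → Bool) → Line → Set
MissesO O l = ∀ (Q : Point) → O Q ≡ true → ¬ OnLine Q l

IsTwoSecant : Point → (Point → Bool) → Line → Set
IsTwoSecant P O l =
  ¬ OnLine P l × MissesO O l ×
  Σ Line (λ c₁ → Σ Line (λ c₂ →
    proj₁ c₁ ≢ proj₁ c₂ × InC P O c₁ × InC P O c₂ × Meets l c₁ × Meets l c₂))

{-# OPTIONS --safe #-}
module Submission where

-- Let χ be the characteristic function of the class, and let s(P), m(π) be the
-- numbers of its lines through the point P and in the plane π. Double counting
-- gives |L| = 147, s(P) + m(π) = 7 + 5 k for a flag P ∈ π whose pencil
-- contains k lines of the class, and, for every line l, Σ s = Σ m = 35 + 20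
-- χ(l) and Σ s² + Σ m² = 630 + 780 χ(l), the sums running over the points and
-- the planes of l. Modulo 25 this forces s = 5u + 1 and m = 5w + 1, where 0 ≤
-- u, w ≤ 4, Σ u = Σ w = 6 + 4 χ(l), Σ u² + Σ w² = 20 + 28 χ(l), and χ(l) + 1 ≤
-- u(P) + w(π) ≤ χ(l) + 5 for P ∈ l ⊂ π. Hence the values of u on a line are
-- 21111, 31110 or 22200 if the line is not in the class, and 22222, 33211,
-- 33310, 43111 or 42220 if it is.
--
-- In each case one or all five values are even, so the points with u even are
-- all points or those of a plane π. The value 4 is excluded, then the first
-- alternative, and counting on π gives w(π) = 1, so that u vanishes on a set O
-- of six points of π and is 2 on the rest of π. Each point of O is on exactly
-- one line of the class, of type 33310, and each point with u = 3 is on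
-- exactly one of these six generators. All planes on a generator have weight
-- 2, whereas the line joining two points of O is in only one plane of weight
-- 2; so any two generators are coplanar and meet, necessarily in a point with
-- u = 1. So they all pass through one point P, and the types of the lines
-- translate into the description of L.

-- Linear counts determine `s P + m π` on a flag only modulo 5. It is the count of squares, read
-- modulo 25 on a line, that fixes the residue 1 on both sides; read exactly, it limits the types.
--
-- The value 4 is excluded as follows. If u(P) = 4, every plane on P has weight 2 and contains lines
-- of the class off P. When all points of such a plane are even, such a line lies in a plane of
-- weight 4 and in a plane of weight 0. A plane of weight 4 has u = 2 throughout, and a plane of
-- weight 0 contains odd points; each alternative for the set of even points contradicts one of
-- these facts.
--
-- Points, lines and planes are handled through the incidence numbers collected in `Space`, so that
-- evaluation in PG(3,4) is confined to checking those numbers. Joining lines, meeting points and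
-- the plane of even points are all obtained by counting.

open import Defs hiding (q; χ)
open import Data.Bool using (Bool; true; false; _∧_; not; if_then_else_; T)
open import Data.Bool.ListAction using (any; all)
open import Data.Bool.Properties using (T-irrelevant; T?)
open import Data.Empty using (⊥; ⊥-elim)
open import Data.Fin using (Fin; zero; suc; toℕ; fromℕ<; #_)
open import Data.Fin.Properties using (all?; toℕ-fromℕ<)
open import Data.List using (List; []; _∷_; map; _++_; concatMap; mapMaybe; filterᵇ; length)
open import Data.List.Relation.Unary.Any using (Any; any?; satisfied)
open import Data.Maybe as Maybe using (Maybe; just; nothing; maybe′)
open import Data.Nat using (ℕ; zero; suc; _+_; _*_; _∸_; _≤_; _<_; z≤n; s≤s; _≤?_; _≡ᵇ_; _/_; _%_)
  renaming (_≟_ to _≟ⁿ_)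
open import Data.Nat.DivMod using (m≡m%n+[m/n]*n; m%n<n; [m+kn]%n≡m%n; %-distribˡ-+)
open import Data.Nat.Properties hiding (_≟_)
open import Data.Nat.Tactic.RingSolver using (solve-∀)
open import Data.Product using (Σ; ∃; _×_; _,_; proj₁; proj₂)
open import Data.Sum using (_⊎_; inj₁; inj₂; [_,_]′)
open import Data.Vec using (Vec; []; _∷_)
open import Data.Vec.Properties using (≡-dec)
open import Function using (_∘_; case_of_)
open import Function.Bundles using (_⇔_; mk⇔; Equivalence)
open import Relation.Binary using (DecidableEquality)
open import Relation.Binary.PropositionalEquality
open import Relation.Nullary using (¬_; Dec; yes; no; does)
open import Relation.Nullary.Decidable using (dec-true; dec-false; map′; toWitness; _×-dec_; _⊎-dec_; _→-dec_)

-- Sums over finite types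

⟦_⟧ : Bool → ℕ
⟦ true ⟧  = 1
⟦ false ⟧ = 0

⟦⟧≡1 : ∀ {b} → ⟦ b ⟧ ≡ 1 → b ≡ true
⟦⟧≡1 {true} _ = refl

⟦⟧-injective : ∀ {a b} → ⟦ a ⟧ ≡ ⟦ b ⟧ → a ≡ b
⟦⟧-injective {true}  {true}  _ = refl
⟦⟧-injective {false} {false} _ = refl

⟦⟧≤1 : ∀ b → ⟦ b ⟧ ≤ 1
⟦⟧≤1 true  = s≤s z≤n
⟦⟧≤1 false = z≤n

⟦⟧*-mono : ∀ b {m n} → (b ≡ true → m ≤ n) → ⟦ b ⟧ * m ≤ ⟦ b ⟧ * n
⟦⟧*-mono true  m≤n = *-monoʳ-≤ 1 (m≤n refl)
⟦⟧*-mono false _   = z≤n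

⟦⟧*-cong : ∀ b {m n} → (b ≡ true → m ≡ n) → ⟦ b ⟧ * m ≡ ⟦ b ⟧ * n
⟦⟧*-cong true  m≡n = cong (1 *_) (m≡n refl)
⟦⟧*-cong false _   = refl

⟦⟧-mono : ∀ {a b} → (a ≡ true → b ≡ true) → ⟦ a ⟧ ≤ ⟦ b ⟧
⟦⟧-mono {true} f rewrite f refl = ≤-refl
⟦⟧-mono {false} _ = z≤n

true≢false : ∀ {b} → b ≡ true → b ≡ false → ⊥
true≢false refl ()

-- Adding the hypothesis a ≡ b crosswise turns a linear consequence into a
-- semiring identity.
cross : ∀ {a b x y} → a ≡ b → x + b ≡ y + a → x ≡ y
cross {a} {_} {x} {y} refl eq = +-cancelʳ-≡ a x y eq

∑ : {A : Set} → List A → (A → ℕ) → ℕ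
∑ []       f = 0
∑ (x ∷ xs) f = f x + ∑ xs f

module _ {A : Set} where

  ∑-cong : ∀ xs {f g : A → ℕ} → (∀ x → f x ≡ g x) → ∑ xs f ≡ ∑ xs g
  ∑-cong []       f≡g = refl
  ∑-cong (x ∷ xs) f≡g = cong₂ _+_ (f≡g x) (∑-cong xs f≡g)

  ∑-mono : ∀ xs {f g : A → ℕ} → (∀ x → f x ≤ g x) → ∑ xs f ≤ ∑ xs g
  ∑-mono []       f≤g = z≤n
  ∑-mono (x ∷ xs) f≤g = +-mono-≤ (f≤g x) (∑-mono xs f≤g)

  ∑-+ : ∀ xs (f g : A → ℕ) → ∑ xs (λ x → f x + g x) ≡ ∑ xs f + ∑ xs g
  ∑-+ []       f g = refl
  ∑-+ (x ∷ xs) f g rewrite ∑-+ xs f g = lemma (f x) (g x) (∑ xs f) (∑ xs g)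
    where
    lemma : ∀ a b c d → (a + b) + (c + d) ≡ (a + c) + (b + d)
    lemma = solve-∀

  ∑-*ˡ : ∀ xs c (f : A → ℕ) → ∑ xs (λ x → c * f x) ≡ c * ∑ xs f
  ∑-*ˡ []       c f = sym (*-zeroʳ c)
  ∑-*ˡ (x ∷ xs) c f rewrite ∑-*ˡ xs c f = sym (*-distribˡ-+ c (f x) (∑ xs f))

  ∑-0 : ∀ (xs : List A) → ∑ xs (λ _ → 0) ≡ 0
  ∑-0 []       = refl
  ∑-0 (x ∷ xs) = ∑-0 xs

module _ {A B : Set} where

  ∑-swap : ∀ (xs : List A) (ys : List B) (f : A → B → ℕ) →
    ∑ xs (λ x → ∑ ys (f x)) ≡ ∑ ys (λ y → ∑ xs (λ x → f x y))
  ∑-swap []       ys f = sym (∑-0 ys)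
  ∑-swap (x ∷ xs) ys f rewrite ∑-swap xs ys f = sym (∑-+ ys (f x) _)

  -- With `a` an incidence matrix this is double counting: the matrix is moved, transposed, from one
  -- side of a pairing to the other.
  ∑-adjoint : ∀ (xs : List A) (ys : List B) (f : A → ℕ) (a : A → B → ℕ) (g : B → ℕ) →
    ∑ xs (λ x → f x * ∑ ys (λ y → a x y * g y)) ≡
    ∑ ys (λ y → g y * ∑ xs (λ x → f x * a x y))
  ∑-adjoint xs ys f a g = begin
    ∑ xs (λ x → f x * ∑ ys (λ y → a x y * g y))
      ≡⟨ ∑-cong xs (λ x → sym (∑-*ˡ ys (f x) _)) ⟩
    ∑ xs (λ x → ∑ ys (λ y → f x * (a x y * g y)))
      ≡⟨ ∑-swap xs ys _ ⟩
    ∑ ys (λ y → ∑ xs (λ x → f x * (a x y * g y)))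
      ≡⟨ ∑-cong ys (λ y → ∑-cong xs (λ x → lemma (f x) (a x y) (g y))) ⟩
    ∑ ys (λ y → ∑ xs (λ x → g y * (f x * a x y)))
      ≡⟨ ∑-cong ys (λ y → ∑-*ˡ xs (g y) _) ⟩
    ∑ ys (λ y → g y * ∑ xs (λ x → f x * a x y)) ∎
    where
    open ≡-Reasoning
    lemma : ∀ a b c → a * (b * c) ≡ c * (a * b)
    lemma = solve-∀

-- `once` expresses completeness and absence of repetitions together, in a form that lets a
-- Kronecker delta be inserted into any sum.
record Finite (A : Set) : Set where
  field
    elements : List A
    _≟_      : DecidableEquality A
    once     : ∀ x → ∑ elements (λ y → ⟦ does (x ≟ y) ⟧) ≡ 1

module Sum {A : Set} (fin : Finite A) where

  open Finite fin

  Σ′ : (A → ℕ) → ℕ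
  Σ′ = ∑ elements

  Σ-cong : {f g : A → ℕ} → (∀ x → f x ≡ g x) → Σ′ f ≡ Σ′ g
  Σ-cong = ∑-cong elements

  Σ-mono : {f g : A → ℕ} → (∀ x → f x ≤ g x) → Σ′ f ≤ Σ′ g
  Σ-mono = ∑-mono elements

  Σ-+ : ∀ (f g : A → ℕ) → Σ′ (λ x → f x + g x) ≡ Σ′ f + Σ′ g
  Σ-+ = ∑-+ elements

  Σ-* : ∀ c (f : A → ℕ) → Σ′ (λ x → c * f x) ≡ c * Σ′ f
  Σ-* = ∑-*ˡ elements

  Σ-*ʳ : ∀ (f : A → ℕ) c → Σ′ (λ x → f x * c) ≡ Σ′ f * c
  Σ-*ʳ f c = trans (Σ-cong (λ x → *-comm (f x) c)) (trans (Σ-* c f) (*-comm c (Σ′ f)))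

  Σ-affine : ∀ (f g : A → ℕ) a b → Σ′ (λ x → f x * (g x * a + b)) ≡ Σ′ (λ x → f x * g x) * a + Σ′ f * b
  Σ-affine f g a b = begin
    Σ′ (λ x → f x * (g x * a + b))           ≡⟨ Σ-cong (λ x → lemma (f x) (g x) a b) ⟩
    Σ′ (λ x → f x * g x * a + f x * b)       ≡⟨ Σ-+ _ _ ⟩
    Σ′ (λ x → f x * g x * a) + Σ′ (λ x → f x * b) ≡⟨ cong₂ _+_ (Σ-*ʳ _ a) (Σ-*ʳ f b) ⟩
    Σ′ (λ x → f x * g x) * a + Σ′ f * b      ∎
    where
    open ≡-Reasoning
    lemma : ∀ x y a b → x * (y * a + b) ≡ x * y * a + x * b
    lemma = solve-∀

  δ : A → A → ℕ
  δ x y = ⟦ does (x ≟ y) ⟧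

  δ-refl : ∀ x → δ x x ≡ 1
  δ-refl x = cong ⟦_⟧ (dec-true (x ≟ x) refl)

  δ-≢ : ∀ {x y} → x ≢ y → δ x y ≡ 0
  δ-≢ {x} {y} x≢y = cong ⟦_⟧ (dec-false (x ≟ y) x≢y)

  Σ-δ : ∀ x (g : A → ℕ) → Σ′ (λ y → g y * δ x y) ≡ g x
  Σ-δ x g = begin
    Σ′ (λ y → g y * δ x y) ≡⟨ Σ-cong same ⟩
    Σ′ (λ y → g x * δ x y) ≡⟨ Σ-* (g x) (δ x) ⟩
    g x * Σ′ (δ x)         ≡⟨ cong (g x *_) (once x) ⟩
    g x * 1                ≡⟨ *-identityʳ (g x) ⟩
    g x                    ∎
    where
    open ≡-Reasoning
    same : ∀ y → g y * δ x y ≡ g x * δ x y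
    same y with x ≟ y
    ... | yes refl = refl
    ... | no _     = trans (*-zeroʳ (g y)) (sym (*-zeroʳ (g x)))

  term≤Σ : ∀ (g : A → ℕ) x → g x ≤ Σ′ g
  term≤Σ g x = subst (_≤ Σ′ g) (Σ-δ x g) (Σ-mono bound)
    where
    bound : ∀ y → g y * δ x y ≤ g y
    bound y = ≤-trans (*-monoʳ-≤ (g y) (⟦⟧≤1 (does (x ≟ y)))) (≤-reflexive (*-identityʳ (g y)))

  two-terms≤Σ : ∀ (g : A → ℕ) {x y} → x ≢ y → g x + g y ≤ Σ′ g
  two-terms≤Σ g {x} {y} x≢y = subst (_≤ Σ′ g) eq (Σ-mono bound)
    where
    eq : Σ′ (λ z → g z * δ x z + g z * δ y z) ≡ g x + g y
    eq = trans (Σ-+ _ _) (cong₂ _+_ (Σ-δ x g) (Σ-δ y g))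
    bound : ∀ z → g z * δ x z + g z * δ y z ≤ g z
    bound z with x ≟ z | y ≟ z
    ... | yes refl | yes refl = ⊥-elim (x≢y refl)
    ... | yes _    | no _     = ≤-reflexive (lemma (g z))
      where
      lemma : ∀ n → n * 1 + n * 0 ≡ n
      lemma = solve-∀
    ... | no _     | yes _    = ≤-reflexive (lemma (g z))
      where
      lemma : ∀ n → n * 0 + n * 1 ≡ n
      lemma = solve-∀
    ... | no _     | no _     = ≤-trans (≤-reflexive (lemma (g z))) z≤n
      where
      lemma : ∀ n → n * 0 + n * 0 ≡ 0
      lemma = solve-∀

  -- The factor `1 ∸ δ x t` deletes the term at `x`, which leaves the case of two terms.
  three-terms≤Σ : ∀ (g : A → ℕ) {x y z} → x ≢ y → x ≢ z → y ≢ z → g x + (g y + g z) ≤ Σ′ g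
  three-terms≤Σ g {x} {y} {z} x≢y x≢z y≢z = subst (g x + (g y + g z) ≤_) (sym split) (+-monoʳ-≤ (g x)
    (subst (_≤ Σ′ rest) (cong₂ _+_ (keeps x≢y) (keeps x≢z)) (two-terms≤Σ rest y≢z)))
    where
    rest : A → ℕ
    rest t = g t * (1 ∸ δ x t)
    keeps : ∀ {t} → x ≢ t → rest t ≡ g t
    keeps {t} x≢t = trans (cong (λ n → g t * (1 ∸ n)) (δ-≢ x≢t)) (*-identityʳ (g t))
    split : Σ′ g ≡ g x + Σ′ rest
    split = begin
      Σ′ g                                   ≡⟨ Σ-cong (λ t → *-identityʳ (g t)) ⟨
      Σ′ (λ t → g t * 1)                     ≡⟨ Σ-cong (λ t → cong (g t *_) (m+[n∸m]≡n (⟦⟧≤1 (does (x ≟ t))))) ⟨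
      Σ′ (λ t → g t * (δ x t + (1 ∸ δ x t))) ≡⟨ Σ-cong (λ t → *-distribˡ-+ (g t) _ _) ⟩
      Σ′ (λ t → g t * δ x t + rest t)        ≡⟨ Σ-+ _ rest ⟩
      Σ′ (λ t → g t * δ x t) + Σ′ rest       ≡⟨ cong (_+ Σ′ rest) (Σ-δ x g) ⟩
      g x + Σ′ rest                          ∎
      where open ≡-Reasoning

  -- The differences `g x ∸ f x` are exact and add up to zero. For characteristic functions: an
  -- inclusion between sets of equal size is an equality.
  Σ≡⇒≡ : ∀ {f g : A → ℕ} → (∀ x → f x ≤ g x) → Σ′ f ≡ Σ′ g → ∀ x → f x ≡ g x
  Σ≡⇒≡ {f} {g} f≤g Σf≡Σg x = ≤-antisym (f≤g x) (m∸n≡0⇒m≤n (n≤0⇒n≡0 gap))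
    where
    split : Σ′ f + Σ′ (λ x → g x ∸ f x) ≡ Σ′ f + 0
    split = begin
      Σ′ f + Σ′ (λ x → g x ∸ f x)     ≡⟨ Σ-+ f _ ⟨
      Σ′ (λ x → f x + (g x ∸ f x))    ≡⟨ Σ-cong (λ x → m+[n∸m]≡n (f≤g x)) ⟩
      Σ′ g                            ≡⟨ Σf≡Σg ⟨
      Σ′ f                            ≡⟨ +-identityʳ _ ⟨
      Σ′ f + 0                        ∎
      where open ≡-Reasoning
    gap : g x ∸ f x ≤ 0
    gap = ≤-trans (term≤Σ (λ x → g x ∸ f x) x) (≤-reflexive (+-cancelˡ-≡ (Σ′ f) _ 0 split))

  -- A failed run through the list is conclusive because the sum of `p` against a delta recovers the
  -- value of `p` at each element.
  search : (p : A → Bool) → (∃ λ x → p x ≡ true) ⊎ (∀ x → p x ≡ false)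
  search p = [ inj₁ , (λ none → inj₂ λ x → absent x (none x)) ]′ (go elements)
    where
    go : ∀ xs → (∃ λ x → p x ≡ true) ⊎ (∀ x → ∑ xs (λ y → ⟦ p y ⟧ * δ x y) ≡ 0)
    go [] = inj₂ (λ _ → refl)
    go (y ∷ ys) with p y in py | go ys
    ... | true  | _         = inj₁ (y , py)
    ... | false | inj₁ hit  = inj₁ hit
    ... | false | inj₂ none = inj₂ none
    absent : ∀ x → Σ′ (λ y → ⟦ p y ⟧ * δ x y) ≡ 0 → p x ≡ false
    absent x none with p x | trans (sym (Σ-δ x (λ y → ⟦ p y ⟧))) none
    ... | false | _ = refl

  Σ-positive : ∀ (g : A → ℕ) → 1 ≤ Σ′ g → ∃ λ x → 1 ≤ g x
  Σ-positive g 1≤Σ with search (λ x → does (1 ≤? g x))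
  ... | inj₁ (x , found) = x , positive (g x) found
    where
    positive : ∀ n → does (1 ≤? n) ≡ true → 1 ≤ n
    positive (suc n) _ = s≤s z≤n
  ... | inj₂ none = ⊥-elim (1+n≰n (≤-trans 1≤Σ (≤-reflexive (trans (Σ-cong zeros) (∑-0 elements)))))
    where
    zeros : ∀ x → g x ≡ 0
    zeros x with g x | none x
    ... | zero | _ = refl

  Σ≤1-unique : ∀ (g : A → ℕ) → Σ′ g ≤ 1 → ∀ {x y} → 1 ≤ g x → 1 ≤ g y → x ≡ y
  Σ≤1-unique g Σ≤1 {x} {y} gx gy with x ≟ y
  ... | yes x≡y = x≡y
  ... | no  x≢y = ⊥-elim (1+n≰n (≤-trans (+-mono-≤ gx gy) (≤-trans (two-terms≤Σ g x≢y) Σ≤1)))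

  unique-Σ≤1 : ∀ (g : A → ℕ) → (∀ x → g x ≤ 1) →
    (∀ {x y} → 1 ≤ g x → 1 ≤ g y → x ≡ y) → Σ′ g ≤ 1
  unique-Σ≤1 g g≤1 unique with 1 ≤? Σ′ g
  ... | no  1≰Σ = ≤-trans (≤-pred (≰⇒> 1≰Σ)) z≤n
  ... | yes 1≤Σ with Σ-positive g 1≤Σ
  ... | x , 1≤gx = ≤-trans (≤-reflexive (trans (Σ-cong concentrated) (Σ-δ x g))) (g≤1 x)
    where
    concentrated : ∀ y → g y ≡ g y * δ x y
    concentrated y with x ≟ y
    ... | yes refl = sym (*-identityʳ (g y))
    ... | no  x≢y with g y in gy
    ...   | zero  = refl
    ...   | suc _ = ⊥-elim (x≢y (unique 1≤gx (subst (1 ≤_) (sym gy) (s≤s z≤n))))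

-- Incidence in projective 3-space of order 4

record Space : Set₁ where
  infix 8 _∈ˡ_ _∈ᵖ_ _⊂_
  field
    Pt Ln Pl : Set
    finPt    : Finite Pt
    finLn    : Finite Ln
    finPl    : Finite Pl
    _∈ˡ_     : Pt → Ln → Bool
    _∈ᵖ_     : Pt → Pl → Bool
    _⊂_      : Ln → Pl → Bool

  module Pts = Sum finPt
  module Lns = Sum finLn
  module Pls = Sum finPl

  field
    #points         : Pts.Σ′ (λ _ → 1) ≡ 85
    #planes         : Pls.Σ′ (λ _ → 1) ≡ 85
    points-on-line  : ∀ l → Pts.Σ′ (λ P → ⟦ P ∈ˡ l ⟧) ≡ 5
    planes-on-line  : ∀ l → Pls.Σ′ (λ π → ⟦ l ⊂ π ⟧) ≡ 5
    points-in-plane : ∀ π → Pts.Σ′ (λ P → ⟦ P ∈ᵖ π ⟧) ≡ 21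
    planes-on-point : ∀ P → Pls.Σ′ (λ π → ⟦ P ∈ᵖ π ⟧) ≡ 21
    lines-on-point  : ∀ P → Lns.Σ′ (λ l → ⟦ P ∈ˡ l ⟧) ≡ 21
    lines-in-plane  : ∀ π → Lns.Σ′ (λ l → ⟦ l ⊂ π ⟧) ≡ 21
    -- One common point, or all five if the line lies in the plane; the next field is the dual
    -- statement.
    line-plane      : ∀ l π → Pts.Σ′ (λ P → ⟦ P ∈ˡ l ⟧ * ⟦ P ∈ᵖ π ⟧) ≡ 1 + 4 * ⟦ l ⊂ π ⟧
    line-point      : ∀ l P → Pls.Σ′ (λ π → ⟦ l ⊂ π ⟧ * ⟦ P ∈ᵖ π ⟧) ≡ 1 + 4 * ⟦ P ∈ˡ l ⟧
    line-ext        : ∀ {l m} → (∀ P → P ∈ˡ l ≡ P ∈ˡ m) → l ≡ m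

module Geometry (S : Space) where

  open Space S public
  open ≡-Reasoning

  -- By `line-plane` there are five common points, which is all that the line has.
  ⊂⇒∈ᵖ : ∀ {P l π} → P ∈ˡ l ≡ true → l ⊂ π ≡ true → P ∈ᵖ π ≡ true
  ⊂⇒∈ᵖ {P} {l} {π} P∈l l⊂π = ⟦⟧≡1 (begin
    ⟦ P ∈ᵖ π ⟧               ≡⟨ *-identityˡ _ ⟨
    1 * ⟦ P ∈ᵖ π ⟧           ≡⟨ cong (λ b → ⟦ b ⟧ * ⟦ P ∈ᵖ π ⟧) P∈l ⟨
    ⟦ P ∈ˡ l ⟧ * ⟦ P ∈ᵖ π ⟧  ≡⟨ Pts.Σ≡⇒≡ bound total P ⟩
    ⟦ P ∈ˡ l ⟧               ≡⟨ cong ⟦_⟧ P∈l ⟩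
    1                        ∎)
    where
    bound : ∀ Q → ⟦ Q ∈ˡ l ⟧ * ⟦ Q ∈ᵖ π ⟧ ≤ ⟦ Q ∈ˡ l ⟧
    bound Q = ≤-trans (*-monoʳ-≤ ⟦ Q ∈ˡ l ⟧ (⟦⟧≤1 (Q ∈ᵖ π))) (≤-reflexive (*-identityʳ _))
    total : Pts.Σ′ (λ Q → ⟦ Q ∈ˡ l ⟧ * ⟦ Q ∈ᵖ π ⟧) ≡ Pts.Σ′ (λ Q → ⟦ Q ∈ˡ l ⟧)
    total = trans (line-plane l π) (trans (cong (λ b → 1 + 4 * ⟦ b ⟧) l⊂π) (sym (points-on-line l)))

  -- Two common points exceed the single one of a line that does not lie in the plane.
  span⊂ : ∀ {P Q l π} → P ≢ Q → P ∈ˡ l ≡ true → Q ∈ˡ l ≡ true →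
    P ∈ᵖ π ≡ true → Q ∈ᵖ π ≡ true → l ⊂ π ≡ true
  span⊂ {P} {Q} {l} {π} P≢Q P∈l Q∈l P∈π Q∈π
    with l ⊂ π | line-plane l π | Pts.two-terms≤Σ (λ R → ⟦ R ∈ˡ l ⟧ * ⟦ R ∈ᵖ π ⟧) P≢Q
  ... | true  | _  | _ = refl
  ... | false | eq | two rewrite P∈l | Q∈l | P∈π | Q∈π = ⊥-elim (1+n≰n (≤-trans two (≤-reflexive eq)))

  -- Every plane on `l` contains both points and hence `m`; as both lines have five planes, these
  -- coincide, and `line-point` recovers the points of a line from its planes.
  line-unique : ∀ {P Q l m} → P ≢ Q → P ∈ˡ l ≡ true → Q ∈ˡ l ≡ true →
    P ∈ˡ m ≡ true → Q ∈ˡ m ≡ true → l ≡ m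
  line-unique {P} {Q} {l} {m} P≢Q P∈l Q∈l P∈m Q∈m = line-ext same-points
    where
    same-planes : ∀ π → ⟦ l ⊂ π ⟧ ≡ ⟦ m ⊂ π ⟧
    same-planes = Pls.Σ≡⇒≡
      (λ π → ⟦⟧-mono (λ l⊂π → span⊂ P≢Q P∈m Q∈m (⊂⇒∈ᵖ P∈l l⊂π) (⊂⇒∈ᵖ Q∈l l⊂π)))
      (trans (planes-on-line l) (sym (planes-on-line m)))
    same-points : ∀ R → R ∈ˡ l ≡ R ∈ˡ m
    same-points R = ⟦⟧-injective (*-cancelˡ-≡ _ _ 4 (suc-injective (begin
      1 + 4 * ⟦ R ∈ˡ l ⟧                        ≡⟨ line-point l R ⟨
      Pls.Σ′ (λ π → ⟦ l ⊂ π ⟧ * ⟦ R ∈ᵖ π ⟧)     ≡⟨ Pls.Σ-cong (λ π → cong (_* ⟦ R ∈ᵖ π ⟧) (same-planes π)) ⟩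
      Pls.Σ′ (λ π → ⟦ m ⊂ π ⟧ * ⟦ R ∈ᵖ π ⟧)     ≡⟨ line-point m R ⟩
      1 + 4 * ⟦ R ∈ˡ m ⟧                        ∎)))

  some-true : ∀ {A : Set} (fin : Finite A) (p : A → Bool) {n} → Sum.Σ′ fin (λ x → ⟦ p x ⟧) ≡ suc n → ∃ λ x → p x ≡ true
  some-true fin p eq with Sum.Σ-positive fin (λ x → ⟦ p x ⟧) (subst (1 ≤_) (sym eq) (s≤s z≤n))
  ... | x , on with p x in px
  ...   | true = x , px

  line-on-point : ∀ P → ∃ λ l → P ∈ˡ l ≡ true
  line-on-point P = some-true finLn (P ∈ˡ_) (lines-on-point P)

  plane-on-point : ∀ P → ∃ λ π → P ∈ᵖ π ≡ true
  plane-on-point P = some-true finPl (P ∈ᵖ_) (planes-on-point P)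

  line-in-plane : ∀ π → ∃ λ l → l ⊂ π ≡ true
  line-in-plane π = some-true finLn (_⊂ π) (lines-in-plane π)

  point-on-line : ∀ l → ∃ λ P → P ∈ˡ l ≡ true
  point-on-line l = some-true finPt (_∈ˡ l) (points-on-line l)

  private
    both : ∀ a b → 1 ≤ ⟦ a ⟧ * ⟦ b ⟧ → a ≡ true × b ≡ true
    both true true _ = refl , refl

    ⟦⟧*⟦⟧≤1 : ∀ a b → ⟦ a ⟧ * ⟦ b ⟧ ≤ 1
    ⟦⟧*⟦⟧≤1 true  true  = s≤s z≤n
    ⟦⟧*⟦⟧≤1 true  false = z≤n
    ⟦⟧*⟦⟧≤1 false _     = z≤n

    ⟦⟧-idem : ∀ a → ⟦ a ⟧ * ⟦ a ⟧ ≡ ⟦ a ⟧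
    ⟦⟧-idem true  = refl
    ⟦⟧-idem false = refl

    Σ85 : ∀ f → Pts.Σ′ (λ Q → 1 + f Q) ≡ 85 + Pts.Σ′ f
    Σ85 f = trans (Pts.Σ-+ (λ _ → 1) f) (cong (_+ Pts.Σ′ f) #points)

  -- Existence of the joining line comes from counting: the 21 lines on P carry
  -- 105 = 85 + 20 points.
  lines-on-two : ∀ P Q → Lns.Σ′ (λ l → ⟦ P ∈ˡ l ⟧ * ⟦ Q ∈ˡ l ⟧) ≡ 1 + 20 * Pts.δ P Q
  lines-on-two P = Pts.Σ≡⇒≡ bound total
    where
    bound : ∀ Q → Lns.Σ′ (λ l → ⟦ P ∈ˡ l ⟧ * ⟦ Q ∈ˡ l ⟧) ≤ 1 + 20 * Pts.δ P Q
    bound Q with Finite._≟_ finPt P Q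
    ... | yes refl = ≤-reflexive (trans (Lns.Σ-cong (λ l → ⟦⟧-idem (P ∈ˡ l))) (lines-on-point P))
    ... | no  P≢Q  = Lns.unique-Σ≤1 _ (λ l → ⟦⟧*⟦⟧≤1 (P ∈ˡ l) (Q ∈ˡ l)) λ {l} {m} onl onm →
      let (P∈l , Q∈l) = both (P ∈ˡ l) _ onl
          (P∈m , Q∈m) = both (P ∈ˡ m) _ onm
      in line-unique P≢Q P∈l Q∈l P∈m Q∈m
    total : Pts.Σ′ (λ Q → Lns.Σ′ (λ l → ⟦ P ∈ˡ l ⟧ * ⟦ Q ∈ˡ l ⟧)) ≡ Pts.Σ′ (λ Q → 1 + 20 * Pts.δ P Q)
    total = begin
      Pts.Σ′ (λ Q → Lns.Σ′ (λ l → ⟦ P ∈ˡ l ⟧ * ⟦ Q ∈ˡ l ⟧))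
        ≡⟨ ∑-swap (Finite.elements finPt) (Finite.elements finLn) _ ⟩
      Lns.Σ′ (λ l → Pts.Σ′ (λ Q → ⟦ P ∈ˡ l ⟧ * ⟦ Q ∈ˡ l ⟧))
        ≡⟨ Lns.Σ-cong (λ l → trans (Pts.Σ-* ⟦ P ∈ˡ l ⟧ _)
             (trans (cong (⟦ P ∈ˡ l ⟧ *_) (points-on-line l)) (*-comm ⟦ P ∈ˡ l ⟧ 5))) ⟩
      Lns.Σ′ (λ l → 5 * ⟦ P ∈ˡ l ⟧)
        ≡⟨ trans (Lns.Σ-* 5 _) (cong (5 *_) (lines-on-point P)) ⟩
      105
        ≡⟨ cong (λ n → 85 + 20 * n) (Finite.once finPt P) ⟨
      85 + 20 * Pts.Σ′ (Pts.δ P)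
        ≡⟨ cong (85 +_) (Pts.Σ-* 20 _) ⟨
      85 + Pts.Σ′ (λ Q → 20 * Pts.δ P Q)
        ≡⟨ Σ85 _ ⟨
      Pts.Σ′ (λ Q → 1 + 20 * Pts.δ P Q) ∎

  join : ∀ {P Q} → P ≢ Q → ∃ λ l → P ∈ˡ l ≡ true × Q ∈ˡ l ≡ true
  join {P} {Q} P≢Q with Lns.Σ-positive (λ l → ⟦ P ∈ˡ l ⟧ * ⟦ Q ∈ˡ l ⟧)
    (≤-reflexive (sym (trans (lines-on-two P Q) (cong (λ n → 1 + 20 * n) (Pts.δ-≢ P≢Q)))))
  ... | l , on = l , both (P ∈ˡ l) (Q ∈ˡ l) on

  plane-through : ∀ l P → ∃ λ π → l ⊂ π ≡ true × P ∈ᵖ π ≡ true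
  plane-through l P with Pls.Σ-positive (λ π → ⟦ l ⊂ π ⟧ * ⟦ P ∈ᵖ π ⟧)
    (subst (1 ≤_) (sym (line-point l P)) (s≤s z≤n))
  ... | π , on = π , both (l ⊂ π) (P ∈ᵖ π) on

  meets-plane : ∀ l π → ∃ λ P → P ∈ˡ l ≡ true × P ∈ᵖ π ≡ true
  meets-plane l π with Pts.Σ-positive (λ P → ⟦ P ∈ˡ l ⟧ * ⟦ P ∈ᵖ π ⟧)
    (subst (1 ≤_) (sym (line-plane l π)) (s≤s z≤n))
  ... | P , on = P , both (P ∈ˡ l) (P ∈ᵖ π) on

  -- Dual to `span⊂`: two planes on `l` through `P` exceed the single one for a point off `l`.
  on-both-planes : ∀ {l π ρ P} → π ≢ ρ → l ⊂ π ≡ true → l ⊂ ρ ≡ true →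
    P ∈ᵖ π ≡ true → P ∈ᵖ ρ ≡ true → P ∈ˡ l ≡ true
  on-both-planes {l} {π} {ρ} {P} π≢ρ l⊂π l⊂ρ P∈π P∈ρ
    with P ∈ˡ l | line-point l P | Pls.two-terms≤Σ (λ π → ⟦ l ⊂ π ⟧ * ⟦ P ∈ᵖ π ⟧) π≢ρ
  ... | true  | _  | _ = refl
  ... | false | eq | two rewrite l⊂π | l⊂ρ | P∈π | P∈ρ = ⊥-elim (1+n≰n (≤-trans two (≤-reflexive eq)))

  -- A second plane `ρ` on `m` has a point in common with `l`; this point lies in `ρ` and in `π`,
  -- hence on `m`.
  coplanar-meet : ∀ {l m π} → l ⊂ π ≡ true → m ⊂ π ≡ true →
    ∃ λ P → P ∈ˡ l ≡ true × P ∈ˡ m ≡ true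
  coplanar-meet {l} {m} {π} l⊂π m⊂π = P , P∈l , on-both-planes (ρ≢π ∘ sym) m⊂π m⊂ρ (⊂⇒∈ᵖ P∈l l⊂π) P∈ρ
    where
    other : ∃ λ ρ → m ⊂ ρ ≡ true × ρ ≢ π
    other with Pls.search (λ ρ → (m ⊂ ρ) ∧ not (does (Finite._≟_ finPl ρ π)))
    ... | inj₁ (ρ , found) with m ⊂ ρ in m⊂ρ | Finite._≟_ finPl ρ π
    ...   | true | no ρ≢π = ρ , m⊂ρ , ρ≢π
    other | inj₂ none = ⊥-elim (case subst (_≤ 1) (planes-on-line m) few of λ { (s≤s ()) })
      where
      only : ∀ {ρ} → 1 ≤ ⟦ m ⊂ ρ ⟧ → ρ ≡ π
      only {ρ} on with m ⊂ ρ | Finite._≟_ finPl ρ π | none ρ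
      ... | true | yes ρ≡π | _ = ρ≡π
      few : Pls.Σ′ (λ ρ → ⟦ m ⊂ ρ ⟧) ≤ 1
      few = Pls.unique-Σ≤1 _ (λ ρ → ⟦⟧≤1 (m ⊂ ρ)) (λ on on′ → trans (only on) (sym (only on′)))
    ρ = proj₁ other
    m⊂ρ = proj₁ (proj₂ other)
    ρ≢π = proj₂ (proj₂ other)
    X = meets-plane l ρ
    P = proj₁ X
    P∈l = proj₁ (proj₂ X)
    P∈ρ = proj₂ (proj₂ X)

  -- Weight functions summed over stars, pencils and planes

  lineSum : (Pt → ℕ) → Ln → ℕ
  lineSum f l = Pts.Σ′ (λ P → ⟦ P ∈ˡ l ⟧ * f P)

  planeSum : (Pt → ℕ) → Pl → ℕ
  planeSum f π = Pts.Σ′ (λ P → ⟦ P ∈ᵖ π ⟧ * f P)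

  -- All 21 lines of the star pass through `P`, and just one of them through any other point.
  star-sum : ∀ f P → Lns.Σ′ (λ l → ⟦ P ∈ˡ l ⟧ * lineSum f l) ≡ Pts.Σ′ f + f P * 20
  star-sum f P = begin
    Lns.Σ′ (λ l → ⟦ P ∈ˡ l ⟧ * lineSum f l)
      ≡⟨ ∑-adjoint (Finite.elements finLn) (Finite.elements finPt) (λ l → ⟦ P ∈ˡ l ⟧) (λ l Q → ⟦ Q ∈ˡ l ⟧) f ⟩
    Pts.Σ′ (λ Q → f Q * Lns.Σ′ (λ l → ⟦ P ∈ˡ l ⟧ * ⟦ Q ∈ˡ l ⟧))
      ≡⟨ Pts.Σ-cong (λ Q → trans (cong (f Q *_) (lines-on-two P Q)) (lemma (f Q) (Pts.δ P Q))) ⟩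
    Pts.Σ′ (λ Q → f Q + f Q * Pts.δ P Q * 20)
      ≡⟨ trans (Pts.Σ-+ f _) (cong (Pts.Σ′ f +_) (trans (Pts.Σ-*ʳ _ 20) (cong (λ n → n * 20) (Pts.Σ-δ P f)))) ⟩
    Pts.Σ′ f + f P * 20 ∎
    where
    lemma : ∀ a d → a * (1 + 20 * d) ≡ a + a * d * 20
    lemma = solve-∀

  -- A point of `l` is on all five planes of `l`, any other point on just one.
  planes-sum : ∀ f l → Pls.Σ′ (λ π → ⟦ l ⊂ π ⟧ * planeSum f π) ≡ Pts.Σ′ f + 4 * lineSum f l
  planes-sum f l = begin
    Pls.Σ′ (λ π → ⟦ l ⊂ π ⟧ * planeSum f π)
      ≡⟨ ∑-adjoint (Finite.elements finPl) (Finite.elements finPt) (λ π → ⟦ l ⊂ π ⟧) (λ π Q → ⟦ Q ∈ᵖ π ⟧) f ⟩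
    Pts.Σ′ (λ Q → f Q * Pls.Σ′ (λ π → ⟦ l ⊂ π ⟧ * ⟦ Q ∈ᵖ π ⟧))
      ≡⟨ Pts.Σ-cong (λ Q → trans (cong (f Q *_) (line-point l Q)) (lemma (f Q) ⟦ Q ∈ˡ l ⟧)) ⟩
    Pts.Σ′ (λ Q → f Q + 4 * (⟦ Q ∈ˡ l ⟧ * f Q))
      ≡⟨ trans (Pts.Σ-+ f _) (cong (Pts.Σ′ f +_) (Pts.Σ-* 4 _)) ⟩
    Pts.Σ′ f + 4 * lineSum f l ∎
    where
    lemma : ∀ a d → a * (1 + 4 * d) ≡ a + 4 * (d * a)
    lemma = solve-∀

  pencil : Pt → Pl → Ln → ℕ
  pencil P π l = ⟦ P ∈ˡ l ⟧ * ⟦ l ⊂ π ⟧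

  private
    pencil-≢ : ∀ {P Q π} → P ∈ᵖ π ≡ true → P ≢ Q →
      Lns.Σ′ (λ l → pencil P π l * ⟦ Q ∈ˡ l ⟧) ≡ ⟦ Q ∈ᵖ π ⟧
    pencil-≢ {P} {Q} {π} P∈π P≢Q = begin
      Lns.Σ′ (λ l → pencil P π l * ⟦ Q ∈ˡ l ⟧)
        ≡⟨ Lns.Σ-cong same ⟩
      Lns.Σ′ (λ l → ⟦ Q ∈ᵖ π ⟧ * (⟦ P ∈ˡ l ⟧ * ⟦ Q ∈ˡ l ⟧))
        ≡⟨ Lns.Σ-* ⟦ Q ∈ᵖ π ⟧ _ ⟩
      ⟦ Q ∈ᵖ π ⟧ * Lns.Σ′ (λ l → ⟦ P ∈ˡ l ⟧ * ⟦ Q ∈ˡ l ⟧)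
        ≡⟨ cong (⟦ Q ∈ᵖ π ⟧ *_) (trans (lines-on-two P Q) (cong (λ n → 1 + 20 * n) (Pts.δ-≢ P≢Q))) ⟩
      ⟦ Q ∈ᵖ π ⟧ * 1
        ≡⟨ *-identityʳ _ ⟩
      ⟦ Q ∈ᵖ π ⟧ ∎
      where
      same : ∀ l → pencil P π l * ⟦ Q ∈ˡ l ⟧ ≡ ⟦ Q ∈ᵖ π ⟧ * (⟦ P ∈ˡ l ⟧ * ⟦ Q ∈ˡ l ⟧)
      same l with P ∈ˡ l in P∈l | Q ∈ˡ l in Q∈l | l ⊂ π in l⊂π | Q ∈ᵖ π in Q∈π
      ... | true  | true  | true  | true  = refl
      ... | true  | true  | true  | false = ⊥-elim (true≢false (⊂⇒∈ᵖ Q∈l l⊂π) Q∈π)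
      ... | true  | true  | false | true  = ⊥-elim (true≢false (span⊂ P≢Q P∈l Q∈l P∈π Q∈π) l⊂π)
      ... | true  | true  | false | false = refl
      ... | true  | false | a     | b     = trans (*-zeroʳ (1 * ⟦ a ⟧)) (sym (*-zeroʳ ⟦ b ⟧))
      ... | false | _     | _     | b     = sym (*-zeroʳ ⟦ b ⟧)

    -- The size `n` of the pencil is still unknown here. The delta on the left balances the 1 that
    -- `⟦ Q ∈ᵖ π ⟧` contributes at `P`, which avoids the coefficient n - 1.
    pencil-points : ∀ {P π} n → P ∈ᵖ π ≡ true → Lns.Σ′ (pencil P π) ≡ n → ∀ Q →
      Lns.Σ′ (λ l → pencil P π l * ⟦ Q ∈ˡ l ⟧) + Pts.δ P Q ≡ ⟦ Q ∈ᵖ π ⟧ + n * Pts.δ P Q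
    pencil-points {P} {π} n P∈π size Q with Finite._≟_ finPt P Q
    ... | no  P≢Q  = cong₂ _+_ (pencil-≢ P∈π P≢Q) (sym (*-zeroʳ n))
    ... | yes refl = begin
      Lns.Σ′ (λ l → pencil P π l * ⟦ P ∈ˡ l ⟧) + 1 ≡⟨ cong (_+ 1) (trans (Lns.Σ-cong absorb) size) ⟩
      n + 1                                        ≡⟨ lemma n ⟩
      1 + n * 1                                    ≡⟨ cong (λ b → ⟦ b ⟧ + n * 1) P∈π ⟨
      ⟦ P ∈ᵖ π ⟧ + n * 1 ∎
      where
      lemma : ∀ n → n + 1 ≡ 1 + n * 1
      lemma = solve-∀
      absorb : ∀ l → pencil P π l * ⟦ P ∈ˡ l ⟧ ≡ pencil P π l
      absorb l with P ∈ˡ l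
      ... | true  = *-identityʳ _
      ... | false = refl

    pencil-sum′ : ∀ {P π} n → P ∈ᵖ π ≡ true → Lns.Σ′ (pencil P π) ≡ n → ∀ f →
      Lns.Σ′ (λ l → pencil P π l * lineSum f l) + f P ≡ planeSum f π + n * f P
    pencil-sum′ {P} {π} n P∈π size f = begin
      Lns.Σ′ (λ l → pencil P π l * lineSum f l) + f P
        ≡⟨ cong₂ _+_ (∑-adjoint (Finite.elements finLn) (Finite.elements finPt) (pencil P π) (λ l Q → ⟦ Q ∈ˡ l ⟧) f) (sym (Pts.Σ-δ P f)) ⟩
      Pts.Σ′ (λ Q → f Q * Lns.Σ′ (λ l → pencil P π l * ⟦ Q ∈ˡ l ⟧)) + Pts.Σ′ (λ Q → f Q * Pts.δ P Q)
        ≡⟨ Pts.Σ-+ _ _ ⟨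
      Pts.Σ′ (λ Q → f Q * Lns.Σ′ (λ l → pencil P π l * ⟦ Q ∈ˡ l ⟧) + f Q * Pts.δ P Q)
        ≡⟨ Pts.Σ-cong (λ Q → trans (sym (*-distribˡ-+ (f Q) _ _))
             (trans (cong (f Q *_) (pencil-points n P∈π size Q)) (lemma (f Q) ⟦ Q ∈ᵖ π ⟧ n (Pts.δ P Q)))) ⟩
      Pts.Σ′ (λ Q → ⟦ Q ∈ᵖ π ⟧ * f Q + n * (f Q * Pts.δ P Q))
        ≡⟨ trans (Pts.Σ-+ _ _) (cong (planeSum f π +_) (trans (Pts.Σ-* n _) (cong (n *_) (Pts.Σ-δ P f)))) ⟩
      planeSum f π + n * f P ∎
      where
      lemma : ∀ a c n d → a * (c + n * d) ≡ c * a + n * (a * d)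
      lemma = solve-∀

  -- The constant weight 1 turns the pencil sum into the equation 5n + 1 = 21 + n.
  pencil-size : ∀ {P π} → P ∈ᵖ π ≡ true → Lns.Σ′ (pencil P π) ≡ 5
  pencil-size {P} {π} P∈π = *-cancelˡ-≡ n 5 4 (cross count (lemma n))
    where
    n = Lns.Σ′ (pencil P π)
    ones : ∀ (g : Pt → Bool) → Pts.Σ′ (λ Q → ⟦ g Q ⟧ * 1) ≡ Pts.Σ′ (λ Q → ⟦ g Q ⟧)
    ones g = Pts.Σ-cong (λ Q → *-identityʳ _)
    count : n * 5 + 1 ≡ 21 + n * 1
    count = begin
      n * 5 + 1
        ≡⟨ cong (_+ 1) (trans (*-comm n 5) (sym (Lns.Σ-* 5 _))) ⟩
      Lns.Σ′ (λ l → 5 * pencil P π l) + 1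
        ≡⟨ cong (_+ 1) (Lns.Σ-cong (λ l → trans (*-comm 5 (pencil P π l))
             (cong (pencil P π l *_) (sym (trans (ones (_∈ˡ l)) (points-on-line l)))))) ⟩
      Lns.Σ′ (λ l → pencil P π l * lineSum (λ _ → 1) l) + 1
        ≡⟨ pencil-sum′ n P∈π refl (λ _ → 1) ⟩
      planeSum (λ _ → 1) π + n * 1
        ≡⟨ cong (_+ n * 1) (trans (ones (_∈ᵖ π)) (points-in-plane π)) ⟩
      21 + n * 1 ∎
    lemma : ∀ n → 4 * n + (21 + n * 1) ≡ 20 + (n * 5 + 1)
    lemma = solve-∀

  pencil-sum : ∀ {P π} → P ∈ᵖ π ≡ true → ∀ f →
    Lns.Σ′ (λ l → pencil P π l * lineSum f l) ≡ planeSum f π + 4 * f P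
  pencil-sum {P} {π} P∈π f = cross (pencil-sum′ 5 P∈π (pencil-size P∈π) f) (lemma (Lns.Σ′ (λ l → pencil P π l * lineSum f l)) (planeSum f π) (f P))
    where
    lemma : ∀ x y a → x + (y + 5 * a) ≡ (y + 4 * a) + (x + a)
    lemma = solve-∀

  line-in-pencil : ∀ {P π} → P ∈ᵖ π ≡ true → ∃ λ l → P ∈ˡ l ≡ true × l ⊂ π ≡ true
  line-in-pencil {P} {π} P∈π with Lns.Σ-positive (pencil P π) (subst (1 ≤_) (sym (pencil-size P∈π)) (s≤s z≤n))
  ... | l , on = l , both (P ∈ˡ l) (l ⊂ π) on

  full-line : ∀ (e : Pt → Bool) {l} → lineSum (⟦_⟧ ∘ e) l ≡ 5 → ∀ {P} → P ∈ˡ l ≡ true → e P ≡ true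
  full-line e {l} full {P} P∈l = ⟦⟧≡1 (begin
    ⟦ e P ⟧               ≡⟨ *-identityˡ _ ⟨
    1 * ⟦ e P ⟧           ≡⟨ cong (λ b → ⟦ b ⟧ * ⟦ e P ⟧) P∈l ⟨
    ⟦ P ∈ˡ l ⟧ * ⟦ e P ⟧  ≡⟨ Pts.Σ≡⇒≡ bound (trans full (sym (points-on-line l))) P ⟩
    ⟦ P ∈ˡ l ⟧            ≡⟨ cong ⟦_⟧ P∈l ⟩
    1                     ∎)
    where
    bound : ∀ Q → ⟦ Q ∈ˡ l ⟧ * ⟦ e Q ⟧ ≤ ⟦ Q ∈ˡ l ⟧
    bound Q = ≤-trans (*-monoʳ-≤ ⟦ Q ∈ˡ l ⟧ (⟦⟧≤1 (e Q))) (≤-reflexive (*-identityʳ _))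

  -- If e misses a point then |e| = 21; a plane not inside e contains 5 points
  -- of e, and 85 · 5 ≠ 21 · 21.
  hyperplane : ∀ (e : Pt → Bool) →
    (∀ l → lineSum (⟦_⟧ ∘ e) l ≡ 1 ⊎ lineSum (⟦_⟧ ∘ e) l ≡ 5) →
    (∀ P → e P ≡ true) ⊎ (∃ λ π → ∀ P → e P ≡ P ∈ᵖ π)
  hyperplane e 1∣5 with Pts.search (not ∘ e)
  ... | inj₂ none = inj₁ λ P → not-not (e P) (none P)
    where
    not-not : ∀ b → not b ≡ false → b ≡ true
    not-not true _ = refl
  ... | inj₁ (P₀ , missing) = inj₂ (π , λ P → sym (⟦⟧-injective (Pts.Σ≡⇒≡ bound (trans (points-in-plane π) (sym size)) P)))
    where
    not-true : ∀ b → not b ≡ true → b ≡ false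
    not-true false _ = refl

    -- A line with five points of `e` lies inside `e`, so a line through a missing point has exactly
    -- one.
    tangent : ∀ {P} → e P ≡ false → ∀ l → ⟦ P ∈ˡ l ⟧ * lineSum (⟦_⟧ ∘ e) l ≡ ⟦ P ∈ˡ l ⟧ * 1
    tangent eP l = ⟦⟧*-cong (_ ∈ˡ l) λ P∈l →
      [ (λ one → one) , (λ five → ⊥-elim (true≢false (full-line e five P∈l) eP)) ]′ (1∣5 l)

    size : Pts.Σ′ (⟦_⟧ ∘ e) ≡ 21
    size = begin
      Pts.Σ′ (⟦_⟧ ∘ e)
        ≡⟨ +-identityʳ _ ⟨
      Pts.Σ′ (⟦_⟧ ∘ e) + 0 * 20
        ≡⟨ cong (λ b → Pts.Σ′ (⟦_⟧ ∘ e) + ⟦ b ⟧ * 20) (not-true (e P₀) missing) ⟨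
      Pts.Σ′ (⟦_⟧ ∘ e) + ⟦ e P₀ ⟧ * 20
        ≡⟨ star-sum (⟦_⟧ ∘ e) P₀ ⟨
      Lns.Σ′ (λ l → ⟦ P₀ ∈ˡ l ⟧ * lineSum (⟦_⟧ ∘ e) l)
        ≡⟨ Lns.Σ-cong (λ l → trans (tangent (not-true (e P₀) missing) l) (*-identityʳ _)) ⟩
      Lns.Σ′ (λ l → ⟦ P₀ ∈ˡ l ⟧)
        ≡⟨ lines-on-point P₀ ⟩
      21 ∎

    tangent-plane : ∀ {P π} → P ∈ᵖ π ≡ true → e P ≡ false → planeSum (⟦_⟧ ∘ e) π ≡ 5
    tangent-plane {P} {π} P∈π eP = begin
      planeSum (⟦_⟧ ∘ e) π
        ≡⟨ +-identityʳ _ ⟨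
      planeSum (⟦_⟧ ∘ e) π + 4 * 0
        ≡⟨ cong (λ b → planeSum (⟦_⟧ ∘ e) π + 4 * ⟦ b ⟧) eP ⟨
      planeSum (⟦_⟧ ∘ e) π + 4 * ⟦ e P ⟧
        ≡⟨ pencil-sum P∈π (⟦_⟧ ∘ e) ⟨
      Lns.Σ′ (λ l → pencil P π l * lineSum (⟦_⟧ ∘ e) l)
        ≡⟨ Lns.Σ-cong once ⟩
      Lns.Σ′ (pencil P π)
        ≡⟨ pencil-size P∈π ⟩
      5 ∎
      where
      shuffle : ∀ a b c → (a * b) * c ≡ b * (a * c)
      shuffle = solve-∀
      once : ∀ l → pencil P π l * lineSum (⟦_⟧ ∘ e) l ≡ pencil P π l
      once l = trans (shuffle ⟦ P ∈ˡ l ⟧ ⟦ l ⊂ π ⟧ _)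
        (trans (cong (⟦ l ⊂ π ⟧ *_) (tangent eP l))
          (trans (sym (shuffle ⟦ P ∈ˡ l ⟧ ⟦ l ⊂ π ⟧ 1)) (*-identityʳ _)))

    Missed Full : Pl → Set
    Missed π = ∃ λ P → P ∈ᵖ π ≡ true × e P ≡ false
    Full π = ∀ P → P ∈ᵖ π ≡ true → e P ≡ true

    missed? : ∀ π → Missed π ⊎ Full π
    missed? π with Pts.search (λ P → (P ∈ᵖ π) ∧ not (e P))
    ... | inj₁ (P , found) with P ∈ᵖ π in P∈π | e P in eP
    ...   | true | false = inj₁ (P , P∈π , eP)
    missed? π | inj₂ none = inj₂ full
      where
      full : Full π
      full P P∈π with P ∈ᵖ π | e P | none P
      ... | true | true | _ = refl

    incidences : Pls.Σ′ (planeSum (⟦_⟧ ∘ e)) ≡ 441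
    incidences = begin
      Pls.Σ′ (planeSum (⟦_⟧ ∘ e))
        ≡⟨ ∑-swap (Finite.elements finPl) (Finite.elements finPt) _ ⟩
      Pts.Σ′ (λ P → Pls.Σ′ (λ π → ⟦ P ∈ᵖ π ⟧ * ⟦ e P ⟧))
        ≡⟨ Pts.Σ-cong (λ P → trans (Pls.Σ-cong (λ π → *-comm ⟦ P ∈ᵖ π ⟧ _))
             (trans (Pls.Σ-* ⟦ e P ⟧ _) (trans (cong (⟦ e P ⟧ *_) (planes-on-point P)) (*-comm ⟦ e P ⟧ 21)))) ⟩
      Pts.Σ′ (λ P → 21 * ⟦ e P ⟧)
        ≡⟨ trans (Pts.Σ-* 21 _) (cong (21 *_) size) ⟩
      441 ∎

    full-plane : ∃ Full
    full-plane with Pls.search (λ π → [ (λ _ → false) , (λ _ → true) ]′ (missed? π))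
    ... | inj₁ (π , found) with missed? π
    ...   | inj₂ full = π , full
    full-plane | inj₂ none = case trans (sym incidences) too-few of λ ()
      where
      five : ∀ π → planeSum (⟦_⟧ ∘ e) π ≡ 5 * 1
      five π with missed? π | none π
      ... | inj₁ (P , P∈π , eP) | _ = tangent-plane P∈π eP
      too-few : Pls.Σ′ (planeSum (⟦_⟧ ∘ e)) ≡ 425
      too-few = trans (Pls.Σ-cong five) (trans (Pls.Σ-* 5 _) (cong (5 *_) #planes))

    π = proj₁ full-plane

    bound : ∀ P → ⟦ P ∈ᵖ π ⟧ ≤ ⟦ e P ⟧
    bound P = ⟦⟧-mono (proj₂ full-plane P)

-- Cameron–Liebler line classes with parameter 7

-- The 35 + 15 χ(l) lines of the class that meet l in a point, and l itself, if
-- it is in the class, with its 5 points.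
LineCondition : (S : Space) → (Space.Ln S → Bool) → Set
LineCondition S L = ∀ l → lineSum (λ P → Lns.Σ′ (λ m → ⟦ P ∈ˡ m ⟧ * ⟦ L m ⟧)) l ≡ ⟦ L l ⟧ * 20 + 35
  where open Geometry S

module Counting (S : Space) (L : Space.Ln S → Bool) (CL : LineCondition S L) where

  open Geometry S

  open ≡-Reasoning

  private
    points = Finite.elements finPt
    lines  = Finite.elements finLn
    planes = Finite.elements finPl

  χ : Ln → ℕ
  χ l = ⟦ L l ⟧

  s : Pt → ℕ
  s P = Lns.Σ′ (λ l → ⟦ P ∈ˡ l ⟧ * χ l)

  m : Pl → ℕ
  m π = Lns.Σ′ (λ l → ⟦ l ⊂ π ⟧ * χ l)

  k : Pt → Pl → ℕ
  k P π = Lns.Σ′ (λ l → pencil P π l * χ l)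

  private
    χ-affine : ∀ l → χ l * (χ l * 20 + 35) ≡ χ l * 55
    χ-affine l with L l
    ... | true  = refl
    ... | false = refl

    s² : Pt → ℕ
    s² P = s P * s P

    m² : Pl → ℕ
    m² π = m π * m π

  Σs : Pts.Σ′ s ≡ Lns.Σ′ χ * 5
  Σs = begin
    Pts.Σ′ s
      ≡⟨ ∑-swap points lines _ ⟩
    Lns.Σ′ (λ l → Pts.Σ′ (λ P → ⟦ P ∈ˡ l ⟧ * χ l))
      ≡⟨ Lns.Σ-cong (λ l → trans (Pts.Σ-cong (λ P → *-comm ⟦ P ∈ˡ l ⟧ (χ l)))
           (trans (Pts.Σ-* (χ l) _) (cong (χ l *_) (points-on-line l)))) ⟩
    Lns.Σ′ (λ l → χ l * 5)
      ≡⟨ Lns.Σ-*ʳ χ 5 ⟩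
    Lns.Σ′ χ * 5 ∎

  -- When the line condition is summed over the star of any point, the terms in `s P` cancel; 147 =
  -- 7 · 21.
  size : Lns.Σ′ χ ≡ 147
  size = *-cancelʳ-≡ N 147 5 (cross (sym eq) (lemma N (s P)))
    where
    N = Lns.Σ′ χ
    P = proj₁ (Pts.Σ-positive (λ _ → 1) (subst (1 ≤_) (sym #points) (s≤s z≤n)))
    eq : s P * 20 + 21 * 35 ≡ N * 5 + s P * 20
    eq = begin
      s P * 20 + 21 * 35
        ≡⟨ cong (λ n → s P * 20 + n * 35) (lines-on-point P) ⟨
      s P * 20 + Lns.Σ′ (λ l → ⟦ P ∈ˡ l ⟧) * 35
        ≡⟨ Lns.Σ-affine (λ l → ⟦ P ∈ˡ l ⟧) χ 20 35 ⟨
      Lns.Σ′ (λ l → ⟦ P ∈ˡ l ⟧ * (χ l * 20 + 35))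
        ≡⟨ Lns.Σ-cong (λ l → cong (⟦ P ∈ˡ l ⟧ *_) (CL l)) ⟨
      Lns.Σ′ (λ l → ⟦ P ∈ˡ l ⟧ * lineSum s l)
        ≡⟨ star-sum s P ⟩
      Pts.Σ′ s + s P * 20
        ≡⟨ cong (λ n → n + s P * 20) Σs ⟩
      N * 5 + s P * 20 ∎
    lemma : ∀ n a → n * 5 + (a * 20 + 21 * 35) ≡ 147 * 5 + (n * 5 + a * 20)
    lemma = solve-∀

  Σs≡735 : Pts.Σ′ s ≡ 735
  Σs≡735 = trans Σs (cong (λ n → n * 5) size)

  -- Each of the 147 lines of the class has one point in `π`, and four more if it lies there.
  plane-degree : ∀ π → planeSum s π ≡ m π * 4 + 147
  plane-degree π = begin
    planeSum s π
      ≡⟨ ∑-adjoint points lines (λ P → ⟦ P ∈ᵖ π ⟧) (λ P l → ⟦ P ∈ˡ l ⟧) χ ⟩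
    Lns.Σ′ (λ l → χ l * Pts.Σ′ (λ P → ⟦ P ∈ᵖ π ⟧ * ⟦ P ∈ˡ l ⟧))
      ≡⟨ Lns.Σ-cong (λ l → cong (χ l *_) (trans (Pts.Σ-cong (λ P → *-comm ⟦ P ∈ᵖ π ⟧ _)) (trans (line-plane l π) (lemma ⟦ l ⊂ π ⟧)))) ⟩
    Lns.Σ′ (λ l → χ l * (⟦ l ⊂ π ⟧ * 4 + 1))
      ≡⟨ Lns.Σ-affine χ (λ l → ⟦ l ⊂ π ⟧) 4 1 ⟩
    Lns.Σ′ (λ l → χ l * ⟦ l ⊂ π ⟧) * 4 + Lns.Σ′ χ * 1
      ≡⟨ cong₂ (λ a b → a * 4 + b) (Lns.Σ-cong (λ l → *-comm (χ l) _)) (trans (*-identityʳ _) size) ⟩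
    m π * 4 + 147 ∎
    where
    lemma : ∀ a → 1 + 4 * a ≡ a * 4 + 1
    lemma = solve-∀

  -- The line condition summed over the pencil, with `plane-degree` for the resulting sum over `π`,
  -- and divided by 4.
  flag-degree : ∀ {P π} → P ∈ᵖ π ≡ true → s P + m π ≡ k P π * 5 + 7
  flag-degree {P} {π} P∈π = *-cancelʳ-≡ _ _ 4 (cross (sym eq) (lemma (s P) (m π) (k P π)))
    where
    eq : k P π * 20 + 5 * 35 ≡ (m π * 4 + 147) + 4 * s P
    eq = begin
      k P π * 20 + 5 * 35
        ≡⟨ cong (λ n → k P π * 20 + n * 35) (pencil-size P∈π) ⟨
      k P π * 20 + Lns.Σ′ (pencil P π) * 35
        ≡⟨ Lns.Σ-affine (pencil P π) χ 20 35 ⟨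
      Lns.Σ′ (λ l → pencil P π l * (χ l * 20 + 35))
        ≡⟨ Lns.Σ-cong (λ l → cong (pencil P π l *_) (CL l)) ⟨
      Lns.Σ′ (λ l → pencil P π l * lineSum s l)
        ≡⟨ pencil-sum P∈π s ⟩
      planeSum s π + 4 * s P
        ≡⟨ cong (λ n → n + 4 * s P) (plane-degree π) ⟩
      (m π * 4 + 147) + 4 * s P ∎
    lemma : ∀ a b c → (a + b) * 4 + (c * 20 + 5 * 35) ≡ (c * 5 + 7) * 4 + ((b * 4 + 147) + 4 * a)
    lemma = solve-∀

  -- The dual of the line condition, obtained by summing `plane-degree` over the planes on `l`.
  planes-degree : ∀ l → Pls.Σ′ (λ π → ⟦ l ⊂ π ⟧ * m π) ≡ χ l * 20 + 35
  planes-degree l = *-cancelʳ-≡ _ _ 4 (cross eq (lemma M (χ l)))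
    where
    M = Pls.Σ′ (λ π → ⟦ l ⊂ π ⟧ * m π)
    eq : M * 4 + 5 * 147 ≡ 4 * (χ l * 20 + 35) + 735
    eq = begin
      M * 4 + 5 * 147
        ≡⟨ cong (λ n → M * 4 + n * 147) (planes-on-line l) ⟨
      M * 4 + Pls.Σ′ (λ π → ⟦ l ⊂ π ⟧) * 147
        ≡⟨ Pls.Σ-affine (λ π → ⟦ l ⊂ π ⟧) m 4 147 ⟨
      Pls.Σ′ (λ π → ⟦ l ⊂ π ⟧ * (m π * 4 + 147))
        ≡⟨ Pls.Σ-cong (λ π → cong (⟦ l ⊂ π ⟧ *_) (plane-degree π)) ⟨
      Pls.Σ′ (λ π → ⟦ l ⊂ π ⟧ * planeSum s π)
        ≡⟨ planes-sum s l ⟩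
      Pts.Σ′ s + 4 * lineSum s l
        ≡⟨ trans (cong₂ (λ a b → a + 4 * b) Σs≡735 (CL l)) (+-comm 735 _) ⟩
      4 * (χ l * 20 + 35) + 735 ∎
    lemma : ∀ a c → a * 4 + (4 * (c * 20 + 35) + 735) ≡ (c * 20 + 35) * 4 + (a * 4 + 5 * 147)
    lemma = solve-∀

  -- Each line of the class contributes the sum 20 + 35 = 55 of `s` over its points, and 55 · 147 =
  -- 8085.
  Σs² : Pts.Σ′ s² ≡ 8085
  Σs² = begin
    Pts.Σ′ s²
      ≡⟨ ∑-adjoint points lines s (λ P l → ⟦ P ∈ˡ l ⟧) χ ⟩
    Lns.Σ′ (λ l → χ l * Pts.Σ′ (λ P → s P * ⟦ P ∈ˡ l ⟧))
      ≡⟨ Lns.Σ-cong (λ l → trans (cong (χ l *_) (trans (Pts.Σ-cong (λ P → *-comm (s P) _)) (CL l))) (χ-affine l)) ⟩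
    Lns.Σ′ (λ l → χ l * 55)
      ≡⟨ trans (Lns.Σ-*ʳ χ 55) (cong (λ n → n * 55) size) ⟩
    8085 ∎

  private
    k-outside : ∀ {P π} → P ∈ᵖ π ≡ false → k P π ≡ 0
    k-outside {P} {π} P∉π = trans (Lns.Σ-cong none) (∑-0 lines)
      where
      none : ∀ l → pencil P π l * χ l ≡ 0
      none l with P ∈ˡ l in P∈l | l ⊂ π in l⊂π
      ... | true  | true  = ⊥-elim (true≢false (⊂⇒∈ᵖ P∈l l⊂π) P∉π)
      ... | true  | false = refl
      ... | false | _     = refl

    Σsk : ∀ π → Pts.Σ′ (λ P → s P * k P π) ≡ m π * 55
    Σsk π = begin
      Pts.Σ′ (λ P → s P * k P π)
        ≡⟨ Pts.Σ-cong (λ P → cong (s P *_) (Lns.Σ-cong (λ l → *-assoc ⟦ P ∈ˡ l ⟧ ⟦ l ⊂ π ⟧ (χ l)))) ⟩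
      Pts.Σ′ (λ P → s P * Lns.Σ′ (λ l → ⟦ P ∈ˡ l ⟧ * (⟦ l ⊂ π ⟧ * χ l)))
        ≡⟨ ∑-adjoint points lines s (λ P l → ⟦ P ∈ˡ l ⟧) (λ l → ⟦ l ⊂ π ⟧ * χ l) ⟩
      Lns.Σ′ (λ l → (⟦ l ⊂ π ⟧ * χ l) * Pts.Σ′ (λ P → s P * ⟦ P ∈ˡ l ⟧))
        ≡⟨ Lns.Σ-cong (λ l → trans (cong ((⟦ l ⊂ π ⟧ * χ l) *_)
             (trans (Pts.Σ-cong (λ P → *-comm (s P) _)) (CL l))) (absorb l)) ⟩
      Lns.Σ′ (λ l → ⟦ l ⊂ π ⟧ * χ l * 55)
        ≡⟨ Lns.Σ-*ʳ _ 55 ⟩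
      m π * 55 ∎
      where
      absorb : ∀ l → (⟦ l ⊂ π ⟧ * χ l) * (χ l * 20 + 35) ≡ ⟦ l ⊂ π ⟧ * χ l * 55
      absorb l = trans (*-assoc ⟦ l ⊂ π ⟧ (χ l) _) (trans (cong (⟦ l ⊂ π ⟧ *_) (χ-affine l)) (sym (*-assoc ⟦ l ⊂ π ⟧ (χ l) 55)))

  -- Multiply `flag-degree` by `s P` and sum over `π`. The products `s P * k P π` add up to 55 for
  -- each class line in `π`, and the rest is `plane-degree`; hence 303 = 5 · 55 + 7 · 4 and 1029 = 7
  -- · 147.
  plane-squares : ∀ π → m π * 303 + 1029 ≡ planeSum s² π + (m π * 147 + m² π * 4)
  plane-squares π = begin
    m π * 303 + 1029
      ≡⟨ lemma₁ (m π) ⟩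
    5 * (m π * 55) + 7 * (m π * 4 + 147)
      ≡⟨ cong₂ (λ a b → 5 * a + 7 * b) (Σsk π) (plane-degree π) ⟨
    5 * Pts.Σ′ (λ P → s P * k P π) + 7 * planeSum s π
      ≡⟨ trans (Pts.Σ-+ _ _) (cong₂ _+_ (Pts.Σ-* 5 _) (Pts.Σ-* 7 _)) ⟨
    Pts.Σ′ (λ P → 5 * (s P * k P π) + 7 * (⟦ P ∈ᵖ π ⟧ * s P))
      ≡⟨ Pts.Σ-cong pointwise ⟩
    Pts.Σ′ (λ P → ⟦ P ∈ᵖ π ⟧ * s² P + m π * (⟦ P ∈ᵖ π ⟧ * s P))
      ≡⟨ trans (Pts.Σ-+ _ _) (cong (planeSum s² π +_) (Pts.Σ-* (m π) _)) ⟩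
    planeSum s² π + m π * planeSum s π
      ≡⟨ cong (λ a → planeSum s² π + m π * a) (plane-degree π) ⟩
    planeSum s² π + m π * (m π * 4 + 147)
      ≡⟨ cong (planeSum s² π +_) (lemma₂ (m π)) ⟩
    planeSum s² π + (m π * 147 + m² π * 4) ∎
    where
    lemma₁ : ∀ m → m * 303 + 1029 ≡ 5 * (m * 55) + 7 * (m * 4 + 147)
    lemma₁ = solve-∀
    lemma₂ : ∀ m → m * (m * 4 + 147) ≡ m * 147 + m * m * 4
    lemma₂ = solve-∀
    pointwise : ∀ P → 5 * (s P * k P π) + 7 * (⟦ P ∈ᵖ π ⟧ * s P) ≡ ⟦ P ∈ᵖ π ⟧ * s² P + m π * (⟦ P ∈ᵖ π ⟧ * s P)
    pointwise P with P ∈ᵖ π in P∈π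
    ... | false rewrite k-outside P∈π = lemma (s P) (m π)
      where
      lemma : ∀ a b → 5 * (a * 0) + 0 ≡ b * 0
      lemma = solve-∀
    ... | true = begin
      5 * (s P * k P π) + 7 * (1 * s P)   ≡⟨ lemma (s P) (k P π) ⟩
      s P * (k P π * 5 + 7)               ≡⟨ cong (s P *_) (flag-degree P∈π) ⟨
      s P * (s P + m π)                   ≡⟨ lemma′ (s P) (m π) ⟩
      1 * s² P + m π * (1 * s P)          ∎
      where
      lemma : ∀ a b → 5 * (a * b) + 7 * (1 * a) ≡ a * (b * 5 + 7)
      lemma = solve-∀
      lemma′ : ∀ a b → a * (a + b) ≡ 1 * (a * a) + b * (1 * a)
      lemma′ = solve-∀

  -- `plane-squares` summed over the planes on `l`: points off `l` count once and points of `l` five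
  -- times, so the total 8085 enters.
  line-squares : ∀ l → lineSum s² l + Pls.Σ′ (λ π → ⟦ l ⊂ π ⟧ * m² π) ≡ χ l * 780 + 630
  line-squares l = *-cancelʳ-≡ _ _ 4 (cross (sym eq) (lemma (lineSum s² l) M₂ (χ l)))
    where
    M₁ = Pls.Σ′ (λ π → ⟦ l ⊂ π ⟧ * m π)
    M₂ = Pls.Σ′ (λ π → ⟦ l ⊂ π ⟧ * m² π)
    expandˡ : ∀ j a → j * (a * 303 + 1029) ≡ j * a * 303 + j * 1029
    expandˡ = solve-∀
    expandʳ : ∀ j a b c → j * (a + (b * 147 + c * 4)) ≡ j * a + (j * b * 147 + j * c * 4)
    expandʳ = solve-∀
    eq : (χ l * 20 + 35) * 303 + 5 * 1029 ≡ (4 * lineSum s² l + 8085) + ((χ l * 20 + 35) * 147 + M₂ * 4)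
    eq = begin
      (χ l * 20 + 35) * 303 + 5 * 1029
        ≡⟨ cong₂ (λ a b → a * 303 + b * 1029) (planes-degree l) (planes-on-line l) ⟨
      M₁ * 303 + Pls.Σ′ (λ π → ⟦ l ⊂ π ⟧) * 1029
        ≡⟨ trans (Pls.Σ-+ _ _) (cong₂ _+_ (Pls.Σ-*ʳ _ 303) (Pls.Σ-*ʳ _ 1029)) ⟨
      Pls.Σ′ (λ π → ⟦ l ⊂ π ⟧ * m π * 303 + ⟦ l ⊂ π ⟧ * 1029)
        ≡⟨ Pls.Σ-cong (λ π → trans (sym (expandˡ ⟦ l ⊂ π ⟧ (m π))) (trans (cong (⟦ l ⊂ π ⟧ *_) (plane-squares π))
             (expandʳ ⟦ l ⊂ π ⟧ (planeSum s² π) (m π) (m² π)))) ⟩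
      Pls.Σ′ (λ π → ⟦ l ⊂ π ⟧ * planeSum s² π + (⟦ l ⊂ π ⟧ * m π * 147 + ⟦ l ⊂ π ⟧ * m² π * 4))
        ≡⟨ trans (Pls.Σ-+ _ _) (cong₂ _+_ (planes-sum s² l)
             (trans (Pls.Σ-+ _ _) (cong₂ _+_ (Pls.Σ-*ʳ _ 147) (Pls.Σ-*ʳ _ 4)))) ⟩
      (Pts.Σ′ s² + 4 * lineSum s² l) + (M₁ * 147 + M₂ * 4)
        ≡⟨ cong₂ (λ a b → a + (b * 147 + M₂ * 4)) (trans (+-comm _ (4 * lineSum s² l)) (cong (λ n → 4 * lineSum s² l + n) Σs²)) (planes-degree l) ⟩
      (4 * lineSum s² l + 8085) + ((χ l * 20 + 35) * 147 + M₂ * 4) ∎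
    lemma : ∀ a b c →
      (a + b) * 4 + ((c * 20 + 35) * 303 + 5 * 1029) ≡
      (c * 780 + 630) * 4 + ((4 * a + 8085) + ((c * 20 + 35) * 147 + b * 4))
    lemma = solve-∀

-- Residues modulo 5 and 25, and the reduced weights `u` and `w`

residue-weight : ℕ → ℕ → ℕ
residue-weight x c = (x ∸ c) * (10 * c) + 5 * (c * c)

-- If s = 5v + c at the five points of a line and x = Σ v + c, then `residue-weight x c` is Σ s²
-- less 25 Σ v². The flags leave the pairs (0,2), (1,1), (2,0), (3,4) and (4,3) for c and d; the
-- squares modulo 25 leave only (1,1).
residues? : ∀ b → Dec (∀ (c d : Fin 5) → (toℕ c + toℕ d) % 5 ≡ 2 →
  (residue-weight (⟦ b ⟧ * 4 + 7) (toℕ c) + residue-weight (⟦ b ⟧ * 4 + 7) (toℕ d)) % 25 ≡ (⟦ b ⟧ * 780 + 630) % 25 →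
  toℕ c ≡ 1 × toℕ d ≡ 1)
residues? b = all? λ c → all? λ d →
  (_ ≟ⁿ 2) →-dec (_ ≟ⁿ (⟦ b ⟧ * 780 + 630) % 25) →-dec ((toℕ c ≟ⁿ 1) ×-dec (toℕ d ≟ⁿ 1))

residues : ∀ b (c d : Fin 5) → (toℕ c + toℕ d) % 5 ≡ 2 →
  (residue-weight (⟦ b ⟧ * 4 + 7) (toℕ c) + residue-weight (⟦ b ⟧ * 4 + 7) (toℕ d)) % 25 ≡ (⟦ b ⟧ * 780 + 630) % 25 →
  toℕ c ≡ 1 × toℕ d ≡ 1
residues false = toWitness {a? = residues? false} _
residues true  = toWitness {a? = residues? true} _

module _ {A : Set} (fin : Finite A) (on : A → Bool) (f v : A → ℕ) (c : ℕ)
  (f≡ : ∀ x → on x ≡ true → f x ≡ v x * 5 + c) where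

  open Sum fin

  shifted-sum : Σ′ (λ x → ⟦ on x ⟧ * f x) ≡ Σ′ (λ x → ⟦ on x ⟧ * v x) * 5 + Σ′ (λ x → ⟦ on x ⟧) * c
  shifted-sum = trans (Σ-cong (λ x → ⟦⟧*-cong (on x) (f≡ x))) (Σ-affine _ v 5 c)

  shifted-squares : Σ′ (λ x → ⟦ on x ⟧ * (f x * f x)) ≡
    Σ′ (λ x → ⟦ on x ⟧ * (v x * v x)) * 25 + (Σ′ (λ x → ⟦ on x ⟧ * v x) * (10 * c) + Σ′ (λ x → ⟦ on x ⟧) * (c * c))
  shifted-squares = begin
    Σ′ (λ x → ⟦ on x ⟧ * (f x * f x))
      ≡⟨ Σ-cong (λ x → trans (⟦⟧*-cong (on x) (λ x∈ → cong₂ _*_ (f≡ x x∈) (f≡ x x∈))) (expand ⟦ on x ⟧ (v x) c)) ⟩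
    Σ′ (λ x → ⟦ on x ⟧ * (v x * v x) * 25 + (⟦ on x ⟧ * v x * (10 * c) + ⟦ on x ⟧ * (c * c)))
      ≡⟨ trans (Σ-+ _ _) (cong₂ _+_ (Σ-*ʳ _ 25) (trans (Σ-+ _ _) (cong₂ _+_ (Σ-*ʳ _ (10 * c)) (Σ-*ʳ _ (c * c))))) ⟩
    Σ′ (λ x → ⟦ on x ⟧ * (v x * v x)) * 25 + (Σ′ (λ x → ⟦ on x ⟧ * v x) * (10 * c) + Σ′ (λ x → ⟦ on x ⟧) * (c * c)) ∎
    where
    open ≡-Reasoning
    expand : ∀ i v c → i * ((v * 5 + c) * (v * 5 + c)) ≡ i * (v * v) * 25 + (i * v * (10 * c) + i * (c * c))
    expand = solve-∀

-- Adding `x * 4` completes `x` to a multiple of 5, in place of a subtraction.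
%5-cancelʳ : ∀ a b x → (a + x) % 5 ≡ (b + x) % 5 → a % 5 ≡ b % 5
%5-cancelʳ a b x eq = begin
  a % 5                             ≡⟨ [m+kn]%n≡m%n a x 5 ⟨
  (a + x * 5) % 5                   ≡⟨ cong (_% 5) (lemma a x) ⟩
  ((a + x) + x * 4) % 5             ≡⟨ %-distribˡ-+ (a + x) (x * 4) 5 ⟩
  ((a + x) % 5 + (x * 4) % 5) % 5   ≡⟨ cong (λ n → (n + (x * 4) % 5) % 5) eq ⟩
  ((b + x) % 5 + (x * 4) % 5) % 5   ≡⟨ %-distribˡ-+ (b + x) (x * 4) 5 ⟨
  ((b + x) + x * 4) % 5             ≡⟨ cong (_% 5) (lemma b x) ⟨
  (b + x * 5) % 5                   ≡⟨ [m+kn]%n≡m%n b x 5 ⟩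
  b % 5                             ∎
  where
  open ≡-Reasoning
  lemma : ∀ a x → a + x * 5 ≡ (a + x) + x * 4
  lemma = solve-∀

module Reduced (S : Space) (L : Space.Ln S → Bool) (CL : LineCondition S L) where

  open Geometry S

  open Counting S L CL public

  u : Pt → ℕ
  u P = s P / 5

  w : Pl → ℕ
  w π = m π / 5

  pencilSum : (Pl → ℕ) → Ln → ℕ
  pencilSum f l = Pls.Σ′ (λ π → ⟦ l ⊂ π ⟧ * f π)

  private
    sq : ∀ {A : Set} → (A → ℕ) → A → ℕ
    sq f x = f x * f x

    flag% : ∀ {P π} → P ∈ᵖ π ≡ true → (s P + m π) % 5 ≡ 2
    flag% {P} {π} P∈π = trans (cong (_% 5) (trans (flag-degree P∈π) (+-comm (k P π * 5) 7))) ([m+kn]%n≡m%n 7 (k P π) 5)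

    div5 : ∀ n {c} → n % 5 ≡ c → n ≡ n / 5 * 5 + c
    div5 n {c} eq = trans (m≡m%n+[m/n]*n n 5) (trans (cong (_+ n / 5 * 5) eq) (+-comm c _))

    module OnLine (l : Ln) {P₀ : Pt} (P₀∈l : P₀ ∈ˡ l ≡ true) {π₀ : Pl} (l⊂π₀ : l ⊂ π₀ ≡ true) where

      c d A B A₂ B₂ : ℕ
      c  = s P₀ % 5
      d  = m π₀ % 5
      A  = lineSum u l
      B  = pencilSum w l
      A₂ = lineSum (sq u) l
      B₂ = pencilSum (sq w) l

      -- All points of `l` form flags with the same plane `π₀`, so their degrees agree modulo 5.
      s≡ : ∀ P → P ∈ˡ l ≡ true → s P ≡ u P * 5 + c
      s≡ P P∈l = div5 (s P) (%5-cancelʳ (s P) (s P₀) (m π₀)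
        (trans (flag% (⊂⇒∈ᵖ P∈l l⊂π₀)) (sym (flag% (⊂⇒∈ᵖ P₀∈l l⊂π₀)))))

      m≡ : ∀ π → l ⊂ π ≡ true → m π ≡ w π * 5 + d
      m≡ π l⊂π = div5 (m π) (%5-cancelʳ (m π) (m π₀) (s P₀)
        (trans (cong (_% 5) (+-comm (m π) (s P₀))) (trans (flag% (⊂⇒∈ᵖ P₀∈l l⊂π))
          (trans (sym (flag% (⊂⇒∈ᵖ P₀∈l l⊂π₀))) (cong (_% 5) (+-comm (s P₀) (m π₀)))))))

      divide : ∀ X c → X * 5 + 5 * c ≡ χ l * 20 + 35 → X + c ≡ χ l * 4 + 7
      divide X c eq = *-cancelʳ-≡ _ _ 5 (trans (lemma₁ X c) (trans eq (lemma₂ (χ l))))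
        where
        lemma₁ : ∀ X c → (X + c) * 5 ≡ X * 5 + 5 * c
        lemma₁ = solve-∀
        lemma₂ : ∀ x → x * 20 + 35 ≡ (x * 4 + 7) * 5
        lemma₂ = solve-∀

      A+c : A + c ≡ χ l * 4 + 7
      A+c = divide A c (trans (cong (λ n → A * 5 + n * c) (sym (points-on-line l)))
        (trans (sym (shifted-sum finPt (_∈ˡ l) s u c s≡)) (CL l)))

      B+d : B + d ≡ χ l * 4 + 7
      B+d = divide B d (trans (cong (λ n → B * 5 + n * d) (sym (planes-on-line l)))
        (trans (sym (shifted-sum finPl (l ⊂_) m w d m≡)) (planes-degree l)))

      squares : (A₂ * 25 + (A * (10 * c) + 5 * (c * c))) + (B₂ * 25 + (B * (10 * d) + 5 * (d * d))) ≡ χ l * 780 + 630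
      squares = trans (sym (cong₂ _+_
        (trans (shifted-squares finPt (_∈ˡ l) s u c s≡) (cong (λ n → A₂ * 25 + (A * (10 * c) + n * (c * c))) (points-on-line l)))
        (trans (shifted-squares finPl (l ⊂_) m w d m≡) (cong (λ n → B₂ * 25 + (B * (10 * d) + n * (d * d))) (planes-on-line l)))))
        (line-squares l)

      c+d%5 : (c + d) % 5 ≡ 2
      c+d%5 = trans (sym (%-distribˡ-+ (s P₀) (m π₀) 5)) (flag% (⊂⇒∈ᵖ P₀∈l l⊂π₀))

      c≡1,d≡1 : c ≡ 1 × d ≡ 1
      c≡1,d≡1 = finite c d (m%n<n (s P₀) 5) (m%n<n (m π₀) 5) c+d%5 (begin
        (residue-weight (χ l * 4 + 7) c + residue-weight (χ l * 4 + 7) d) % 25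
          ≡⟨ cong₂ (λ a b → (a * (10 * c) + 5 * (c * c) + (b * (10 * d) + 5 * (d * d))) % 25) (minus A c A+c) (minus B d B+d) ⟩
        K % 25
          -- The unknown sums of squares carry the factor 25 and drop out of the residue.
          ≡⟨ [m+kn]%n≡m%n K (A₂ + B₂) 25 ⟨
        (K + (A₂ + B₂) * 25) % 25
          ≡⟨ cong (_% 25) (trans (lemma (A * (10 * c) + 5 * (c * c)) _ A₂ B₂) squares) ⟩
        (χ l * 780 + 630) % 25 ∎)
        where
        open ≡-Reasoning
        K = A * (10 * c) + 5 * (c * c) + (B * (10 * d) + 5 * (d * d))
        minus : ∀ X c → X + c ≡ χ l * 4 + 7 → (χ l * 4 + 7) ∸ c ≡ X
        minus X c eq = trans (cong (_∸ c) (sym eq)) (m+n∸n≡m X c)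
        lemma : ∀ x y a b → (x + y) + (a + b) * 25 ≡ (a * 25 + x) + (b * 25 + y)
        lemma = solve-∀
        finite : ∀ c d → c < 5 → d < 5 → (c + d) % 5 ≡ 2 →
          (residue-weight (χ l * 4 + 7) c + residue-weight (χ l * 4 + 7) d) % 25
            ≡ (χ l * 780 + 630) % 25 → c ≡ 1 × d ≡ 1
        finite c d c<5 d<5 with residues (L l) (fromℕ< c<5) (fromℕ< d<5)
        ... | ok rewrite toℕ-fromℕ< c<5 | toℕ-fromℕ< d<5 = ok

  s≡5u+1 : ∀ P → s P ≡ u P * 5 + 1
  s≡5u+1 P = div5 (s P) (proj₁ (OnLine.c≡1,d≡1 l P∈l (proj₁ (proj₂ (plane-through l P)))))
    where
    l   = proj₁ (line-on-point P)
    P∈l = proj₂ (line-on-point P)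

  m≡5w+1 : ∀ π → m π ≡ w π * 5 + 1
  m≡5w+1 π = div5 (m π) (proj₂ (OnLine.c≡1,d≡1 l P∈l l⊂π))
    where
    l   = proj₁ (line-in-plane π)
    l⊂π = proj₂ (line-in-plane π)
    P∈l = proj₂ (point-on-line l)

  private
    line-sum : ∀ X x → X * 5 + 5 * 1 ≡ x * 20 + 35 → X ≡ x * 4 + 6
    line-sum X x eq = *-cancelʳ-≡ _ _ 5 (cross eq (lemma X x))
      where
      lemma : ∀ X x → X * 5 + (x * 20 + 35) ≡ (x * 4 + 6) * 5 + (X * 5 + 5 * 1)
      lemma = solve-∀

  line-u : ∀ l → lineSum u l ≡ χ l * 4 + 6
  line-u l = line-sum (lineSum u l) (χ l) (trans (cong (λ n → lineSum u l * 5 + n * 1) (sym (points-on-line l)))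
    (trans (sym (shifted-sum finPt (_∈ˡ l) s u 1 (λ P _ → s≡5u+1 P))) (CL l)))

  line-w : ∀ l → pencilSum w l ≡ χ l * 4 + 6
  line-w l = line-sum (pencilSum w l) (χ l) (trans (cong (λ n → pencilSum w l * 5 + n * 1) (sym (planes-on-line l)))
    (trans (sym (shifted-sum finPl (l ⊂_) m w 1 (λ π _ → m≡5w+1 π))) (planes-degree l)))

  line-u²+w² : ∀ l → lineSum (sq u) l + pencilSum (sq w) l ≡ χ l * 28 + 20
  line-u²+w² l = *-cancelʳ-≡ _ _ 25 (cross eq (lemma A₂ B₂ (χ l)))
    where
    A₂ = lineSum (sq u) l
    B₂ = pencilSum (sq w) l
    eq : (A₂ * 25 + ((χ l * 4 + 6) * (10 * 1) + 5 * (1 * 1))) + (B₂ * 25 + ((χ l * 4 + 6) * (10 * 1) + 5 * (1 * 1))) ≡ χ l * 780 + 630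
    eq = trans (sym (cong₂ _+_
        (trans (shifted-squares finPt (_∈ˡ l) s u 1 (λ P _ → s≡5u+1 P))
          (cong₂ (λ a n → A₂ * 25 + (a * (10 * 1) + n * (1 * 1))) (line-u l) (points-on-line l)))
        (trans (shifted-squares finPl (l ⊂_) m w 1 (λ π _ → m≡5w+1 π))
          (cong₂ (λ a n → B₂ * 25 + (a * (10 * 1) + n * (1 * 1))) (line-w l) (planes-on-line l)))))
        (line-squares l)
    lemma : ∀ a b x → (a + b) * 25 + (x * 780 + 630) ≡ (x * 28 + 20) * 25 +
      ((a * 25 + ((x * 4 + 6) * (10 * 1) + 5 * (1 * 1))) + (b * 25 + ((x * 4 + 6) * (10 * 1) + 5 * (1 * 1))))
    lemma = solve-∀

  flag-u+w : ∀ {P π} → P ∈ᵖ π ≡ true → u P + w π ≡ k P π + 1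
  flag-u+w {P} {π} P∈π = *-cancelʳ-≡ _ _ 5 (cross (trans (sym (cong₂ _+_ (s≡5u+1 P) (m≡5w+1 π))) (flag-degree P∈π))
    (lemma (u P) (w π) (k P π)))
    where
    lemma : ∀ a b k → (a + b) * 5 + (k * 5 + 7) ≡ (k + 1) * 5 + (a * 5 + 1 + (b * 5 + 1))
    lemma = solve-∀

  private
    ≤4 : ∀ n → n * 5 + 1 ≤ 21 → n ≤ 4
    ≤4 n le = *-cancelʳ-≤ n 4 5 (+-cancelʳ-≤ 1 (n * 5) 20 le)

    degree≤21 : (r : Ln → Bool) → Lns.Σ′ (λ l → ⟦ r l ⟧) ≡ 21 → Lns.Σ′ (λ l → ⟦ r l ⟧ * χ l) ≤ 21
    degree≤21 r eq = ≤-trans (Lns.Σ-mono (λ l → ≤-trans (*-monoʳ-≤ ⟦ r l ⟧ (⟦⟧≤1 (L l))) (≤-reflexive (*-identityʳ _)))) (≤-reflexive eq)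

  u≤4 : ∀ P → u P ≤ 4
  u≤4 P = ≤4 (u P) (subst (_≤ 21) (s≡5u+1 P) (degree≤21 (P ∈ˡ_) (lines-on-point P)))

  w≤4 : ∀ π → w π ≤ 4
  w≤4 π = ≤4 (w π) (subst (_≤ 21) (m≡5w+1 π) (degree≤21 (_⊂ π) (lines-in-plane π)))

  private
    -- `l` is one of the five lines of the pencil: it is counted by `k P π` if it is in the class
    -- and is among the others if not.
    k+ : ∀ {P l π} → P ∈ˡ l ≡ true → l ⊂ π ≡ true → χ l ≤ k P π × k P π + (1 ∸ χ l) ≤ 5
    k+ {P} {l} {π} P∈l l⊂π = subst (_≤ k P π) (at χ) (Lns.term≤Σ (λ m → pencil P π m * χ m) l) , (begin
      k P π + (1 ∸ χ l)
        ≤⟨ +-monoʳ-≤ (k P π) (subst (_≤ Lns.Σ′ (λ m → pencil P π m * (1 ∸ χ m))) (at (λ m → 1 ∸ χ m)) (Lns.term≤Σ (λ m → pencil P π m * (1 ∸ χ m)) l)) ⟩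
      k P π + Lns.Σ′ (λ m → pencil P π m * (1 ∸ χ m))
        ≡⟨ Lns.Σ-+ _ _ ⟨
      Lns.Σ′ (λ m → pencil P π m * χ m + pencil P π m * (1 ∸ χ m))
        ≡⟨ Lns.Σ-cong (λ m → trans (sym (*-distribˡ-+ (pencil P π m) _ _))
             (trans (cong (pencil P π m *_) (m+[n∸m]≡n (⟦⟧≤1 (L m)))) (*-identityʳ _))) ⟩
      Lns.Σ′ (pencil P π)
        ≡⟨ pencil-size (⊂⇒∈ᵖ P∈l l⊂π) ⟩
      5 ∎)
      where
      open ≤-Reasoning
      at : ∀ g → pencil P π l * g l ≡ g l
      at g = trans (cong₂ (λ a b → ⟦ a ⟧ * ⟦ b ⟧ * g l) P∈l l⊂π) (*-identityˡ (g l))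

  flag-bounds : ∀ {P l π} → P ∈ˡ l ≡ true → l ⊂ π ≡ true → χ l + 1 ≤ u P + w π × u P + w π ≤ χ l + 5
  flag-bounds {P} {l} {π} P∈l l⊂π =
    subst (χ l + 1 ≤_) (sym uw) (+-monoˡ-≤ 1 (proj₁ (k+ P∈l l⊂π))) ,
    subst (_≤ χ l + 5) (sym uw) (upper (L l) (proj₂ (k+ P∈l l⊂π)))
    where
    uw = flag-u+w (⊂⇒∈ᵖ P∈l l⊂π)
    upper : ∀ b → k P π + (1 ∸ ⟦ b ⟧) ≤ 5 → k P π + 1 ≤ ⟦ b ⟧ + 5
    upper false le = le
    upper true  le = ≤-trans (≤-reflexive (trans (+-comm (k P π) 1) (cong suc (sym (+-identityʳ _))))) (s≤s le)

  plane-u : ∀ π → planeSum u π ≡ w π * 4 + 26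
  plane-u π = *-cancelʳ-≡ _ _ 5 (cross eq (lemma (planeSum u π) (w π)))
    where
    eq : planeSum u π * 5 + 21 * 1 ≡ (w π * 5 + 1) * 4 + 147
    eq = trans (cong (λ n → planeSum u π * 5 + n * 1) (sym (points-in-plane π)))
      (trans (sym (shifted-sum finPt (_∈ᵖ π) s u 1 (λ P _ → s≡5u+1 P)))
        (trans (plane-degree π) (cong (λ n → n * 4 + 147) (m≡5w+1 π))))
    lemma : ∀ x w → x * 5 + ((w * 5 + 1) * 4 + 147) ≡ (w * 4 + 26) * 5 + (x * 5 + 21 * 1)
    lemma = solve-∀

  plane-u² : ∀ π → planeSum (sq u) π + w π * w π * 4 ≡ w π * 28 + 36
  plane-u² π = *-cancelʳ-≡ _ _ 25 (cross (sym eq) (lemma V (w π)))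
    where
    V = planeSum (sq u) π
    eq : (w π * 5 + 1) * 303 + 1029 ≡
      (V * 25 + ((w π * 4 + 26) * (10 * 1) + 21 * (1 * 1))) + ((w π * 5 + 1) * 147 + (w π * 5 + 1) * (w π * 5 + 1) * 4)
    eq = trans (cong (λ n → n * 303 + 1029) (sym (m≡5w+1 π))) (trans (plane-squares π)
      (cong₂ _+_ (trans (shifted-squares finPt (_∈ᵖ π) s u 1 (λ P _ → s≡5u+1 P))
          (cong₂ (λ a n → V * 25 + (a * (10 * 1) + n * (1 * 1))) (plane-u π) (points-in-plane π)))
        (cong (λ n → n * 147 + n * n * 4) (m≡5w+1 π))))
    lemma : ∀ v w → (v + w * w * 4) * 25 + ((w * 5 + 1) * 303 + 1029) ≡ (w * 28 + 36) * 25 +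
      ((v * 25 + ((w * 4 + 26) * (10 * 1) + 21 * (1 * 1))) + ((w * 5 + 1) * 147 + (w * 5 + 1) * (w * 5 + 1) * 4))
    lemma = solve-∀

  private
    all-on : (f : Pt → ℕ) → Pts.Σ′ (λ P → ⟦ true ⟧ * f P) ≡ Pts.Σ′ f
    all-on f = Pts.Σ-cong (λ P → *-identityˡ (f P))

  Σu : Pts.Σ′ u ≡ 130
  Σu = *-cancelʳ-≡ _ _ 5 (+-cancelʳ-≡ 85 _ _ (begin
    Pts.Σ′ u * 5 + 85
      ≡⟨ cong₂ (λ a b → a * 5 + b) (all-on u) #points ⟨
    Pts.Σ′ (λ P → 1 * u P) * 5 + Pts.Σ′ (λ _ → 1)
      ≡⟨ cong (λ n → Pts.Σ′ (λ P → 1 * u P) * 5 + n) (*-identityʳ _) ⟨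
    Pts.Σ′ (λ P → 1 * u P) * 5 + Pts.Σ′ (λ _ → 1) * 1
      ≡⟨ shifted-sum finPt (λ _ → true) s u 1 (λ P _ → s≡5u+1 P) ⟨
    Pts.Σ′ (λ P → 1 * s P)
      ≡⟨ trans (all-on s) Σs≡735 ⟩
    735 ∎))
    where open ≡-Reasoning

  Σu² : Pts.Σ′ (sq u) ≡ 268
  Σu² = *-cancelʳ-≡ _ _ 25 (+-cancelʳ-≡ (1300 + 85) _ _ (begin
    Pts.Σ′ (sq u) * 25 + (130 * 10 + 85)
      ≡⟨ cong₂ (λ a b → a * 25 + (b * 10 + 85)) (all-on (sq u)) (trans (all-on u) Σu) ⟨
    V * 25 + (Pts.Σ′ (λ P → 1 * u P) * 10 + 85)
      ≡⟨ cong (λ n → V * 25 + (Pts.Σ′ (λ P → 1 * u P) * 10 + n)) (trans (*-identityʳ _) #points) ⟨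
    V * 25 + (Pts.Σ′ (λ P → 1 * u P) * (10 * 1) + Pts.Σ′ (λ _ → 1) * (1 * 1))
      ≡⟨ shifted-squares finPt (λ _ → true) s u 1 (λ P _ → s≡5u+1 P) ⟨
    Pts.Σ′ (λ P → 1 * (s P * s P))
      ≡⟨ trans (all-on (sq s)) Σs² ⟩
    8085 ∎))
    where
    open ≡-Reasoning
    V = Pts.Σ′ (λ P → 1 * sq u P)

-- Types of lines

-- The multisets of values of u on the points, or of w on the planes, of a line
-- outside of (false) or in (true) the class.
data Kind : Bool → Set where
  ‹21111› ‹31110› ‹22200›                         : Kind false
  ‹22222› ‹33211› ‹33310› ‹43111› ‹42220›         : Kind true

kinds : ∀ b → List (Kind b)
kinds false = ‹21111› ∷ ‹31110› ∷ ‹22200› ∷ []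
kinds true  = ‹22222› ∷ ‹33211› ∷ ‹33310› ∷ ‹43111› ∷ ‹42220› ∷ []

values : ∀ {b} → Kind b → List ℕ
values ‹21111› = 2 ∷ 1 ∷ 1 ∷ 1 ∷ 1 ∷ []
values ‹31110› = 3 ∷ 1 ∷ 1 ∷ 1 ∷ 0 ∷ []
values ‹22200› = 2 ∷ 2 ∷ 2 ∷ 0 ∷ 0 ∷ []
values ‹22222› = 2 ∷ 2 ∷ 2 ∷ 2 ∷ 2 ∷ []
values ‹33211› = 3 ∷ 3 ∷ 2 ∷ 1 ∷ 1 ∷ []
values ‹33310› = 3 ∷ 3 ∷ 3 ∷ 1 ∷ 0 ∷ []
values ‹43111› = 4 ∷ 3 ∷ 1 ∷ 1 ∷ 1 ∷ []
values ‹42220› = 4 ∷ 2 ∷ 2 ∷ 2 ∷ 0 ∷ []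

count : ∀ {b} → Kind b → ℕ → ℕ
count κ j = ∑ (values κ) (λ i → ⟦ i ≡ᵇ j ⟧)

square : ∀ {b} → Kind b → ℕ
square κ = ∑ (values κ) (λ i → i * i)

module _ (xs : List (Fin 5)) where

  total : ℕ
  total = ∑ xs toℕ

  squares : ℕ
  squares = ∑ xs (λ i → toℕ i * toℕ i)

  mult : ℕ → ℕ
  mult j = ∑ xs (λ i → ⟦ toℕ i ≡ᵇ j ⟧)

  OfKind : ∀ {b} → Kind b → Set
  OfKind κ = squares ≡ square κ × (∀ (j : Fin 5) → mult (toℕ j) ≡ count κ (toℕ j))

  -- Recorded are the values that will clash with the other weight: the 0 of 22110, the 1 and 3 of
  -- 32221, the 0 of 33220 and the 4 of 42211.
  Exceptional : Bool → Set
  Exceptional false = squares ≡ 10 × 1 ≤ mult 0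
  Exceptional true  = (squares ≡ 22 × 1 ≤ mult 1 × 1 ≤ mult 3) ⊎ (squares ≡ 26 × (1 ≤ mult 0 ⊎ 1 ≤ mult 4))

  -- The least possible sum of squares is 8 or 20, attained by the most even distribution. As the
  -- two sums of a line add up to 20 or 48, neither exceeds 12 or 28, and few multisets remain in
  -- this range.
  Outcome : Bool → Set
  Outcome b = total ≡ ⟦ b ⟧ * 4 + 6 → ⟦ b ⟧ * 12 + 8 ≤ squares ×
    (squares ≤ ⟦ b ⟧ * 16 + 12 → Any OfKind (kinds b) ⊎ Exceptional b)

  exceptional? : ∀ b → Dec (Exceptional b)
  exceptional? false = (_ ≟ⁿ _) ×-dec (_ ≤? _)
  exceptional? true  = ((_ ≟ⁿ _) ×-dec (_ ≤? _) ×-dec (_ ≤? _)) ⊎-dec ((_ ≟ⁿ _) ×-dec ((_ ≤? _) ⊎-dec (_ ≤? _)))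

  outcome? : ∀ b → Dec (Outcome b)
  outcome? b = (_ ≟ⁿ _) →-dec ((_ ≤? _) ×-dec ((_ ≤? _) →-dec
    (any? (λ κ → (_ ≟ⁿ square κ) ×-dec all? (λ j → _ ≟ⁿ count κ (toℕ j))) (kinds b) ⊎-dec exceptional? b)))

outcomes? : ∀ b → Dec (∀ (i j k m n : Fin 5) → Outcome (i ∷ j ∷ k ∷ m ∷ n ∷ []) b)
outcomes? b = all? λ i → all? λ j → all? λ k → all? λ m → all? λ n → outcome? (i ∷ j ∷ k ∷ m ∷ n ∷ []) b

outcome : ∀ b {xs : List (Fin 5)} → length xs ≡ 5 → Outcome xs b
outcome false {i ∷ j ∷ k ∷ m ∷ n ∷ []} _ = toWitness {a? = outcomes? false} _ i j k m n
outcome true  {i ∷ j ∷ k ∷ m ∷ n ∷ []} _ = toWitness {a? = outcomes? true}  _ i j k m n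

square-regular : ∀ {b} (κ : Kind b) → square κ ≢ 10 × square κ ≢ 22 × square κ ≢ 26
square-regular ‹21111› = (λ ()) , (λ ()) , λ ()
square-regular ‹31110› = (λ ()) , (λ ()) , λ ()
square-regular ‹22200› = (λ ()) , (λ ()) , λ ()
square-regular ‹22222› = (λ ()) , (λ ()) , λ ()
square-regular ‹33211› = (λ ()) , (λ ()) , λ ()
square-regular ‹33310› = (λ ()) , (λ ()) , λ ()
square-regular ‹43111› = (λ ()) , (λ ()) , λ ()
square-regular ‹42220› = (λ ()) , (λ ()) , λ ()

-- These are the flag bounds; they hold for all pairs of values because every point of a line lies
-- in every plane on it.
Compatible : Bool → List (Fin 5) → List (Fin 5) → Set
Compatible b xs ys = ∀ i j → 1 ≤ mult xs i → 1 ≤ mult ys j → ⟦ b ⟧ + 1 ≤ i + j × i + j ≤ ⟦ b ⟧ + 5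

complement : ∀ {x y} n c → x + y ≡ c + n → x ≡ n → y ≡ c
complement n c eq refl = +-cancelˡ-≡ n _ c (trans eq (+-comm c n))

module _ {xs ys : List (Fin 5)} where

  -- The multisets 22110, 32221, 33220 and 42211 have the right sum, but each
  -- could only be paired with another of them, violating the flag bounds.
  not-exceptional : ∀ b → squares xs + squares ys ≡ ⟦ b ⟧ * 28 + 20 → Compatible b xs ys →
    Any (OfKind ys) (kinds b) ⊎ Exceptional ys b → ¬ Exceptional xs b
  not-exceptional false sum ok (inj₁ any) (ten , zero∈)
    with satisfied any
  ... | κ , sq , _ = proj₁ (square-regular κ) (trans (sym sq) (complement 10 10 sum ten))
  not-exceptional false sum ok (inj₂ (_ , zero∈ys)) (_ , zero∈xs) = case proj₁ (ok 0 0 zero∈xs zero∈ys) of λ ()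
  not-exceptional true sum ok (inj₁ any) (inj₁ (sq₂₂ , _)) with satisfied any
  ... | κ , sq , _ = proj₂ (proj₂ (square-regular κ)) (trans (sym sq) (complement 22 26 sum sq₂₂))
  not-exceptional true sum ok (inj₁ any) (inj₂ (sq₂₆ , _)) with satisfied any
  ... | κ , sq , _ = proj₁ (proj₂ (square-regular κ)) (trans (sym sq) (complement 26 22 sum sq₂₆))
  not-exceptional true sum ok (inj₂ (inj₁ (sq , _))) (inj₁ (sq′ , _)) =
    case trans (sym sq) (complement 22 26 sum sq′) of λ ()
  not-exceptional true sum ok (inj₂ (inj₂ (sq , _))) (inj₂ (sq′ , _)) =
    case trans (sym sq) (complement 26 22 sum sq′) of λ ()
  not-exceptional true sum ok (inj₂ (inj₁ (_ , one∈ , three∈))) (inj₂ (_ , inj₁ zero∈)) =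
    case proj₁ (ok 0 1 zero∈ one∈) of λ { (s≤s ()) }
  not-exceptional true sum ok (inj₂ (inj₁ (_ , one∈ , three∈))) (inj₂ (_ , inj₂ four∈)) =
    case proj₂ (ok 4 3 four∈ three∈) of λ { (s≤s (s≤s (s≤s (s≤s (s≤s (s≤s ())))))) }
  not-exceptional true sum ok (inj₂ (inj₂ (_ , inj₁ zero∈))) (inj₁ (_ , one∈ , three∈)) =
    case proj₁ (ok 1 0 one∈ zero∈) of λ { (s≤s ()) }
  not-exceptional true sum ok (inj₂ (inj₂ (_ , inj₂ four∈))) (inj₁ (_ , one∈ , three∈)) =
    case proj₂ (ok 3 4 three∈ four∈) of λ { (s≤s (s≤s (s≤s (s≤s (s≤s (s≤s ())))))) }

kind-of : ∀ b {xs ys} → Outcome xs b → Outcome ys b →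
  total xs ≡ ⟦ b ⟧ * 4 + 6 → total ys ≡ ⟦ b ⟧ * 4 + 6 →
  squares xs + squares ys ≡ ⟦ b ⟧ * 28 + 20 → Compatible b xs ys → ∃ λ (κ : Kind b) → OfKind xs κ
kind-of b {xs} {ys} oxs oys tx ty sum ok = satisfied (case regular of λ where
    (inj₁ any)  → any
    (inj₂ exc)  → ⊥-elim (not-exceptional b sum ok regular′ exc))
  where
  split : ⟦ b ⟧ * 28 + 20 ≡ (⟦ b ⟧ * 16 + 12) + (⟦ b ⟧ * 12 + 8)
  split = lemma ⟦ b ⟧
    where
    lemma : ∀ n → n * 28 + 20 ≡ (n * 16 + 12) + (n * 12 + 8)
    lemma = solve-∀
  upper : ∀ {x y} → x + y ≡ ⟦ b ⟧ * 28 + 20 → ⟦ b ⟧ * 12 + 8 ≤ y → x ≤ ⟦ b ⟧ * 16 + 12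
  upper {x} eq le = +-cancelʳ-≤ _ x _ (≤-trans (+-monoʳ-≤ x le) (≤-reflexive (trans eq split)))
  regular = proj₂ (oxs tx) (upper sum (proj₁ (oys ty)))
  regular′ = proj₂ (oys ty) (upper (trans (+-comm (squares ys) _) sum) (proj₁ (oxs tx)))

≡ᵇ⇒≡′ : ∀ m n → (m ≡ᵇ n) ≡ true → m ≡ n
≡ᵇ⇒≡′ m n eq = ≡ᵇ⇒≡ m n (subst T (sym eq) _)

≡ᵇ-refl : ∀ n → (n ≡ᵇ n) ≡ true
≡ᵇ-refl zero    = refl
≡ᵇ-refl (suc n) = ≡ᵇ-refl n

-- Multiplicities of values on a line, and the type of each line

module Profile {A : Set} (fin : Finite A) (on : A → Bool) (f : A → ℕ) where

  open Sum fin

  occurrences : ℕ → ℕ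
  occurrences j = Σ′ (λ x → ⟦ on x ⟧ * ⟦ f x ≡ᵇ j ⟧)

  record HasKind {b} (κ : Kind b) : Set where
    constructor has-kind
    field
      counts : ∀ (j : Fin 5) → occurrences (toℕ j) ≡ count κ (toℕ j)

  open HasKind public

  occurs : ∀ {x j} → on x ≡ true → f x ≡ j → ⟦ on x ⟧ * ⟦ f x ≡ᵇ j ⟧ ≡ 1
  occurs {x} on-x refl = cong₂ (λ a b → ⟦ a ⟧ * ⟦ b ⟧) on-x (≡ᵇ-refl (f x))

  occurrence : ∀ {x j} → on x ≡ true → f x ≡ j → 1 ≤ occurrences j
  occurrence {x} {j} on-x fx = subst (_≤ occurrences j) (occurs on-x fx) (term≤Σ (λ x → ⟦ on x ⟧ * ⟦ f x ≡ᵇ _ ⟧) x)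

  occurrence₂ : ∀ {x y j} → x ≢ y → on x ≡ true → on y ≡ true → f x ≡ j → f y ≡ j → 2 ≤ occurrences j
  occurrence₂ {j = j} x≢y on-x on-y fx fy = subst (_≤ occurrences j) (cong₂ _+_ (occurs on-x fx) (occurs on-y fy))
    (two-terms≤Σ (λ x → ⟦ on x ⟧ * ⟦ f x ≡ᵇ _ ⟧) x≢y)

  absent : ∀ {b} {κ : Kind b} → HasKind κ → ∀ (j : Fin 5) → count κ (toℕ j) ≡ 0 → ∀ {x} → on x ≡ true → f x ≢ toℕ j
  absent kind j none on-x fx = 1+n≰n (≤-trans (occurrence on-x fx) (≤-reflexive (trans (counts kind j) none)))

  find : ∀ j → 1 ≤ occurrences j → ∃ λ x → on x ≡ true × f x ≡ j
  find j 1≤ with Σ-positive _ 1≤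
  ... | x , hit with on x in on-x | f x ≡ᵇ j in fx
  ...   | true | true = x , on-x , ≡ᵇ⇒≡′ (f x) j fx

  unique-occurrence : ∀ {x y j} → occurrences j ≡ 1 → on x ≡ true → on y ≡ true → f x ≡ j → f y ≡ j → x ≡ y
  unique-occurrence one on-x on-y fx fy = Σ≤1-unique _ (≤-reflexive one)
    (≤-reflexive (sym (occurs on-x fx))) (≤-reflexive (sym (occurs on-y fy)))

  find₂ : ∀ j → 2 ≤ occurrences j → ∃ λ x → ∃ λ y → x ≢ y × (on x ≡ true × f x ≡ j) × (on y ≡ true × f y ≡ j)
  find₂ j 2≤ with search (λ x → (on x ∧ (f x ≡ᵇ j)) ∧ not (does (Finite._≟_ fin (proj₁ first) x)))
    where first = find j (≤-trans (s≤s z≤n) 2≤)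
  ... | inj₁ (y , hit) with on y in on-y | f y ≡ᵇ j in fy | Finite._≟_ fin (proj₁ (find j (≤-trans (s≤s z≤n) 2≤))) y
  ...   | true | true | no x≢y = _ , y , x≢y , proj₂ (find j (≤-trans (s≤s z≤n) 2≤)) , on-y , ≡ᵇ⇒≡′ (f y) j fy
  find₂ j 2≤ | inj₂ none = ⊥-elim (1+n≰n (≤-trans 2≤ (unique-Σ≤1 _ bound λ hx hy → trans (only hx) (sym (only hy)))))
    where
    bound : ∀ x → ⟦ on x ⟧ * ⟦ f x ≡ᵇ j ⟧ ≤ 1
    bound x with on x
    ... | true  = ≤-trans (≤-reflexive (*-identityˡ _)) (⟦⟧≤1 (f x ≡ᵇ j))
    ... | false = z≤n
    first = proj₁ (find j (≤-trans (s≤s z≤n) 2≤))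
    only : ∀ {x} → 1 ≤ ⟦ on x ⟧ * ⟦ f x ≡ᵇ j ⟧ → x ≡ first
    only {x} hx with on x | f x ≡ᵇ j | Finite._≟_ fin first x | none x
    ... | true | true | yes eq | _ = sym eq

  module _ (f≤4 : ∀ x → f x ≤ 4) where

    digit : ∀ x → ∃ λ (j : Fin 5) → f x ≡ toℕ j
    digit x = fromℕ< (s≤s (f≤4 x)) , sym (toℕ-fromℕ< (s≤s (f≤4 x)))

    value : ∀ {b} {κ : Kind b} → HasKind κ → ∀ {x} → on x ≡ true →
      ∃ λ (j : Fin 5) → f x ≡ toℕ j × 1 ≤ count κ (toℕ j)
    value {κ = κ} kind {x} on-x = digit-of (digit x)
      where
      digit-of : (∃ λ (j : Fin 5) → f x ≡ toℕ j) → ∃ λ (j : Fin 5) → f x ≡ toℕ j × 1 ≤ count κ (toℕ j)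
      digit-of (j , fx) = j , fx , subst (1 ≤_) (counts kind j) (occurrence on-x fx)

    -- Turns the values on a line into a short list, to which `outcome` applies. The quantifier over
    -- `g` covers sums, squares and multiplicities at once.
    tuple : ∃ λ (xs : List (Fin 5)) → length xs ≡ Σ′ (λ x → ⟦ on x ⟧) ×
      (∀ g → Σ′ (λ x → ⟦ on x ⟧ * g (f x)) ≡ ∑ xs (g ∘ toℕ))
    tuple = go (Finite.elements fin)
      where
      go : ∀ ys → ∃ λ (xs : List (Fin 5)) → length xs ≡ ∑ ys (λ x → ⟦ on x ⟧) ×
        (∀ g → ∑ ys (λ x → ⟦ on x ⟧ * g (f x)) ≡ ∑ xs (g ∘ toℕ))
      go [] = [] , refl , λ _ → refl
      go (y ∷ ys) with on y | go ys
      ... | false | ih = ih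
      ... | true  | xs , len , sums = fromℕ< (s≤s (f≤4 y)) ∷ xs , cong suc len ,
        λ g → cong₂ _+_ (trans (*-identityˡ _) (cong g (sym (toℕ-fromℕ< (s≤s (f≤4 y)))))) (sums g)

-- All later arguments about the structure of the class use the Cameron-Liebler condition only
-- through this record.
record Weights (S : Space) (L : Space.Ln S → Bool) : Set where
  open Geometry S
  field
    u : Pt → ℕ
    w : Pl → ℕ
    u≤4 : ∀ P → u P ≤ 4
    w≤4 : ∀ π → w π ≤ 4
    degree : ∀ P → Lns.Σ′ (λ l → ⟦ P ∈ˡ l ⟧ * ⟦ L l ⟧) ≡ u P * 5 + 1
    plane-size : ∀ π → Lns.Σ′ (λ l → ⟦ l ⊂ π ⟧ * ⟦ L l ⟧) ≡ w π * 5 + 1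
    flag : ∀ {P π} → P ∈ᵖ π ≡ true → u P + w π ≡ Lns.Σ′ (λ l → pencil P π l * ⟦ L l ⟧) + 1
    flag-bounds : ∀ {P l π} → P ∈ˡ l ≡ true → l ⊂ π ≡ true →
      ⟦ L l ⟧ + 1 ≤ u P + w π × u P + w π ≤ ⟦ L l ⟧ + 5
    line-u : ∀ l → Pts.Σ′ (λ P → ⟦ P ∈ˡ l ⟧ * u P) ≡ ⟦ L l ⟧ * 4 + 6
    line-w : ∀ l → Pls.Σ′ (λ π → ⟦ l ⊂ π ⟧ * w π) ≡ ⟦ L l ⟧ * 4 + 6
    line-u²+w² : ∀ l → Pts.Σ′ (λ P → ⟦ P ∈ˡ l ⟧ * (u P * u P)) + Pls.Σ′ (λ π → ⟦ l ⊂ π ⟧ * (w π * w π)) ≡ ⟦ L l ⟧ * 28 + 20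
    plane-u : ∀ π → planeSum u π ≡ w π * 4 + 26
    plane-u² : ∀ π → planeSum (λ P → u P * u P) π + w π * w π * 4 ≡ w π * 28 + 36
    Σu : Pts.Σ′ u ≡ 130
    Σu² : Pts.Σ′ (λ P → u P * u P) ≡ 268

module Lines {S : Space} {L : Space.Ln S → Bool} (weights : Weights S L) where

  open Geometry S public
  open Weights weights public

  module U (l : Ln) = Profile finPt (_∈ˡ l) u
  module W (l : Ln) = Profile finPl (l ⊂_) w

  -- `balance` links the two kinds: the kind of the points fixes the sum of squares for the planes,
  -- and often the kind of the planes with it.
  record Type (l : Ln) (b : Bool) : Set where
    constructor type
    field
      uκ wκ   : Kind b
      u-kind  : U.HasKind l uκ
      w-kind  : W.HasKind l wκ
      balance : square uκ + square wκ ≡ ⟦ b ⟧ * 28 + 20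

  classify : ∀ l → Type l (L l)
  classify l = conclude (U.tuple l u≤4) (W.tuple l w≤4)
    where
    conclude :
      (∃ λ (xs : List (Fin 5)) → length xs ≡ Pts.Σ′ (λ P → ⟦ P ∈ˡ l ⟧) ×
        (∀ g → Pts.Σ′ (λ P → ⟦ P ∈ˡ l ⟧ * g (u P)) ≡ ∑ xs (g ∘ toℕ))) →
      (∃ λ (ys : List (Fin 5)) → length ys ≡ Pls.Σ′ (λ π → ⟦ l ⊂ π ⟧) ×
        (∀ g → Pls.Σ′ (λ π → ⟦ l ⊂ π ⟧ * g (w π)) ≡ ∑ ys (g ∘ toℕ))) →
      Type l (L l)
    conclude (xs , xs-length , xs-sum) (ys , ys-length , ys-sum) = assemble
      (kind-of (L l) xs-outcome ys-outcome total-xs total-ys sum compatible)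
      (kind-of (L l) ys-outcome xs-outcome total-ys total-xs (trans (+-comm (squares ys) (squares xs)) sum) compatible′)
      where
      xs-outcome : Outcome xs (L l)
      xs-outcome = outcome (L l) (trans xs-length (points-on-line l))
      ys-outcome : Outcome ys (L l)
      ys-outcome = outcome (L l) (trans ys-length (planes-on-line l))
      sum : squares xs + squares ys ≡ ⟦ L l ⟧ * 28 + 20
      sum = trans (sym (cong₂ _+_ (xs-sum (λ n → n * n)) (ys-sum (λ n → n * n)))) (line-u²+w² l)
      total-xs : total xs ≡ ⟦ L l ⟧ * 4 + 6
      total-xs = trans (sym (xs-sum (λ n → n))) (line-u l)
      total-ys : total ys ≡ ⟦ L l ⟧ * 4 + 6
      total-ys = trans (sym (ys-sum (λ n → n))) (line-w l)
      compatible : Compatible (L l) xs ys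
      compatible i j hi hj
        with U.find l i (subst (1 ≤_) (sym (xs-sum (λ n → ⟦ n ≡ᵇ i ⟧))) hi)
           | W.find l j (subst (1 ≤_) (sym (ys-sum (λ n → ⟦ n ≡ᵇ j ⟧))) hj)
      ... | P , P∈l , refl | π , l⊂π , refl = flag-bounds P∈l l⊂π
      compatible′ : Compatible (L l) ys xs
      compatible′ i j hi hj = subst (λ n → ⟦ L l ⟧ + 1 ≤ n × n ≤ ⟦ L l ⟧ + 5) (+-comm j i) (compatible j i hj hi)
      assemble : (∃ λ (κ : Kind (L l)) → OfKind xs κ) → (∃ λ (κ : Kind (L l)) → OfKind ys κ) → Type l (L l)
      assemble (κ , sq , counts) (κ′ , sq′ , counts′) = type κ κ′
        (U.has-kind λ j → trans (xs-sum (λ n → ⟦ n ≡ᵇ toℕ j ⟧)) (counts j))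
        (W.has-kind λ j → trans (ys-sum (λ n → ⟦ n ≡ᵇ toℕ j ⟧)) (counts′ j))
        (trans (sym (cong₂ _+_ sq sq′)) sum)

  line-type : ∀ {l b} → L l ≡ b → Type l b
  line-type {l} Ll = subst (Type l) Ll (classify l)

-- Parity of `u` and exclusion of the value 4

even : ℕ → Bool
even zero          = true
even (suc zero)    = false
even (suc (suc n)) = even n

only-22222 : ∀ (κ : Kind true) → square κ ≡ 20 → κ ≡ ‹22222›
only-22222 ‹22222› _ = refl

-- The kinds 33310 and 43111 have the same sum of squares, but no 2.
only-42220 : ∀ (κ : Kind true) → square κ ≡ 28 → 1 ≤ count κ 2 → κ ≡ ‹42220›
only-42220 ‹42220› _ _ = refl

only-21111 : ∀ (κ : Kind false) → square κ ≡ 8 → κ ≡ ‹21111›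
only-21111 ‹21111› _ = refl

count-4≤1 : ∀ {b} (κ : Kind b) → count κ 4 ≤ 1
count-4≤1 ‹21111› = z≤n
count-4≤1 ‹31110› = z≤n
count-4≤1 ‹22200› = z≤n
count-4≤1 ‹22222› = z≤n
count-4≤1 ‹33211› = z≤n
count-4≤1 ‹33310› = z≤n
count-4≤1 ‹43111› = s≤s z≤n
count-4≤1 ‹42220› = s≤s z≤n

count-0≤2 : ∀ {b} (κ : Kind b) → count κ 0 ≤ 2
count-0≤2 ‹21111› = z≤n
count-0≤2 ‹31110› = s≤s z≤n
count-0≤2 ‹22200› = s≤s (s≤s z≤n)
count-0≤2 ‹22222› = z≤n
count-0≤2 ‹33211› = z≤n
count-0≤2 ‹33310› = s≤s z≤n
count-0≤2 ‹43111› = z≤n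
count-0≤2 ‹42220› = s≤s z≤n

evens : ∀ {b} (κ : Kind b) → count κ 0 + (count κ 2 + count κ 4) ≡ 1 ⊎ count κ 0 + (count κ 2 + count κ 4) ≡ 5
evens ‹21111› = inj₁ refl
evens ‹31110› = inj₁ refl
evens ‹22200› = inj₂ refl
evens ‹22222› = inj₂ refl
evens ‹33211› = inj₁ refl
evens ‹33310› = inj₁ refl
evens ‹43111› = inj₁ refl
evens ‹42220› = inj₂ refl

module Structure {S : Space} {L : Space.Ln S → Bool} (weights : Weights S L) where

  open Lines weights public

  private
    χ : Ln → ℕ
    χ l = ⟦ L l ⟧

    u² : Pt → ℕ
    u² P = u P * u P

  e : Pt → Bool
  e P = even (u P)

  value-of : ∀ {l b} {κ : Kind b} → U.HasKind l κ → ∀ {P} → P ∈ˡ l ≡ true → ∃ λ (j : Fin 5) → u P ≡ toℕ j × 1 ≤ count κ (toℕ j)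
  value-of {l} {κ = κ} = U.value l u≤4 {κ = κ}

  digit-of : ∀ P → ∃ λ (j : Fin 5) → u P ≡ toℕ j
  digit-of P = U.digit (proj₁ (line-on-point P)) u≤4 P

  e-line : ∀ l → lineSum (⟦_⟧ ∘ e) l ≡ 1 ⊎ lineSum (⟦_⟧ ∘ e) l ≡ 5
  e-line l = by-type (classify l)
    where
    open ≡-Reasoning
    split : ∀ P → ⟦ e P ⟧ ≡ ⟦ u P ≡ᵇ 0 ⟧ + (⟦ u P ≡ᵇ 2 ⟧ + ⟦ u P ≡ᵇ 4 ⟧)
    split P = at (digit-of P)
      where
      at : ∀ {n} → (∃ λ (j : Fin 5) → n ≡ toℕ j) → ⟦ even n ⟧ ≡ ⟦ n ≡ᵇ 0 ⟧ + (⟦ n ≡ᵇ 2 ⟧ + ⟦ n ≡ᵇ 4 ⟧)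
      at (zero , refl) = refl
      at (suc zero , refl) = refl
      at (suc (suc zero) , refl) = refl
      at (suc (suc (suc zero)) , refl) = refl
      at (suc (suc (suc (suc zero))) , refl) = refl
    distrib : ∀ i a b c → i * (a + (b + c)) ≡ i * a + (i * b + i * c)
    distrib = solve-∀
    sum : lineSum (⟦_⟧ ∘ e) l ≡ U.occurrences l 0 + (U.occurrences l 2 + U.occurrences l 4)
    sum = begin
      lineSum (⟦_⟧ ∘ e) l
        ≡⟨ Pts.Σ-cong (λ P → trans (cong (⟦ P ∈ˡ l ⟧ *_) (split P))
             (distrib ⟦ P ∈ˡ l ⟧ ⟦ u P ≡ᵇ 0 ⟧ ⟦ u P ≡ᵇ 2 ⟧ ⟦ u P ≡ᵇ 4 ⟧)) ⟩
      Pts.Σ′ (λ P → ⟦ P ∈ˡ l ⟧ * ⟦ u P ≡ᵇ 0 ⟧ + (⟦ P ∈ˡ l ⟧ * ⟦ u P ≡ᵇ 2 ⟧ + ⟦ P ∈ˡ l ⟧ * ⟦ u P ≡ᵇ 4 ⟧))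
        ≡⟨ trans (Pts.Σ-+ _ _) (cong (U.occurrences l 0 +_) (Pts.Σ-+ _ _)) ⟩
      U.occurrences l 0 + (U.occurrences l 2 + U.occurrences l 4) ∎
    by-type : Type l (L l) → lineSum (⟦_⟧ ∘ e) l ≡ 1 ⊎ lineSum (⟦_⟧ ∘ e) l ≡ 5
    by-type (type κ _ kind _ _) = subst (λ n → n ≡ 1 ⊎ n ≡ 5)
      (sym (trans sum (cong₂ _+_ (U.counts kind (# 0)) (cong₂ _+_ (U.counts kind (# 2)) (U.counts kind (# 4)))))) (evens κ)

  even-points : (∀ P → e P ≡ true) ⊎ (∃ λ π → ∀ P → e P ≡ P ∈ᵖ π)
  even-points = hyperplane e e-line

  -- The flag bounds give `u` at most 2 on the plane, and the total 4 · 4 + 26 = 2 · 21 requires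
  -- equality.
  weight-4-plane : ∀ {σ} → w σ ≡ 4 → ∀ {P} → P ∈ᵖ σ ≡ true → u P ≡ 2
  weight-4-plane {σ} wσ {P} P∈σ = *-cancelˡ-≡ _ _ 1 (subst (λ b → ⟦ b ⟧ * u P ≡ ⟦ b ⟧ * 2) P∈σ
    (Pts.Σ≡⇒≡ (λ Q → ⟦⟧*-mono (Q ∈ᵖ σ) bound) doubled P))
    where
    bound : ∀ {Q} → Q ∈ᵖ σ ≡ true → u Q ≤ 2
    bound {Q} Q∈σ =
      let (l , Q∈l , l⊂σ) = line-in-pencil Q∈σ
      in +-cancelʳ-≤ 4 (u Q) 2 (≤-trans (subst (λ n → u Q + n ≤ χ l + 5) wσ (proj₂ (flag-bounds Q∈l l⊂σ)))
           (+-monoˡ-≤ 5 (⟦⟧≤1 (L l))))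
    doubled : planeSum u σ ≡ Pts.Σ′ (λ Q → ⟦ Q ∈ᵖ σ ⟧ * 2)
    doubled = trans (plane-u σ) (trans (cong (λ n → n * 4 + 26) wσ)
      (sym (trans (Pts.Σ-*ʳ _ 2) (cong (_* 2) (points-in-plane σ)))))

  plane⊆⇒≡ : ∀ {π σ} → (∀ P → P ∈ᵖ σ ≡ true → P ∈ᵖ π ≡ true) → ∀ {P} → P ∈ᵖ π ≡ true → P ∈ᵖ σ ≡ true
  plane⊆⇒≡ {π} {σ} σ⊆π {P} P∈π = trans (⟦⟧-injective
    (Pts.Σ≡⇒≡ (λ Q → ⟦⟧-mono (σ⊆π Q)) (trans (points-in-plane σ) (sym (points-in-plane π))) P)) P∈π

  -- Σ u (u − 2) < 0 over a plane of weight 0.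
  weight-0-plane : ∀ {τ} → w τ ≡ 0 → ¬ (∀ P → e P ≡ true)
  weight-0-plane {τ} wτ all-even = <⇒≱ (m≤m+n 37 15) (subst (_≤ 36) twice lower)
    where
    at : ∀ {n} → (∃ λ (j : Fin 5) → n ≡ toℕ j) → even n ≡ true → n * 2 ≤ n * n
    at (zero , refl) _ = z≤n
    at (suc zero , refl) ()
    at (suc (suc zero) , refl) _ = ≤-refl
    at (suc (suc (suc zero)) , refl) ()
    at (suc (suc (suc (suc zero))) , refl) _ = m≤m+n 8 8
    squares≡ : planeSum u² τ ≡ 36
    squares≡ = trans (sym (+-identityʳ _)) (subst (λ n → planeSum u² τ + n * n * 4 ≡ n * 28 + 36) wτ (plane-u² τ))
    twice : Pts.Σ′ (λ P → ⟦ P ∈ᵖ τ ⟧ * u P * 2) ≡ 52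
    twice = trans (Pts.Σ-*ʳ _ 2) (cong (λ n → n * 2) single)
      where
      single : planeSum u τ ≡ 26
      single = trans (plane-u τ) (cong (λ n → n * 4 + 26) wτ)
    lower : Pts.Σ′ (λ P → ⟦ P ∈ᵖ τ ⟧ * u P * 2) ≤ 36
    lower = ≤-trans (Pts.Σ-mono (λ P → ≤-trans (≤-reflexive (*-assoc ⟦ P ∈ᵖ τ ⟧ (u P) 2))
      (*-monoʳ-≤ ⟦ P ∈ᵖ τ ⟧ (at (digit-of P) (all-even P))))) (≤-reflexive squares≡)

  W-22222 : ∀ {l π} → W.HasKind l ‹22222› → l ⊂ π ≡ true → w π ≡ 2
  W-22222 {l} kind l⊂π with W.value l w≤4 kind l⊂π
  ... | zero , _ , ()
  ... | suc zero , _ , ()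
  ... | suc (suc zero) , wπ , _ = wπ
  ... | suc (suc (suc zero)) , _ , ()
  ... | suc (suc (suc (suc zero))) , _ , ()

  module Four {P : Pt} (uP : u P ≡ 4) where

    -- A 4 occurs only in 43111 and 42220. Both have sum of squares 28, which leaves 20 for the
    -- planes.
    four-line : ∀ {l} → P ∈ˡ l ≡ true → W.HasKind l ‹22222›
    four-line {l} P∈l = by-cases (L l) (classify l)
      where
      by-cases : ∀ b → Type l b → W.HasKind l ‹22222›
      by-cases _ (type ‹21111› _ kind _ _) = ⊥-elim (U.absent l kind (# 4) refl P∈l uP)
      by-cases _ (type ‹31110› _ kind _ _) = ⊥-elim (U.absent l kind (# 4) refl P∈l uP)
      by-cases _ (type ‹22200› _ kind _ _) = ⊥-elim (U.absent l kind (# 4) refl P∈l uP)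
      by-cases _ (type ‹22222› _ kind _ _) = ⊥-elim (U.absent l kind (# 4) refl P∈l uP)
      by-cases _ (type ‹33211› _ kind _ _) = ⊥-elim (U.absent l kind (# 4) refl P∈l uP)
      by-cases _ (type ‹33310› _ kind _ _) = ⊥-elim (U.absent l kind (# 4) refl P∈l uP)
      by-cases _ (type ‹43111› κ kind kind′ bal) = subst (W.HasKind l) (only-22222 κ (complement 28 20 bal refl)) kind′
      by-cases _ (type ‹42220› κ kind kind′ bal) = subst (W.HasKind l) (only-22222 κ (complement 28 20 bal refl)) kind′

    four-plane : ∀ {ρ} → P ∈ᵖ ρ ≡ true → w ρ ≡ 2
    four-plane P∈ρ = let (l , P∈l , l⊂ρ) = line-in-pencil P∈ρ in W-22222 (four-line P∈l) l⊂ρ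

    four-unique : ∀ {Q} → u Q ≡ 4 → P ≡ Q
    four-unique {Q} uQ with Finite._≟_ finPt P Q
    ... | yes P≡Q = P≡Q
    ... | no  P≢Q = let (l , P∈l , Q∈l) = join P≢Q in
      ⊥-elim (too-many l P∈l Q∈l (classify l))
      where
      too-many : ∀ l → P ∈ˡ l ≡ true → Q ∈ˡ l ≡ true → Type l (L l) → ⊥
      too-many l P∈l Q∈l (type κ _ kind _ _) =
        1+n≰n (≤-trans (U.occurrence₂ l P≢Q P∈l Q∈l uP uQ) (≤-trans (≤-reflexive (U.counts kind (# 4))) (count-4≤1 κ)))

    -- The plane ρ has 11 lines in the class, of which only 5 pass through P.
    avoiding-line : ∀ {ρ} → P ∈ᵖ ρ ≡ true → ∃ λ l → l ⊂ ρ ≡ true × L l ≡ true × P ∈ˡ l ≡ false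
    avoiding-line {ρ} P∈ρ with Lns.search (λ l → (l ⊂ ρ) ∧ (L l) ∧ not (P ∈ˡ l))
    ... | inj₁ (l , hit) = l , split (l ⊂ ρ) (L l) (P ∈ˡ l) hit
      where
      split : ∀ a b c → a ∧ b ∧ not c ≡ true → a ≡ true × b ≡ true × c ≡ false
      split true true false _ = refl , refl , refl
    ... | inj₂ none = ⊥-elim (eleven≢five (trans (sym eleven) five))
      where
      eleven≢five : 11 ≢ 5
      eleven≢five ()
      in-pencil : ∀ a b c → a ∧ b ∧ not c ≡ false → ⟦ a ⟧ * ⟦ b ⟧ ≡ ⟦ c ⟧ * ⟦ a ⟧ * ⟦ b ⟧
      in-pencil true  true  true  _ = refl
      in-pencil true  false true  _ = refl
      in-pencil true  false false _ = refl
      in-pencil false b     true  _ = refl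
      in-pencil false b     false _ = refl
      eleven : Lns.Σ′ (λ l → ⟦ l ⊂ ρ ⟧ * χ l) ≡ 11
      eleven = trans (plane-size ρ) (cong (λ n → n * 5 + 1) (four-plane P∈ρ))
      pencil-count : Lns.Σ′ (λ l → pencil P ρ l * χ l) ≡ 5
      pencil-count = +-cancelʳ-≡ 1 _ 5 (sym (trans (sym (cong₂ _+_ uP (four-plane P∈ρ))) (flag P∈ρ)))
      five : Lns.Σ′ (λ l → ⟦ l ⊂ ρ ⟧ * χ l) ≡ 5
      five = trans (Lns.Σ-cong (λ l → in-pencil (l ⊂ ρ) (L l) (P ∈ˡ l) (none l))) pencil-count

    module EvenPlane {ρ : Pl} (P∈ρ : P ∈ᵖ ρ ≡ true) (ρ-even : ∀ Q → Q ∈ᵖ ρ ≡ true → e Q ≡ true) where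

      l = proj₁ (avoiding-line P∈ρ)
      l⊂ρ = proj₁ (proj₂ (avoiding-line P∈ρ))
      L-l = proj₁ (proj₂ (proj₂ (avoiding-line P∈ρ)))
      P∉l = proj₂ (proj₂ (proj₂ (avoiding-line P∈ρ)))

      odd-free : ∀ j → even j ≡ false → 1 ≤ U.occurrences l j → ⊥
      odd-free j odd occ with U.find l j occ
      ... | Q , Q∈l , refl = true≢false (ρ-even Q (⊂⇒∈ᵖ Q∈l l⊂ρ)) odd

      -- The points of `l` have even values, and none has the value 4 because `P` is off `l`. So
      -- they are of kind 22222, the planes have sum of squares 28, and the weight 2 of `ρ` decides
      -- among the three kinds with this sum.
      w-kind-42220 : W.HasKind l ‹42220›
      w-kind-42220 = by-cases (line-type L-l)
        where
        by-cases : Type l true → W.HasKind l ‹42220›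
        by-cases (type ‹22222› κ kind kind′ bal) = subst (W.HasKind l)
          (only-42220 κ (complement 20 28 bal refl) (subst (1 ≤_) (W.counts kind′ (# 2)) (W.occurrence l l⊂ρ (four-plane P∈ρ)))) kind′
        by-cases (type ‹33211› _ kind _ _) = ⊥-elim (odd-free 3 refl (subst (1 ≤_) (sym (U.counts kind (# 3))) (s≤s z≤n)))
        by-cases (type ‹33310› _ kind _ _) = ⊥-elim (odd-free 3 refl (subst (1 ≤_) (sym (U.counts kind (# 3))) (s≤s z≤n)))
        by-cases (type ‹43111› _ kind _ _) = ⊥-elim (odd-free 3 refl (subst (1 ≤_) (sym (U.counts kind (# 3))) (s≤s z≤n)))
        by-cases (type ‹42220› _ kind _ _) with U.find l 4 (subst (1 ≤_) (sym (U.counts kind (# 4))) (s≤s z≤n))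
        ... | Q , Q∈l , uQ with four-unique uQ
        ... | refl = ⊥-elim (true≢false Q∈l P∉l)

      heavy : ∃ λ σ → l ⊂ σ ≡ true × w σ ≡ 4
      heavy = W.find l 4 (subst (1 ≤_) (sym (W.counts w-kind-42220 (# 4))) (s≤s z≤n))

      light : ∃ λ τ → l ⊂ τ ≡ true × w τ ≡ 0
      light = W.find l 0 (subst (1 ≤_) (sym (W.counts w-kind-42220 (# 0))) (s≤s z≤n))

    -- If all points are even, the plane of weight 0 gives the contradiction. If the even points
    -- form `π`, the plane of weight 4 lies inside `π` and equals it, but `π` passes through `P` and
    -- so has weight 2.
    impossible : ⊥
    impossible = [ (λ all-even → everywhere all-even (plane-on-point P)) , (λ (π , e≡) → on-plane π e≡) ]′ even-points
      where
      everywhere : (∀ Q → e Q ≡ true) → (∃ λ ρ → P ∈ᵖ ρ ≡ true) → ⊥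
      everywhere all-even (ρ , P∈ρ) = weight-0-plane (proj₂ (proj₂ light)) all-even
        where open EvenPlane {ρ} P∈ρ (λ Q _ → all-even Q)

      on-plane : ∀ π → (∀ Q → e Q ≡ Q ∈ᵖ π) → ⊥
      on-plane π e≡ = 4≢2 (trans (sym wσ) (four-plane (plane⊆⇒≡ σ⊆π P∈π)))
        where
        P∈π : P ∈ᵖ π ≡ true
        P∈π = trans (sym (e≡ P)) (cong even uP)
        open EvenPlane {π} P∈π (λ Q Q∈π → trans (e≡ Q) Q∈π)
        σ = proj₁ heavy
        wσ = proj₂ (proj₂ heavy)
        σ⊆π : ∀ Q → Q ∈ᵖ σ ≡ true → Q ∈ᵖ π ≡ true
        σ⊆π Q Q∈σ = trans (sym (e≡ Q)) (cong even (weight-4-plane wσ Q∈σ))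
        4≢2 : 4 ≢ 2
        4≢2 ()

  no-four : ∀ P → u P ≢ 4
  no-four P uP = Four.impossible uP

  -- The values would be 0 and 2, where n² = 2n; but 268 differs from 2 · 130.
  not-all-even : ¬ (∀ P → e P ≡ true)
  not-all-even all-even = case trans (sym Σu²) (trans (Pts.Σ-cong (λ P → at (digit-of P) (all-even P) (no-four P)))
      (trans (Pts.Σ-*ʳ u 2) (cong (_* 2) Σu))) of λ ()
    where
    at : ∀ {n} → (∃ λ (j : Fin 5) → n ≡ toℕ j) → even n ≡ true → n ≢ 4 → n * n ≡ n * 2
    at (zero , refl) _ _ = refl
    at (suc zero , refl) () _
    at (suc (suc zero) , refl) _ _ = refl
    at (suc (suc (suc zero)) , refl) () _
    at (suc (suc (suc (suc zero))) , refl) _ n≢4 = ⊥-elim (n≢4 refl)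

  even-plane : ∃ λ π → ∀ P → e P ≡ P ∈ᵖ π
  even-plane = [ (λ all-even → ⊥-elim (not-all-even all-even)) , (λ found → found) ]′ even-points

-- The cone

positive-factors : ∀ a b n → 1 ≤ ⟦ a ⟧ * (⟦ b ⟧ * n) → a ≡ true × b ≡ true × 1 ≤ n
positive-factors true true n 1≤ = refl , refl , subst (1 ≤_) (trans (*-identityˡ (1 * n)) (*-identityˡ n)) 1≤

module Cone {S : Space} {L : Space.Ln S → Bool} (weights : Weights S L)
  (π : Space.Pl S) (e≡ : ∀ P → Structure.e weights P ≡ Space._∈ᵖ_ S P π) where

  open Structure weights

  private
    χ : Ln → ℕ
    χ l = ⟦ L l ⟧

    u² : Pt → ℕ
    u² P = u P * u P

  data InPlaneValue (n : ℕ) : Set where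
    is-0 : n ≡ 0 → InPlaneValue n
    is-2 : n ≡ 2 → InPlaneValue n

  data AffineValue (n : ℕ) : Set where
    is-1 : n ≡ 1 → AffineValue n
    is-3 : n ≡ 3 → AffineValue n

  on-π : ∀ {P} → P ∈ᵖ π ≡ true → InPlaneValue (u P)
  on-π {P} P∈π = at (digit-of P) (trans (e≡ P) P∈π) (no-four P)
    where
    at : ∀ {n} → (∃ λ (j : Fin 5) → n ≡ toℕ j) → even n ≡ true → n ≢ 4 → InPlaneValue n
    at (zero , eq) _ _ = is-0 eq
    at (suc zero , refl) () _
    at (suc (suc zero) , eq) _ _ = is-2 eq
    at (suc (suc (suc zero)) , refl) () _
    at (suc (suc (suc (suc zero))) , eq) _ n≢4 = ⊥-elim (n≢4 eq)

  off-π : ∀ {P} → P ∈ᵖ π ≡ false → AffineValue (u P)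
  off-π {P} P∉π = at (digit-of P) (trans (e≡ P) P∉π)
    where
    at : ∀ {n} → (∃ λ (j : Fin 5) → n ≡ toℕ j) → even n ≡ false → AffineValue n
    at (zero , refl) ()
    at (suc zero , eq) _ = is-1 eq
    at (suc (suc zero) , refl) ()
    at (suc (suc (suc zero)) , eq) _ = is-3 eq
    at (suc (suc (suc (suc zero))) , refl) ()

  even⇒∈π : ∀ {P n} → u P ≡ n → even n ≡ true → P ∈ᵖ π ≡ true
  even⇒∈π {P} uP even-n = trans (sym (e≡ P)) (trans (cong even uP) even-n)

  odd⇒∉π : ∀ {P n} → u P ≡ n → even n ≡ false → P ∈ᵖ π ≡ false
  odd⇒∉π {P} uP odd-n = trans (sym (e≡ P)) (trans (cong even uP) odd-n)

  private
    -- Only 0 and 2 occur on `π`, so Σ u² = 2 Σ u there; with `plane-u` and `plane-u²` this becomes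
    -- (w - 1)(w - 4) = 0.
    1∨4 : w π ≡ 1 ⊎ w π ≡ 4
    1∨4 = at (W.digit (proj₁ (line-in-plane π)) w≤4 π) balance
      where
      in-plane : ∀ {n} → InPlaneValue n → n * n ≡ n * 2
      in-plane (is-0 refl) = refl
      in-plane (is-2 refl) = refl
      doubled : planeSum u² π ≡ planeSum u π * 2
      doubled = trans (Pts.Σ-cong (λ P → trans (⟦⟧*-cong (P ∈ᵖ π) (λ P∈π → in-plane (on-π P∈π)))
        (sym (*-assoc ⟦ P ∈ᵖ π ⟧ (u P) 2)))) (Pts.Σ-*ʳ _ 2)
      balance : (w π * 4 + 26) * 2 + w π * w π * 4 ≡ w π * 28 + 36
      balance = trans (cong (λ n → n * 2 + w π * w π * 4) (sym (plane-u π)))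
        (trans (cong (_+ w π * w π * 4) (sym doubled)) (plane-u² π))
      at : ∀ {n} → (∃ λ (j : Fin 5) → n ≡ toℕ j) → (n * 4 + 26) * 2 + n * n * 4 ≡ n * 28 + 36 → n ≡ 1 ⊎ n ≡ 4
      at (zero , refl) ()
      at (suc zero , eq) _ = inj₁ eq
      at (suc (suc zero) , refl) ()
      at (suc (suc (suc zero)) , refl) ()
      at (suc (suc (suc (suc zero))) , eq) _ = inj₂ eq

    -- If w π were 4, the 21 lines through a point with u = 3 would all be in
    -- the class, but such a point is on 16 of them.
    not-4 : w π ≢ 4
    not-4 wπ = use three-point
      where
      three-point : ∃ λ Q → u Q ≡ 3
      three-point with Pts.search (λ Q → u Q ≡ᵇ 3)
      ... | inj₁ (Q , hit) = Q , ≡ᵇ⇒≡′ (u Q) 3 hit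
      -- Without a value 3, `u` would be 2 on `π` and 1 elsewhere, with total 85 + 21.
      ... | inj₂ none = ⊥-elim (130≢106 (trans (sym Σu) (trans (Pts.Σ-cong one-or-two)
          (trans (Pts.Σ-+ (λ _ → 1) (λ P → ⟦ P ∈ᵖ π ⟧)) (cong₂ _+_ #points (points-in-plane π))))))
        where
        130≢106 : 130 ≢ 106
        130≢106 ()
        one-or-two : ∀ P → u P ≡ 1 + ⟦ P ∈ᵖ π ⟧
        one-or-two P with P ∈ᵖ π in P∈π
        ... | true  = weight-4-plane wπ P∈π
        ... | false with off-π P∈π
        ...   | is-1 uP = uP
        ...   | is-3 uP = ⊥-elim (true≢false (trans (cong (_≡ᵇ 3) uP) refl) (none P))
      use : (∃ λ Q → u Q ≡ 3) → ⊥
      use (Q , uQ) = 16≢21 (trans (sym sixteen) (trans (Lns.Σ-cong all-in) (lines-on-point Q)))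
        where
        16≢21 : 16 ≢ 21
        16≢21 ()
        sixteen : Lns.Σ′ (λ l → ⟦ Q ∈ˡ l ⟧ * χ l) ≡ 16
        sixteen = trans (degree Q) (cong (λ n → n * 5 + 1) uQ)
        in-class : ∀ {l} → Q ∈ˡ l ≡ true → ∀ b → Type l b → b ≡ true
        in-class {l} Q∈l true _ = refl
        in-class {l} Q∈l false (type ‹21111› _ kind _ _) = ⊥-elim (U.absent l kind (# 3) refl Q∈l uQ)
        -- The line meets `π` in a point with value 2, which its kind does not contain.
        in-class {l} Q∈l false (type ‹31110› _ kind _ _) = let (R , R∈l , R∈π) = meets-plane l π in
          ⊥-elim (U.absent l kind (# 2) refl R∈l (weight-4-plane wπ R∈π))
        in-class {l} Q∈l false (type ‹22200› _ kind _ _) = ⊥-elim (U.absent l kind (# 3) refl Q∈l uQ)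
        all-in : ∀ l → ⟦ Q ∈ˡ l ⟧ * χ l ≡ ⟦ Q ∈ˡ l ⟧
        all-in l = trans (⟦⟧*-cong (Q ∈ˡ l) (λ Q∈l → cong ⟦_⟧ (in-class Q∈l (L l) (classify l)))) (*-identityʳ _)

  wπ : w π ≡ 1
  wπ = [ (λ eq → eq) , (λ eq → ⊥-elim (not-4 eq)) ]′ 1∨4

  O : Pt → Bool
  O P = u P ≡ᵇ 0

  O⇒u≡0 : ∀ {P} → O P ≡ true → u P ≡ 0
  O⇒u≡0 {P} = ≡ᵇ⇒≡′ (u P) 0

  u≡0⇒O : ∀ {P} → u P ≡ 0 → O P ≡ true
  u≡0⇒O eq = cong (_≡ᵇ 0) eq

  -- The sum 30 over `π` falls short of 2 · 21 by 12, and each zero accounts for 2.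
  |O| : Pts.Σ′ (⟦_⟧ ∘ O) ≡ 6
  |O| = *-cancelʳ-≡ _ 6 2 (+-cancelˡ-≡ 30 _ 12 (begin
    30 + Pts.Σ′ (⟦_⟧ ∘ O) * 2
      ≡⟨ cong₂ _+_ thirty (Pts.Σ-*ʳ (⟦_⟧ ∘ O) 2) ⟨
    planeSum u π + Pts.Σ′ (λ P → ⟦ O P ⟧ * 2)
      ≡⟨ Pts.Σ-+ _ _ ⟨
    Pts.Σ′ (λ P → ⟦ P ∈ᵖ π ⟧ * u P + ⟦ O P ⟧ * 2)
      ≡⟨ Pts.Σ-cong pointwise ⟩
    Pts.Σ′ (λ P → ⟦ P ∈ᵖ π ⟧ * 2)
      ≡⟨ trans (Pts.Σ-*ʳ _ 2) (cong (λ n → n * 2) (points-in-plane π)) ⟩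
    42 ∎))
    where
    open ≡-Reasoning
    thirty : planeSum u π ≡ 30
    thirty = trans (plane-u π) (cong (λ n → n * 4 + 26) wπ)
    affine : ∀ {n} → AffineValue n → ⟦ n ≡ᵇ 0 ⟧ * 2 ≡ 0
    affine (is-1 refl) = refl
    affine (is-3 refl) = refl
    planar : ∀ {n} → InPlaneValue n → 1 * n + ⟦ n ≡ᵇ 0 ⟧ * 2 ≡ 2
    planar (is-0 refl) = refl
    planar (is-2 refl) = refl
    pointwise : ∀ P → ⟦ P ∈ᵖ π ⟧ * u P + ⟦ O P ⟧ * 2 ≡ ⟦ P ∈ᵖ π ⟧ * 2
    pointwise P with P ∈ᵖ π in P∈π
    ... | true  = planar (on-π P∈π)
    ... | false = affine (off-π P∈π)

  -- The future lines of the cone, characterised before the apex is available.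
  record Generator (c : Ln) (z : Pt) : Set where
    field
      in-class : L c ≡ true
      on-line  : z ∈ˡ c ≡ true
      at-zero  : u z ≡ 0

  open Generator

  generator-kind : ∀ {c z} → Generator c z → U.HasKind c ‹33310› × W.HasKind c ‹22222›
  generator-kind {c} {z} g = by-cases (line-type (in-class g))
    where
    by-cases : Type c true → U.HasKind c ‹33310› × W.HasKind c ‹22222›
    by-cases (type ‹22222› _ kind _ _) = ⊥-elim (U.absent c kind (# 0) refl (on-line g) (at-zero g))
    by-cases (type ‹33211› _ kind _ _) = ⊥-elim (U.absent c kind (# 0) refl (on-line g) (at-zero g))
    by-cases (type ‹33310› κ kind kind′ bal) = kind , subst (W.HasKind c) (only-22222 κ (complement 28 20 bal refl)) kind′
    by-cases (type ‹43111› _ kind _ _) = ⊥-elim (U.absent c kind (# 0) refl (on-line g) (at-zero g))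
    by-cases (type ‹42220› _ kind _ _) =
      let (P , _ , uP) = U.find c 4 (subst (1 ≤_) (sym (U.counts kind (# 4))) (s≤s z≤n)) in ⊥-elim (no-four P uP)

  generator-at : ∀ {z} → u z ≡ 0 → ∃ λ c → Generator c z
  generator-at {z} uz with Lns.Σ-positive (λ l → ⟦ z ∈ˡ l ⟧ * χ l) (≤-reflexive (sym (trans (degree z) (cong (λ n → n * 5 + 1) uz))))
  ... | c , hit with z ∈ˡ c in z∈c | L c in Lc
  ...   | true | true = c , record { in-class = Lc ; on-line = z∈c ; at-zero = uz }

  -- A zero has degree 5 · 0 + 1 = 1.
  generator-unique : ∀ {c c′ z} → Generator c z → Generator c′ z → c ≡ c′
  generator-unique {c} {c′} {z} g g′ = Lns.Σ≤1-unique (λ l → ⟦ z ∈ˡ l ⟧ * χ l)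
    (≤-reflexive (trans (degree z) (cong (λ n → n * 5 + 1) (at-zero g)))) (hit g) (hit g′)
    where
    hit : ∀ {c} → Generator c z → 1 ≤ ⟦ z ∈ˡ c ⟧ * χ c
    hit g = ≤-reflexive (sym (cong₂ (λ a b → ⟦ a ⟧ * ⟦ b ⟧) (on-line g) (in-class g)))

  Σ-zeros : ∀ P → Lns.Σ′ (λ l → ⟦ P ∈ˡ l ⟧ * U.occurrences l 0) ≡ 6 + ⟦ O P ⟧ * 20
  Σ-zeros P = trans (star-sum (⟦_⟧ ∘ O) P) (cong (_+ ⟦ O P ⟧ * 20) |O|)

  module _ {Q : Pt} (uQ : u Q ≡ 3) where

    private
      simplify : ∀ n → 1 * (1 * n) ≡ n
      simplify n = trans (*-identityˡ (1 * n)) (*-identityˡ n)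

      meeting : Ln → ℕ
      meeting l = ⟦ Q ∈ˡ l ⟧ * (χ l * U.occurrences l 0)

      -- The 21 lines on `Q` carry all six zeros. The five outside the class are of kind 31110 and
      -- carry one each, so a single zero is left for the 16 in the class.
      one-generator : Lns.Σ′ meeting ≡ 1
      one-generator = +-cancelˡ-≡ 21 _ 1 (sym (begin
        22
          ≡⟨ cong₂ _+_ sixteen six ⟨
        Lns.Σ′ (λ l → ⟦ Q ∈ˡ l ⟧ * χ l) + Lns.Σ′ (λ l → ⟦ Q ∈ˡ l ⟧ * U.occurrences l 0)
          ≡⟨ Lns.Σ-+ _ _ ⟨
        Lns.Σ′ (λ l → ⟦ Q ∈ˡ l ⟧ * χ l + ⟦ Q ∈ˡ l ⟧ * U.occurrences l 0)
          ≡⟨ Lns.Σ-cong (λ l → trans (sym (*-distribˡ-+ ⟦ Q ∈ˡ l ⟧ _ _)) (trans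
               (⟦⟧*-cong (Q ∈ˡ l) (λ Q∈l → exchange Q∈l (L l) (classify l)))
               (trans (*-distribˡ-+ ⟦ Q ∈ˡ l ⟧ 1 _) (cong (_+ meeting l) (*-identityʳ _))))) ⟩
        Lns.Σ′ (λ l → ⟦ Q ∈ˡ l ⟧ + meeting l)
          ≡⟨ trans (Lns.Σ-+ _ meeting) (cong (_+ Lns.Σ′ meeting) (lines-on-point Q)) ⟩
        21 + Lns.Σ′ meeting ∎))
        where
        open ≡-Reasoning
        sixteen : Lns.Σ′ (λ l → ⟦ Q ∈ˡ l ⟧ * χ l) ≡ 16
        sixteen = trans (degree Q) (cong (λ n → n * 5 + 1) uQ)
        six : Lns.Σ′ (λ l → ⟦ Q ∈ˡ l ⟧ * U.occurrences l 0) ≡ 6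
        six = trans (Σ-zeros Q) (cong (λ n → 6 + ⟦ n ≡ᵇ 0 ⟧ * 20) uQ)
        -- The same count line by line: trivial in the class, and outside it the statement that
        -- 31110 has one zero.
        exchange : ∀ {l} → Q ∈ˡ l ≡ true → ∀ b → Type l b →
          ⟦ b ⟧ + U.occurrences l 0 ≡ 1 + ⟦ b ⟧ * U.occurrences l 0
        exchange {l} Q∈l b (type ‹21111› _ kind _ _) = ⊥-elim (U.absent l kind (# 3) refl Q∈l uQ)
        exchange {l} Q∈l b (type ‹31110› _ kind _ _) = U.counts kind (# 0)
        exchange {l} Q∈l b (type ‹22200› _ kind _ _) = ⊥-elim (U.absent l kind (# 3) refl Q∈l uQ)
        exchange {l} Q∈l b (type ‹22222› _ kind _ _) = ⊥-elim (U.absent l kind (# 3) refl Q∈l uQ)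
        exchange {l} Q∈l b (type ‹33211› _ kind _ _) = cong suc (sym (*-identityˡ _))
        exchange {l} Q∈l b (type ‹33310› _ kind _ _) = cong suc (sym (*-identityˡ _))
        exchange {l} Q∈l b (type ‹43111› _ kind _ _) = cong suc (sym (*-identityˡ _))
        exchange {l} Q∈l b (type ‹42220› _ kind _ _) = cong suc (sym (*-identityˡ _))

    generator-through-3 : ∃ λ c → ∃ λ z → Generator c z × Q ∈ˡ c ≡ true
    generator-through-3 = build (Lns.Σ-positive meeting (≤-reflexive (sym one-generator)))
      where
      build : (∃ λ c → 1 ≤ meeting c) → ∃ λ c → ∃ λ z → Generator c z × Q ∈ˡ c ≡ true
      build (c , hit) = on-zero (positive-factors (Q ∈ˡ c) (L c) (U.occurrences c 0) hit)
        where
        on-zero : Q ∈ˡ c ≡ true × L c ≡ true × 1 ≤ U.occurrences c 0 → ∃ λ c → ∃ λ z → Generator c z × Q ∈ˡ c ≡ true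
        on-zero (Q∈c , Lc , pos) =
          let (z , z∈c , uz) = U.find c 0 pos
          in c , z , record { in-class = Lc ; on-line = z∈c ; at-zero = uz } , Q∈c

    generator-through-3-unique : ∀ {c c′ z z′} → Generator c z → Generator c′ z′ →
      Q ∈ˡ c ≡ true → Q ∈ˡ c′ ≡ true → c ≡ c′
    generator-through-3-unique g g′ Q∈c Q∈c′ = Lns.Σ≤1-unique meeting (≤-reflexive one-generator) (hit g Q∈c) (hit g′ Q∈c′)
      where
      hit : ∀ {c z} → Generator c z → Q ∈ˡ c ≡ true → 1 ≤ meeting c
      hit {c} g Q∈c = subst (1 ≤_)
        (sym (trans (cong₂ (λ a b → ⟦ a ⟧ * (⟦ b ⟧ * U.occurrences c 0)) Q∈c (in-class g))
          (simplify (U.occurrences c 0))))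
        (U.occurrence c (on-line g) (at-zero g))

  -- The line joining two zeros lies in a single plane of weight 2, while every
  -- plane on a generator has weight 2; so any two generators are coplanar.
  generators-meet : ∀ {c c′ z z′} → Generator c z → Generator c′ z′ → c ≢ c′ →
    ∃ λ X → X ∈ˡ c ≡ true × X ∈ˡ c′ ≡ true × u X ≡ 1
  generators-meet {c} {c′} {z} {z′} g g′ c≢c′ = X , X∈c , X∈c′ , at-1 (value-of (proj₁ (generator-kind g)) X∈c)
    where
    z≢z′ : z ≢ z′
    z≢z′ refl = c≢c′ (generator-unique g g′)
    joined = join z≢z′
    n = proj₁ joined
    z∈n = proj₁ (proj₂ joined)
    z′∈n = proj₂ (proj₂ joined)
    two-zeros : 2 ≤ U.occurrences n 0
    two-zeros = U.occurrence₂ n z≢z′ z∈n z′∈n (at-zero g) (at-zero g′)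
    -- Only 22200 has two zeros; its sum of squares 12 leaves 8 for the planes, hence the kind
    -- 21111.
    n-kind : ∀ b → Type n b → W.occurrences n 2 ≡ 1
    n-kind _ (type ‹21111› _ kind _ _) = ⊥-elim (<⇒≱ two-zeros (≤-trans (≤-reflexive (U.counts kind (# 0))) z≤n))
    n-kind _ (type ‹31110› _ kind _ _) = ⊥-elim (<⇒≱ two-zeros (≤-reflexive (U.counts kind (# 0))))
    n-kind _ (type ‹22200› κ kind kind′ bal) = W.counts (subst (W.HasKind n) (only-21111 κ (complement 12 8 bal refl)) kind′) (# 2)
    n-kind _ (type ‹22222› _ kind _ _) = ⊥-elim (<⇒≱ two-zeros (≤-trans (≤-reflexive (U.counts kind (# 0))) z≤n))
    n-kind _ (type ‹33211› _ kind _ _) = ⊥-elim (<⇒≱ two-zeros (≤-trans (≤-reflexive (U.counts kind (# 0))) z≤n))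
    n-kind _ (type ‹33310› _ kind _ _) = ⊥-elim (<⇒≱ two-zeros (≤-reflexive (U.counts kind (# 0))))
    n-kind _ (type ‹43111› _ kind _ _) = ⊥-elim (<⇒≱ two-zeros (≤-trans (≤-reflexive (U.counts kind (# 0))) z≤n))
    n-kind _ (type ‹42220› _ kind _ _) = ⊥-elim (<⇒≱ two-zeros (≤-reflexive (U.counts kind (# 0))))
    on-c = plane-through c z′
    ρ = proj₁ on-c
    c⊂ρ = proj₁ (proj₂ on-c)
    on-c′ = plane-through c′ z
    ρ′ = proj₁ on-c′
    c′⊂ρ′ = proj₁ (proj₂ on-c′)
    n⊂ρ : n ⊂ ρ ≡ true
    n⊂ρ = span⊂ z≢z′ z∈n z′∈n (⊂⇒∈ᵖ (on-line g) c⊂ρ) (proj₂ (proj₂ on-c))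
    n⊂ρ′ : n ⊂ ρ′ ≡ true
    n⊂ρ′ = span⊂ z≢z′ z∈n z′∈n (proj₂ (proj₂ on-c′)) (⊂⇒∈ᵖ (on-line g′) c′⊂ρ′)
    ρ≡ρ′ : ρ ≡ ρ′
    ρ≡ρ′ = W.unique-occurrence n (n-kind (L n) (classify n)) n⊂ρ n⊂ρ′
      (W-22222 (proj₂ (generator-kind g)) c⊂ρ) (W-22222 (proj₂ (generator-kind g′)) c′⊂ρ′)
    met = coplanar-meet c⊂ρ (subst (λ σ → c′ ⊂ σ ≡ true) (sym ρ≡ρ′) c′⊂ρ′)
    X = proj₁ met
    X∈c = proj₁ (proj₂ met)
    X∈c′ = proj₂ (proj₂ met)
    -- A common point with value 0 or 3 would make the two generators equal.
    at-1 : (∃ λ (j : Fin 5) → u X ≡ toℕ j × 1 ≤ count ‹33310› (toℕ j)) → u X ≡ 1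
    at-1 (zero , uX , _) = ⊥-elim (c≢c′ (generator-unique
      (record { in-class = in-class g ; on-line = X∈c ; at-zero = uX })
      (record { in-class = in-class g′ ; on-line = X∈c′ ; at-zero = uX })))
    at-1 (suc zero , uX , _) = uX
    at-1 (suc (suc zero) , _ , ())
    at-1 (suc (suc (suc zero)) , uX , _) = ⊥-elim (c≢c′ (generator-through-3-unique uX g g′ X∈c X∈c′))
    at-1 (suc (suc (suc (suc zero))) , _ , ())

  -- The kind 33310 has a single 1, so every other generator meets `c₀` in the same point.
  common-point : ∀ {c₀ z₀ P} → Generator c₀ z₀ → P ∈ˡ c₀ ≡ true → u P ≡ 1 →
    ∀ {c z} → Generator c z → P ∈ˡ c ≡ true
  common-point {c₀} {P = P} g₀ P∈c₀ uP {c} g with Finite._≟_ finLn c₀ c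
  ... | yes refl = P∈c₀
  ... | no c₀≢c = same-point (generators-meet g₀ g c₀≢c)
    where
    same-point : (∃ λ X → X ∈ˡ c₀ ≡ true × X ∈ˡ c ≡ true × u X ≡ 1) → P ∈ˡ c ≡ true
    same-point (X , X∈c₀ , X∈c , uX) = subst (λ Y → Y ∈ˡ c ≡ true)
      (U.unique-occurrence c₀ (U.counts (proj₁ (generator-kind g₀)) (# 1)) X∈c₀ P∈c₀ uX uP) X∈c

  apex-exists : ∃ λ P → u P ≡ 1 × (∀ {c z} → Generator c z → P ∈ˡ c ≡ true)
  apex-exists = on-zero (some-true finPt O |O|)
    where
    on-generator : ∀ {z} → (∃ λ c → Generator c z) → ∃ λ P → u P ≡ 1 × (∀ {c z} → Generator c z → P ∈ˡ c ≡ true)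
    on-generator (c , g) =
      let (P , P∈c , uP) = U.find c 1 (subst (1 ≤_) (sym (U.counts (proj₁ (generator-kind g)) (# 1))) (s≤s z≤n))
      in P , uP , common-point g P∈c uP
    on-zero : (∃ λ z → O z ≡ true) → ∃ λ P → u P ≡ 1 × (∀ {c z} → Generator c z → P ∈ˡ c ≡ true)
    on-zero (z , Oz) = on-generator (generator-at (O⇒u≡0 Oz))

  module Apex (apex : Pt) (u-apex : u apex ≡ 1) (apex∈ : ∀ {c z} → Generator c z → apex ∈ˡ c ≡ true) where

    apex∉π : apex ∈ᵖ π ≡ false
    apex∉π = odd⇒∉π u-apex refl

    -- The generator of the zero also joins it to the apex, and the joining line is unique.
    apex-zero-line : ∀ {l z} → apex ∈ˡ l ≡ true → z ∈ˡ l ≡ true → u z ≡ 0 → Generator l z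
    apex-zero-line {l} {z} P∈l z∈l uz =
      let (c , g) = generator-at uz
      in subst (λ l → Generator l z) (line-unique apex≢z (apex∈ g) (on-line g) P∈l z∈l) g
      where
      apex≢z : apex ≢ z
      apex≢z eq = case trans (sym u-apex) (trans (cong u eq) uz) of λ ()

    -- Six zeros face six lines of the class through the apex. A line on the apex with a zero is a
    -- generator and has exactly one, so the two counts agree on each line.
    apex-line-zero : ∀ {l} → apex ∈ˡ l ≡ true → L l ≡ true → 1 ≤ U.occurrences l 0
    apex-line-zero {l} P∈l Ll = ≤-reflexive (sym (begin
      U.occurrences l 0                      ≡⟨ *-identityˡ _ ⟨
      1 * U.occurrences l 0                  ≡⟨ cong (λ b → ⟦ b ⟧ * U.occurrences l 0) P∈l ⟨
      ⟦ apex ∈ˡ l ⟧ * U.occurrences l 0      ≡⟨ Lns.Σ≡⇒≡ bound (trans six (sym six′)) l ⟩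
      ⟦ apex ∈ˡ l ⟧ * χ l                    ≡⟨ cong₂ (λ a b → ⟦ a ⟧ * ⟦ b ⟧) P∈l Ll ⟩
      1                                      ∎))
      where
      open ≡-Reasoning
      six : Lns.Σ′ (λ m → ⟦ apex ∈ˡ m ⟧ * U.occurrences m 0) ≡ 6
      six = trans (Σ-zeros apex) (cong (λ n → 6 + ⟦ n ≡ᵇ 0 ⟧ * 20) u-apex)
      six′ : Lns.Σ′ (λ m → ⟦ apex ∈ˡ m ⟧ * χ m) ≡ 6
      six′ = trans (degree apex) (cong (λ n → n * 5 + 1) u-apex)
      zeros≤ : ∀ {m} → apex ∈ˡ m ≡ true → U.occurrences m 0 ≤ χ m
      zeros≤ {m} P∈m with 1 ≤? U.occurrences m 0
      ... | no  none = ≤-trans (≤-pred (≰⇒> none)) z≤n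
      ... | yes some =
        let (z , z∈m , uz) = U.find m 0 some
            g = apex-zero-line P∈m z∈m uz
        in ≤-reflexive (trans (U.counts (proj₁ (generator-kind g)) (# 0)) (sym (cong ⟦_⟧ (in-class g))))
      bound : ∀ m → ⟦ apex ∈ˡ m ⟧ * U.occurrences m 0 ≤ ⟦ apex ∈ˡ m ⟧ * χ m
      bound m = ⟦⟧*-mono (apex ∈ˡ m) zeros≤

    no-three-zeros : ∀ {l x y z} → x ≢ y → x ≢ z → y ≢ z → x ∈ˡ l ≡ true → y ∈ˡ l ≡ true → z ∈ˡ l ≡ true →
      u x ≡ 0 → u y ≡ 0 → u z ≢ 0
    no-three-zeros {l} x≢y x≢z y≢z x∈l y∈l z∈l ux uy uz = bounded (classify l)
      where
      three : 3 ≤ U.occurrences l 0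
      three = subst (_≤ U.occurrences l 0)
        (cong₂ _+_ (U.occurs l x∈l ux) (cong₂ _+_ (U.occurs l y∈l uy) (U.occurs l z∈l uz)))
        (Pts.three-terms≤Σ (λ P → ⟦ P ∈ˡ l ⟧ * ⟦ u P ≡ᵇ 0 ⟧) x≢y x≢z y≢z)
      bounded : Type l (L l) → ⊥
      bounded (type κ _ kind _ _) = <⇒≱ three (≤-trans (≤-reflexive (U.counts kind (# 0))) (count-0≤2 κ))

    -- The families of the theorem in terms of `u`; for lines of the class they are the kinds 33310,
    -- 33211 and 22222.
    data Description (l : Ln) : Set where
      cone    : ∀ {z} → apex ∈ˡ l ≡ true → z ∈ˡ l ≡ true → u z ≡ 0 → Description l
      secant  : ∀ {c c′ z z′ Y Y′} → apex ∈ˡ l ≡ false → (∀ {Q} → Q ∈ˡ l ≡ true → u Q ≢ 0) → c ≢ c′ →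
        Generator c z → Generator c′ z′ → Y ∈ˡ l ≡ true → Y ∈ˡ c ≡ true → Y′ ∈ˡ l ≡ true → Y′ ∈ˡ c′ ≡ true →
        Description l
      planar  : (∀ {Q} → Q ∈ˡ l ≡ true → Q ∈ᵖ π ≡ true) → (∀ {Q} → Q ∈ˡ l ≡ true → u Q ≢ 0) → Description l

    describe : ∀ {l} → L l ≡ true → Description l
    describe {l} Ll = by-cases (line-type Ll)
      where
      by-cases : Type l true → Description l
      by-cases (type ‹22222› _ kind _ _) = planar (λ Q∈l → two (value-of kind Q∈l)) (U.absent l kind (# 0) refl)
        where
        two : ∀ {Q} → (∃ λ (j : Fin 5) → u Q ≡ toℕ j × 1 ≤ count ‹22222› (toℕ j)) → Q ∈ᵖ π ≡ true
        two (zero , _ , ())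
        two (suc zero , _ , ())
        two (suc (suc zero) , uQ , _) = even⇒∈π uQ refl
        two (suc (suc (suc zero)) , _ , ())
        two (suc (suc (suc (suc zero))) , _ , ())
      by-cases (type ‹33310› _ kind _ _) =
        let (z , z∈l , uz) = U.find l 0 (subst (1 ≤_) (sym (U.counts kind (# 0))) (s≤s z≤n))
            g = record { in-class = Ll ; on-line = z∈l ; at-zero = uz }
        in cone (apex∈ g) z∈l uz
      -- Each of the two points with value 3 lies on a generator. One generator through both would
      -- be `l` itself, which has no zero.
      by-cases (type ‹33211› _ kind _ _) =
        let (Y , Y′ , Y≢Y′ , (Y∈l , uY) , (Y′∈l , uY′)) = U.find₂ l 3 (subst (2 ≤_) (sym (U.counts kind (# 3))) (s≤s (s≤s z≤n)))
            (c , z , g , Y∈c) = generator-through-3 uY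
            (c′ , z′ , g′ , Y′∈c′) = generator-through-3 uY′
        in secant apex∉l misses (different Y≢Y′ Y∈l Y′∈l g Y∈c Y′∈c′) g g′ Y∈l Y∈c Y′∈l Y′∈c′
        where
        misses : ∀ {Q} → Q ∈ˡ l ≡ true → u Q ≢ 0
        misses = U.absent l kind (# 0) refl
        apex∉l : apex ∈ˡ l ≡ false
        apex∉l with apex ∈ˡ l in P∈l
        ... | false = refl
        ... | true  = ⊥-elim (1+n≰n (≤-trans (apex-line-zero P∈l Ll) (≤-reflexive (U.counts kind (# 0)))))
        different : ∀ {Y Y′ c c′ z} → Y ≢ Y′ → Y ∈ˡ l ≡ true → Y′ ∈ˡ l ≡ true → Generator c z →
          Y ∈ˡ c ≡ true → Y′ ∈ˡ c′ ≡ true → c ≢ c′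
        different Y≢Y′ Y∈l Y′∈l g Y∈c Y′∈c refl =
          misses (subst (λ m → _ ∈ˡ m ≡ true) (line-unique Y≢Y′ Y∈c Y′∈c Y∈l Y′∈l) (on-line g)) (at-zero g)
      by-cases (type ‹43111› _ kind _ _) =
        let (P , _ , uP) = U.find l 4 (subst (1 ≤_) (sym (U.counts kind (# 4))) (s≤s z≤n)) in ⊥-elim (no-four P uP)
      by-cases (type ‹42220› _ kind _ _) =
        let (P , _ , uP) = U.find l 4 (subst (1 ≤_) (sym (U.counts kind (# 4))) (s≤s z≤n)) in ⊥-elim (no-four P uP)

    -- The kinds outside the class are 21111, 31110 and 22200. None has two 3s, which excludes
    -- secants; each has a 1 or a 0, which excludes lines of `π` that miss the zeros.
    described : ∀ {l} → Description l → L l ≡ true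
    described (cone P∈l z∈l uz) = in-class (apex-zero-line P∈l z∈l uz)
    described {l} (secant {c} {c′} {Y = Y} {Y′ = Y′} P∉l misses c≢c′ g g′ Y∈l Y∈c Y′∈l Y′∈c′) = by-cases (L l) (classify l)
      where
      -- A generator has the values 3, 1 and 0; the 0 is excluded by `misses`, and the 1 belongs to
      -- the apex, which is off `l`.
      three : ∀ {c z Y} → Generator c z → Y ∈ˡ l ≡ true → Y ∈ˡ c ≡ true → u Y ≡ 3
      three {c} {z} {Y} g Y∈l Y∈c = at (value-of (proj₁ (generator-kind g)) Y∈c)
        where
        at : (∃ λ (j : Fin 5) → u Y ≡ toℕ j × 1 ≤ count ‹33310› (toℕ j)) → u Y ≡ 3
        at (zero , uY , _) = ⊥-elim (misses Y∈l uY)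
        at (suc zero , uY , _) = ⊥-elim (true≢false (subst (λ R → R ∈ˡ l ≡ true)
          (U.unique-occurrence c (U.counts (proj₁ (generator-kind g)) (# 1)) Y∈c (apex∈ g) uY u-apex) Y∈l) P∉l)
        at (suc (suc zero) , _ , ())
        at (suc (suc (suc zero)) , uY , _) = uY
        at (suc (suc (suc (suc zero))) , _ , ())
      Y≢Y′ : Y ≢ Y′
      Y≢Y′ refl = c≢c′ (generator-through-3-unique (three g Y∈l Y∈c) g g′ Y∈c Y′∈c′)
      two : 2 ≤ U.occurrences l 3
      two = U.occurrence₂ l Y≢Y′ Y∈l Y′∈l (three g Y∈l Y∈c) (three g′ Y′∈l Y′∈c′)
      by-cases : ∀ b → Type l b → b ≡ true
      by-cases true  _ = refl
      by-cases false (type ‹21111› _ kind _ _) = ⊥-elim (<⇒≱ two (≤-trans (≤-reflexive (U.counts kind (# 3))) z≤n))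
      by-cases false (type ‹31110› _ kind _ _) = ⊥-elim (<⇒≱ two (≤-reflexive (U.counts kind (# 3))))
      by-cases false (type ‹22200› _ kind _ _) = ⊥-elim (<⇒≱ two (≤-trans (≤-reflexive (U.counts kind (# 3))) z≤n))
    described {l} (planar l⊂π misses) = by-cases (L l) (classify l)
      where
      odd : 1 ≤ U.occurrences l 1 → ⊥
      odd occ = let (Q , Q∈l , uQ) = U.find l 1 occ in true≢false (l⊂π Q∈l) (odd⇒∉π uQ refl)
      by-cases : ∀ b → Type l b → b ≡ true
      by-cases true  _ = refl
      by-cases false (type ‹21111› _ kind _ _) = ⊥-elim (odd (subst (1 ≤_) (sym (U.counts kind (# 1))) (s≤s z≤n)))
      by-cases false (type ‹31110› _ kind _ _) = ⊥-elim (odd (subst (1 ≤_) (sym (U.counts kind (# 1))) (s≤s z≤n)))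
      by-cases false (type ‹22200› _ kind _ _) =
        let (z , z∈l , uz) = U.find l 0 (subst (1 ≤_) (sym (U.counts kind (# 0))) (s≤s z≤n)) in ⊥-elim (misses z∈l uz)

-- The characterisation in an abstract space

module _ (S : Space) (L : Space.Ln S → Bool) (CL : LineCondition S L) where

  weights : Weights S L
  weights = record
    { u = u ; w = w ; u≤4 = u≤4 ; w≤4 = w≤4 ; degree = s≡5u+1 ; plane-size = m≡5w+1
    ; flag = flag-u+w ; flag-bounds = flag-bounds ; line-u = line-u ; line-w = line-w
    ; line-u²+w² = line-u²+w² ; plane-u = plane-u ; plane-u² = plane-u² ; Σu = Σu ; Σu² = Σu² }
    where open Reduced S L CL

-- The wording of the theorem carried over to a `Space`, where lines are compared by equality and
-- not by their bases.
module HyperovalCone (S : Space) (P : Space.Pt S) (π : Space.Pl S) (O : Space.Pt S → Bool) where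

  open Geometry S

  InCone : Ln → Set
  InCone l = P ∈ˡ l ≡ true × Σ Pt (λ Q → O Q ≡ true × Q ∈ˡ l ≡ true)

  Misses : Ln → Set
  Misses l = ∀ Q → O Q ≡ true → ¬ (Q ∈ˡ l ≡ true)

  Meet : Ln → Ln → Set
  Meet l m = Σ Pt (λ Q → Q ∈ˡ l ≡ true × Q ∈ˡ m ≡ true)

  TwoSecant : Ln → Set
  TwoSecant l = ¬ (P ∈ˡ l ≡ true) × Misses l ×
    Σ Ln (λ c₁ → Σ Ln (λ c₂ → c₁ ≢ c₂ × InCone c₁ × InCone c₂ × Meet l c₁ × Meet l c₂))

  Planar : Ln → Set
  Planar l = (∀ Q → Q ∈ˡ l ≡ true → Q ∈ᵖ π ≡ true) × Misses l

  record Describes (L : Ln → Bool) : Set where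
    field
      apex-off  : ¬ (P ∈ᵖ π ≡ true)
      planar    : ∀ Q → O Q ≡ true → Q ∈ᵖ π ≡ true
      six       : Pts.Σ′ (⟦_⟧ ∘ O) ≡ 6
      no-three  : ∀ Q₁ Q₂ Q₃ → O Q₁ ≡ true → O Q₂ ≡ true → O Q₃ ≡ true →
        Q₁ ≢ Q₂ → Q₁ ≢ Q₃ → Q₂ ≢ Q₃ → ¬ Σ Ln (λ l → Q₁ ∈ˡ l ≡ true × Q₂ ∈ˡ l ≡ true × Q₃ ∈ˡ l ≡ true)
      lines     : ∀ l → (L l ≡ true) ⇔ (InCone l ⊎ TwoSecant l ⊎ Planar l)

module _ (S : Space) (L : Space.Ln S → Bool) where

  open Geometry S

  hyperoval-cone : Weights S L → ∃ λ P → ∃ λ π → ∃ λ O → HyperovalCone.Describes S P π O L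
  hyperoval-cone weights = on-plane (Structure.even-plane weights)
    where
    on-plane : (∃ λ π → ∀ P → Structure.e weights P ≡ P ∈ᵖ π) → ∃ λ P → ∃ λ π → ∃ λ O → HyperovalCone.Describes S P π O L
    on-plane (π , e≡) = on-apex apex-exists
      where
      open Structure weights using (u)
      open Cone weights π e≡
      on-apex : (∃ λ P → u P ≡ 1 × (∀ {c z} → Generator c z → P ∈ˡ c ≡ true)) →
        ∃ λ P → ∃ λ π → ∃ λ O → HyperovalCone.Describes S P π O L
      on-apex (P , uP , P∈) = P , π , O , record
        { apex-off = λ P∈π → true≢false P∈π apex∉π
        ; planar   = λ Q OQ → even⇒∈π (O⇒u≡0 OQ) refl
        ; six      = |O|
        ; no-three = λ Q₁ Q₂ Q₃ O₁ O₂ O₃ Q₁≢Q₂ Q₁≢Q₃ Q₂≢Q₃ (l , ∈₁ , ∈₂ , ∈₃) →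
            no-three-zeros Q₁≢Q₂ Q₁≢Q₃ Q₂≢Q₃ ∈₁ ∈₂ ∈₃ (O⇒u≡0 O₁) (O⇒u≡0 O₂) (O⇒u≡0 O₃)
        ; lines    = λ l → mk⇔ (forth ∘ describe) (described ∘ back)
        }
        where
        open Apex P uP P∈
        open HyperovalCone S P π O
        misses : ∀ {l} → (∀ {Q} → Q ∈ˡ l ≡ true → u Q ≢ 0) → Misses l
        misses none Q OQ Q∈l = none Q∈l (O⇒u≡0 OQ)
        misses⁻ : ∀ {l} → Misses l → ∀ {Q} → Q ∈ˡ l ≡ true → u Q ≢ 0
        misses⁻ none {Q} Q∈l uQ = none Q (u≡0⇒O uQ) Q∈l
        in-cone : ∀ {c z} → Generator c z → InCone c
        in-cone {z = z} g = P∈ g , z , u≡0⇒O (Generator.at-zero g) , Generator.on-line g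
        forth : ∀ {l} → Description l → InCone l ⊎ TwoSecant l ⊎ Planar l
        forth (cone {z} P∈l z∈l uz) = inj₁ (P∈l , z , u≡0⇒O uz , z∈l)
        forth (secant {c} {c′} {Y = Y} {Y′ = Y′} P∉l none c≢c′ g g′ Y∈l Y∈c Y′∈l Y′∈c′) = inj₂ (inj₁
          ((λ P∈l → true≢false P∈l P∉l) , misses none , c , c′ , c≢c′ , in-cone g , in-cone g′ ,
            (Y , Y∈l , Y∈c) , (Y′ , Y′∈l , Y′∈c′)))
        forth (planar l⊂π none) = inj₂ (inj₂ ((λ Q → l⊂π) , misses none))
        not-true : ∀ {b} → ¬ (b ≡ true) → b ≡ false
        not-true {false} _ = refl
        not-true {true}  contra = ⊥-elim (contra refl)
        back : ∀ {l} → InCone l ⊎ TwoSecant l ⊎ Planar l → Description l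
        back (inj₁ (P∈l , z , Oz , z∈l)) = cone P∈l z∈l (O⇒u≡0 Oz)
        back (inj₂ (inj₁ (P∉l , none , c , c′ , c≢c′ , (P∈c , z , Oz , z∈c) , (P∈c′ , z′ , Oz′ , z′∈c′) ,
            (Y , Y∈l , Y∈c) , (Y′ , Y′∈l , Y′∈c′)))) =
          secant (not-true P∉l) (misses⁻ none) c≢c′ (apex-zero-line P∈c z∈c (O⇒u≡0 Oz))
            (apex-zero-line P∈c′ z′∈c′ (O⇒u≡0 Oz′)) Y∈l Y∈c Y′∈l Y′∈c′
        back (inj₂ (inj₂ (l⊂π , none))) = planar (λ {Q} → l⊂π Q) (misses⁻ none)

-- The space PG(3,4)

==⇒≡ : ∀ a b → T (a == b) → a ≡ b
==⇒≡ 𝟎  𝟎  _ = refl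
==⇒≡ 𝟏  𝟏  _ = refl
==⇒≡ ω  ω  _ = refl
==⇒≡ ω² ω² _ = refl

==-refl : ∀ a → T (a == a)
==-refl 𝟎  = _
==-refl 𝟏  = _
==-refl ω  = _
==-refl ω² = _

_≟ᶠ_ : DecidableEquality GF4
a ≟ᶠ b = map′ (==⇒≡ a b) (λ { refl → ==-refl a }) (T? (a == b))

_≟ᵛ_ : ∀ {n} → DecidableEquality (Vec GF4 n)
_≟ᵛ_ = ≡-dec _≟ᶠ_

==v-does : ∀ {n} (v w : Vec GF4 n) → (v ==v w) ≡ does (v ≟ᵛ w)
==v-does []      []      = refl
==v-does (a ∷ v) (b ∷ w) = cong ((a == b) ∧_) (==v-does v w)

⟦∧⟧ : ∀ a b → ⟦ a ∧ b ⟧ ≡ ⟦ a ⟧ * ⟦ b ⟧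
⟦∧⟧ true  b = sym (*-identityˡ ⟦ b ⟧)
⟦∧⟧ false b = refl

∑-++ : ∀ {A : Set} (xs ys : List A) (f : A → ℕ) → ∑ (xs ++ ys) f ≡ ∑ xs f + ∑ ys f
∑-++ []       ys f = refl
∑-++ (x ∷ xs) ys f = trans (cong (f x +_) (∑-++ xs ys f)) (sym (+-assoc (f x) (∑ xs f) (∑ ys f)))

module _ {A : Set} where

  ∑-filterᵇ : ∀ xs (p : A → Bool) (f : A → ℕ) → ∑ (filterᵇ p xs) f ≡ ∑ xs (λ x → ⟦ p x ⟧ * f x)
  ∑-filterᵇ []       p f = refl
  ∑-filterᵇ (x ∷ xs) p f with p x
  ... | true  = cong₂ _+_ (sym (*-identityˡ (f x))) (∑-filterᵇ xs p f)
  ... | false = ∑-filterᵇ xs p f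

  length-filterᵇ : ∀ xs (p : A → Bool) → length (filterᵇ p xs) ≡ ∑ xs (⟦_⟧ ∘ p)
  length-filterᵇ []       p = refl
  length-filterᵇ (x ∷ xs) p with p x
  ... | true  = cong suc (length-filterᵇ xs p)
  ... | false = length-filterᵇ xs p

  ∑≡⟦any⟧ : ∀ xs (p : A → Bool) → ∑ xs (⟦_⟧ ∘ p) ≤ 1 → ∑ xs (⟦_⟧ ∘ p) ≡ ⟦ any p xs ⟧
  ∑≡⟦any⟧ []       p _ = refl
  ∑≡⟦any⟧ (x ∷ xs) p ≤1 with p x
  ... | true  = cong suc (n≤0⇒n≡0 (≤-pred ≤1))
  ... | false = ∑≡⟦any⟧ xs p ≤1

  module _ {B : Set} where

    ∑-map : ∀ (h : A → B) xs f → ∑ (map h xs) f ≡ ∑ xs (f ∘ h)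
    ∑-map h []       f = refl
    ∑-map h (x ∷ xs) f = cong (f (h x) +_) (∑-map h xs f)

    ∑-concatMap : ∀ (h : A → List B) xs f → ∑ (concatMap h xs) f ≡ ∑ xs (λ x → ∑ (h x) f)
    ∑-concatMap h []       f = refl
    ∑-concatMap h (x ∷ xs) f = trans (∑-++ (h x) (concatMap h xs) f) (cong (∑ (h x) f +_) (∑-concatMap h xs f))

    ∑-mapMaybe : ∀ (h : A → Maybe B) xs f → ∑ (mapMaybe h xs) f ≡ ∑ xs (maybe′ f 0 ∘ h)
    ∑-mapMaybe h []       f = refl
    ∑-mapMaybe h (x ∷ xs) f with h x
    ... | just y  = cong (f y +_) (∑-mapMaybe h xs f)
    ... | nothing = ∑-mapMaybe h xs f

all⇒ : ∀ {A : Set} (fin : Finite A) (p : A → Bool) → all p (Finite.elements fin) ≡ true → ∀ x → p x ≡ true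
all⇒ fin p every x = ⟦⟧≡1 (trans (sym (Sum.Σ-δ fin x (⟦_⟧ ∘ p)))
  (trans (go (Finite.elements fin) every) (Finite.once fin x)))
  where
  go : ∀ xs → all p xs ≡ true → ∑ xs (λ y → ⟦ p y ⟧ * Sum.δ fin x y) ≡ ∑ xs (Sum.δ fin x)
  go []       _ = refl
  go (y ∷ ys) eq with p y
  ... | true = cong₂ _+_ (*-identityˡ _) (go ys eq)

allVecs-once : ∀ {n} (v : Vec GF4 n) → ∑ (allVecs n) (λ w → ⟦ does (v ≟ᵛ w) ⟧) ≡ 1
allVecs-once []      = refl
allVecs-once {suc n} (a ∷ v) = begin
  ∑ (allVecs (suc n)) (λ w → ⟦ does ((a ∷ v) ≟ᵛ w) ⟧)
    ≡⟨ ∑-concatMap (λ b → map (b ∷_) (allVecs n)) allGF4 δ ⟩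
  ∑ allGF4 (λ b → ∑ (map (b ∷_) (allVecs n)) (λ w → ⟦ does ((a ∷ v) ≟ᵛ w) ⟧))
    ≡⟨ ∑-cong allGF4 (λ b → trans (∑-map (b ∷_) (allVecs n) δ)
         (trans (∑-cong (allVecs n) (λ w → ⟦∧⟧ (a == b) (does (v ≟ᵛ w))))
           (trans (∑-*ˡ (allVecs n) ⟦ a == b ⟧ _) (cong (⟦ a == b ⟧ *_) (allVecs-once v))))) ⟩
  ∑ allGF4 (λ b → ⟦ a == b ⟧ * 1)
    ≡⟨ allGF4-once a ⟩
  1 ∎
  where
  open ≡-Reasoning
  δ : Vec GF4 (suc n) → ℕ
  δ w = ⟦ does ((a ∷ v) ≟ᵛ w) ⟧
  allGF4-once : ∀ a → ∑ allGF4 (λ b → ⟦ a == b ⟧ * 1) ≡ 1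
  allGF4-once 𝟎  = refl
  allGF4-once 𝟏  = refl
  allGF4-once ω  = refl
  allGF4-once ω² = refl

Σ-T-≡ : ∀ {A : Set} {p : A → Bool} {x y : Σ A (T ∘ p)} → proj₁ x ≡ proj₁ y → x ≡ y
Σ-T-≡ {x = x , t} {.x , t′} refl = cong (x ,_) (T-irrelevant t t′)

maybe-decT : ∀ {A : Set} b (k : T b → A) (f : A → ℕ) n → (∀ t → f (k t) ≡ n) → (¬ T b → n ≡ 0) →
  maybe′ f 0 (Maybe.map k (decT b)) ≡ n
maybe-decT true  k f n yes-case no-case = yes-case _
maybe-decT false k f n yes-case no-case = sym (no-case (λ ()))

⟦does⟧≡0 : ∀ {P : Set} (p? : Dec P) → ¬ P → ⟦ does p? ⟧ ≡ 0
⟦does⟧≡0 p? ¬p = cong ⟦_⟧ (dec-false p? ¬p)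

-- Abstracted over the list of vectors, so that allVecs 4 is not evaluated here.
module _ (vecs : List Vec4) (vecs-once : ∀ v → ∑ vecs (λ w → ⟦ does (v ≟ᵛ w) ⟧) ≡ 1) where

  finitePoint′ : Finite Point
  finitePoint′ = record
    { elements = mapMaybe (λ v → Maybe.map (v ,_) (decT (isNormalized v))) vecs
    ; _≟_      = _≟_
    ; once     = once
    }
    where
    _≟_ : DecidableEquality Point
    P ≟ Q = map′ Σ-T-≡ (cong proj₁) (proj₁ P ≟ᵛ proj₁ Q)
    once : ∀ P → ∑ (mapMaybe (λ v → Maybe.map (v ,_) (decT (isNormalized v))) vecs) (λ Q → ⟦ does (P ≟ Q) ⟧) ≡ 1
    once P@(p , t) = trans (∑-mapMaybe _ vecs _) (trans (∑-cong vecs pointwise) (vecs-once p))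
      where
      pointwise : ∀ v → maybe′ (λ Q → ⟦ does (P ≟ Q) ⟧) 0 (Maybe.map (v ,_) (decT (isNormalized v))) ≡ ⟦ does (p ≟ᵛ v) ⟧
      pointwise v = maybe-decT (isNormalized v) (v ,_) _ _ (λ _ → refl)
        (λ abnormal → ⟦does⟧≡0 (p ≟ᵛ v) (λ { refl → abnormal t }))

  finiteLine′ : Finite Line
  finiteLine′ = record
    { elements = concatMap (λ s₁ → mapMaybe (λ s₂ → Maybe.map ((s₁ , s₂) ,_) (decT (isRREF s₁ s₂))) vecs) vecs
    ; _≟_      = _≟_
    ; once     = once
    }
    where
    _≟_ : DecidableEquality Line
    ((r₁ , r₂) , _) ≟ ((s₁ , s₂) , _) = map′ (λ { (refl , refl) → Σ-T-≡ refl }) (λ { refl → refl , refl })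
      ((r₁ ≟ᵛ s₁) ×-dec (r₂ ≟ᵛ s₂))
    row : Vec4 → List Line
    row s₁ = mapMaybe (λ s₂ → Maybe.map ((s₁ , s₂) ,_) (decT (isRREF s₁ s₂))) vecs
    once : ∀ l → ∑ (concatMap row vecs) (λ m → ⟦ does (l ≟ m) ⟧) ≡ 1
    once l@((r₁ , r₂) , t) = begin
      ∑ (concatMap row vecs) (λ m → ⟦ does (l ≟ m) ⟧)
        ≡⟨ ∑-concatMap row vecs _ ⟩
      ∑ vecs (λ s₁ → ∑ (row s₁) (λ m → ⟦ does (l ≟ m) ⟧))
        ≡⟨ ∑-cong vecs (λ s₁ → trans (∑-mapMaybe _ vecs _) (∑-cong vecs (pointwise s₁))) ⟩
      ∑ vecs (λ s₁ → ∑ vecs (λ s₂ → ⟦ does (r₁ ≟ᵛ s₁) ⟧ * ⟦ does (r₂ ≟ᵛ s₂) ⟧))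
        ≡⟨ ∑-cong vecs (λ s₁ → trans (∑-*ˡ vecs ⟦ does (r₁ ≟ᵛ s₁) ⟧ _)
             (trans (cong (⟦ does (r₁ ≟ᵛ s₁) ⟧ *_) (vecs-once r₂)) (*-identityʳ _))) ⟩
      ∑ vecs (λ s₁ → ⟦ does (r₁ ≟ᵛ s₁) ⟧)
        ≡⟨ vecs-once r₁ ⟩
      1 ∎
      where
      open ≡-Reasoning
      pointwise : ∀ s₁ s₂ → maybe′ (λ m → ⟦ does (l ≟ m) ⟧) 0 (Maybe.map ((s₁ , s₂) ,_) (decT (isRREF s₁ s₂))) ≡
        ⟦ does (r₁ ≟ᵛ s₁) ⟧ * ⟦ does (r₂ ≟ᵛ s₂) ⟧
      pointwise s₁ s₂ = trans (maybe-decT (isRREF s₁ s₂) ((s₁ , s₂) ,_) _ ⟦ does (r₁ ≟ᵛ s₁) ∧ does (r₂ ≟ᵛ s₂) ⟧ (λ _ → refl)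
        (λ singular → ⟦does⟧≡0 ((r₁ ≟ᵛ s₁) ×-dec (r₂ ≟ᵛ s₂)) (λ { (refl , refl) → singular t })))
        (⟦∧⟧ (does (r₁ ≟ᵛ s₁)) (does (r₂ ≟ᵛ s₂)))

-- Opaque, so that sums over points and lines are evaluated in no other place
-- than the checks that unfold them.
opaque

  finitePoint : Finite Point
  finitePoint = finitePoint′ (allVecs 4) allVecs-once

  finiteLine : Finite Line
  finiteLine = finiteLine′ (allVecs 4) allVecs-once

  elements-point : Finite.elements finitePoint ≡ allPoints
  elements-point = refl

  elements-line : Finite.elements finiteLine ≡ allLines
  elements-line = refl

-- It suffices to test the functional on a basis. Agreement with the incidence of points is among
-- the facts checked by `checkLine′`.
_⊆_ : Line → Plane → Bool
((r₁ , r₂) , _) ⊆ (a , _) = (dot a r₁ == 𝟎) ∧ (dot a r₂ == 𝟎)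

-- As allPoints is sorted lexicographically, the first two points of a line are
-- its rows r₂ and r₁; so a line is determined by its points.
leading : Line → List Point → Bool
leading ((r₁ , r₂) , _) (P ∷ Q ∷ _) = (proj₁ P ==v r₂) ∧ (proj₁ Q ==v r₁)
leading _               _           = false

-- The points and planes of the line are arguments, so that the inner sums run over five elements
-- instead of 85.
checkLine′ : Line → List Point → List Plane → Bool
checkLine′ l Ps πs =
  (∑ Ps (λ _ → 1) ≡ᵇ 5) ∧ (∑ πs (λ _ → 1) ≡ᵇ 5) ∧ leading l Ps
  ∧ all (λ π → ∑ Ps (λ P → ⟦ onPlane P π ⟧) ≡ᵇ 1 + 4 * ⟦ l ⊆ π ⟧) (Finite.elements finitePoint)
  ∧ all (λ P → ∑ πs (λ π → ⟦ onPlane P π ⟧) ≡ᵇ 1 + 4 * ⟦ onLine P l ⟧) (Finite.elements finitePoint)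

checkLine : Line → Bool
checkLine l = checkLine′ l (filterᵇ (λ P → onLine P l) (Finite.elements finitePoint)) (filterᵇ (l ⊆_) (Finite.elements finitePoint))

-- `Point` and `Plane` unfold to the same type: `P` is read both as a point and as the plane with
-- these coefficients.
checkPoint : List Line → Point → Bool
checkPoint ls P =
  (∑ ls (λ l → ⟦ onLine P l ⟧) ≡ᵇ 21) ∧ (∑ ls (λ l → ⟦ l ⊆ P ⟧) ≡ᵇ 21)
  ∧ (∑ (Finite.elements finitePoint) (λ Q → ⟦ onPlane Q P ⟧) ≡ᵇ 21) ∧ (∑ (Finite.elements finitePoint) (λ π → ⟦ onPlane P π ⟧) ≡ᵇ 21)

checkPoints : List Line → Bool
checkPoints ls = all (checkPoint ls) (Finite.elements finitePoint)

opaque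
  unfolding finitePoint finiteLine

  lines-checked : all checkLine (Finite.elements finiteLine) ≡ true
  lines-checked = refl

  points-checked : checkPoints (Finite.elements finiteLine) ≡ true
  points-checked = refl

  85-points : ∑ (Finite.elements finitePoint) (λ _ → 1) ≡ 85
  85-points = refl

∧⁻ : ∀ {a b} → a ∧ b ≡ true → a ≡ true × b ≡ true
∧⁻ {true} eq = refl , eq

==v-sound : ∀ {n} {v w : Vec GF4 n} → (v ==v w) ≡ true → v ≡ w
==v-sound {v = v} {w} eq with v ≟ᵛ w | ==v-does v w
... | yes v≡w | _ = v≡w
... | no _    | neq = ⊥-elim (true≢false eq neq)

∑-filterᵇ-1 : ∀ {A : Set} xs (p : A → Bool) → ∑ (filterᵇ p xs) (λ _ → 1) ≡ ∑ xs (λ x → ⟦ p x ⟧)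
∑-filterᵇ-1 xs p = trans (∑-filterᵇ xs p (λ _ → 1)) (∑-cong xs (λ x → *-identityʳ ⟦ p x ⟧))

module LineCheck (l : Line) (Ps : List Point) (πs : List Plane) (checked : checkLine′ l Ps πs ≡ true) where

  private
    c₂ = ∧⁻ {∑ Ps (λ _ → 1) ≡ᵇ 5} checked
    c₃ = ∧⁻ {∑ πs (λ _ → 1) ≡ᵇ 5} (proj₂ c₂)
    c₄ = ∧⁻ {leading l Ps} (proj₂ c₃)
    c₅ = ∧⁻ {all (λ π → ∑ Ps (λ P → ⟦ onPlane P π ⟧) ≡ᵇ 1 + 4 * ⟦ l ⊆ π ⟧) (Finite.elements finitePoint)} (proj₂ c₄)

  five-points : ∑ Ps (λ _ → 1) ≡ 5
  five-points = ≡ᵇ⇒≡′ _ _ (proj₁ c₂)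

  five-planes : ∑ πs (λ _ → 1) ≡ 5
  five-planes = ≡ᵇ⇒≡′ _ _ (proj₁ c₃)

  leads : leading l Ps ≡ true
  leads = proj₁ c₄

  plane-meets : ∀ π → ∑ Ps (λ P → ⟦ onPlane P π ⟧) ≡ 1 + 4 * ⟦ l ⊆ π ⟧
  plane-meets π = ≡ᵇ⇒≡′ _ _ (all⇒ finitePoint _ (proj₁ c₅) π)

  point-joins : ∀ P → ∑ πs (λ π → ⟦ onPlane P π ⟧) ≡ 1 + 4 * ⟦ onLine P l ⟧
  point-joins P = ≡ᵇ⇒≡′ _ _ (all⇒ finitePoint _ (proj₂ c₅) P)

filterᵇ-cong : ∀ {A : Set} xs {p r : A → Bool} → (∀ x → p x ≡ r x) → filterᵇ p xs ≡ filterᵇ r xs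
filterᵇ-cong []       p≡r = refl
filterᵇ-cong (x ∷ xs) {p} {r} p≡r with p x | r x | p≡r x
... | true  | .true  | refl = cong (x ∷_) (filterᵇ-cong xs p≡r)
... | false | .false | refl = filterᵇ-cong xs p≡r

leading-unique : ∀ {l m Ps} → leading l Ps ≡ true → leading m Ps ≡ true → proj₁ l ≡ proj₁ m
leading-unique {(r₁ , r₂) , _} {(s₁ , s₂) , _} {P ∷ Q ∷ _} l-leads m-leads =
  let (r₂≡ , r₁≡) = ∧⁻ {proj₁ P ==v r₂} l-leads
      (s₂≡ , s₁≡) = ∧⁻ {proj₁ P ==v s₂} m-leads
  in cong₂ _,_ (trans (sym (==v-sound {v = proj₁ Q} r₁≡)) (==v-sound {v = proj₁ Q} s₁≡))
       (trans (sym (==v-sound {v = proj₁ P} r₂≡)) (==v-sound {v = proj₁ P} s₂≡))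

module PointCheck (ls : List Line) (P : Point) (checked : checkPoint ls P ≡ true) where

  private
    c₁ = ∧⁻ {∑ ls (λ l → ⟦ onLine P l ⟧) ≡ᵇ 21} checked
    c₂ = ∧⁻ {∑ ls (λ l → ⟦ l ⊆ P ⟧) ≡ᵇ 21} (proj₂ c₁)
    c₃ = ∧⁻ {∑ (Finite.elements finitePoint) (λ Q → ⟦ onPlane Q P ⟧) ≡ᵇ 21} (proj₂ c₂)

  star : ∑ ls (λ l → ⟦ onLine P l ⟧) ≡ 21
  star = ≡ᵇ⇒≡′ _ _ (proj₁ c₁)

  ruled : ∑ ls (λ l → ⟦ l ⊆ P ⟧) ≡ 21
  ruled = ≡ᵇ⇒≡′ _ _ (proj₁ c₂)

  points : ∑ (Finite.elements finitePoint) (λ Q → ⟦ onPlane Q P ⟧) ≡ 21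
  points = ≡ᵇ⇒≡′ _ _ (proj₁ c₃)

  planes : ∑ (Finite.elements finitePoint) (λ π → ⟦ onPlane P π ⟧) ≡ 21
  planes = ≡ᵇ⇒≡′ _ _ (proj₂ c₃)

module Checked where

  check : ∀ l → checkLine′ l (filterᵇ (λ P → onLine P l) (Finite.elements finitePoint)) (filterᵇ (l ⊆_) (Finite.elements finitePoint)) ≡ true
  check = all⇒ finiteLine checkLine lines-checked

  check′ : ∀ P → checkPoint (Finite.elements finiteLine) P ≡ true
  check′ = all⇒ finitePoint (checkPoint (Finite.elements finiteLine)) points-checked

  module Line (l : Line) = LineCheck l (filterᵇ (λ P → onLine P l) (Finite.elements finitePoint)) (filterᵇ (l ⊆_) (Finite.elements finitePoint)) (check l)
  module Pointwise (P : Point) = PointCheck (Finite.elements finiteLine) P (check′ P)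

PG34 : Space
PG34 = record
  { Pt = Point ; Ln = Line ; Pl = Plane
  ; finPt = finitePoint ; finLn = finiteLine ; finPl = finitePoint
  ; _∈ˡ_ = onLine ; _∈ᵖ_ = onPlane ; _⊂_ = _⊆_
  ; #points         = 85-points
  ; #planes         = 85-points
  ; points-on-line  = λ l → trans (sym (∑-filterᵇ-1 (Finite.elements finitePoint) (λ P → onLine P l))) (Checked.Line.five-points l)
  ; planes-on-line  = λ l → trans (sym (∑-filterᵇ-1 (Finite.elements finitePoint) (l ⊆_))) (Checked.Line.five-planes l)
  ; points-in-plane = Checked.Pointwise.points
  ; planes-on-point = Checked.Pointwise.planes
  ; lines-on-point  = Checked.Pointwise.star
  ; lines-in-plane  = Checked.Pointwise.ruled
  ; line-plane      = λ l π → trans (sym (∑-filterᵇ (Finite.elements finitePoint) (λ P → onLine P l) (λ P → ⟦ onPlane P π ⟧))) (Checked.Line.plane-meets l π)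
  ; line-point      = λ l P → trans (sym (∑-filterᵇ (Finite.elements finitePoint) (l ⊆_) (λ π → ⟦ onPlane P π ⟧))) (Checked.Line.point-joins l P)
  ; line-ext        = λ {l} {m} same → Σ-T-≡ (leading-unique {l} {m} {filterᵇ (λ P → onLine P l) (Finite.elements finitePoint)} (Checked.Line.leads l)
      (subst (λ Ps → leading m Ps ≡ true) (sym (filterᵇ-cong (Finite.elements finitePoint) same)) (Checked.Line.leads m)))
  }

sameLine-sound : ∀ l m → sameLine l m ≡ true → l ≡ m
sameLine-sound ((r₁ , r₂) , _) ((s₁ , s₂) , _) same =
  let (eq₁ , eq₂) = ∧⁻ {r₁ ==v s₁} same
  in Σ-T-≡ (cong₂ _,_ (==v-sound eq₁) (==v-sound eq₂))

==v-refl : ∀ {n} (v : Vec GF4 n) → (v ==v v) ≡ true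
==v-refl v = trans (==v-does v v) (dec-true (v ≟ᵛ v) refl)

sameLine-refl : ∀ l → sameLine l l ≡ true
sameLine-refl ((r₁ , r₂) , _) = cong₂ _∧_ (==v-refl r₁) (==v-refl r₂)

-- From the number of meeting lines to the line condition

module _ (L : Line → Bool) (cameron-liebler : IsCameronLiebler 7 L) where

  open Geometry PG34

  -- Distinct lines share at most one point, so the number of common points is the truth value of
  -- meeting; the last term covers `m` equal to `l`.
  common-points : ∀ l m → Pts.Σ′ (λ P → ⟦ onLine P l ⟧ * ⟦ onLine P m ⟧) ≡
    ⟦ not (sameLine m l) ∧ meets m l ⟧ + Lns.δ l m * 5
  common-points l m = by-cases (Finite._≟_ finiteLine l m)
    where
    when-equal : ∀ {n} b {s d} → s ≡ true → d ≡ 1 → n ≡ 5 → n ≡ ⟦ not s ∧ b ⟧ + d * 5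
    when-equal _ refl refl eq = eq
    when-distinct : ∀ {n} b {s d} → s ≡ false → d ≡ 0 → n ≡ ⟦ b ⟧ → n ≡ ⟦ not s ∧ b ⟧ + d * 5
    when-distinct _ refl refl eq = trans eq (sym (+-identityʳ _))
    by-cases : Dec (l ≡ m) → Pts.Σ′ (λ P → ⟦ onLine P l ⟧ * ⟦ onLine P m ⟧) ≡
      ⟦ not (sameLine m l) ∧ meets m l ⟧ + Lns.δ l m * 5
    by-cases (yes refl) = when-equal (meets l l) (sameLine-refl l) (Lns.δ-refl l)
      (trans (Pts.Σ-cong (λ P → idem (onLine P l))) (points-on-line l))
      where
      idem : ∀ b → ⟦ b ⟧ * ⟦ b ⟧ ≡ ⟦ b ⟧
      idem true  = refl
      idem false = refl
    by-cases (no l≢m) = when-distinct (meets m l) different (Lns.δ-≢ l≢m) (begin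
      Pts.Σ′ (λ P → ⟦ onLine P l ⟧ * ⟦ onLine P m ⟧)
        ≡⟨ Pts.Σ-cong (λ P → trans (*-comm ⟦ onLine P l ⟧ ⟦ onLine P m ⟧) (sym (⟦∧⟧ (onLine P m) (onLine P l)))) ⟩
      Pts.Σ′ (λ P → ⟦ onLine P m ∧ onLine P l ⟧)
        ≡⟨ ∑≡⟦any⟧ (Finite.elements finitePoint) (λ P → onLine P m ∧ onLine P l)
             (Pts.unique-Σ≤1 (λ P → ⟦ onLine P m ∧ onLine P l ⟧) (λ P → ⟦⟧≤1 (onLine P m ∧ onLine P l)) one-point) ⟩
      ⟦ any (λ P → onLine P m ∧ onLine P l) (Finite.elements finitePoint) ⟧
        ≡⟨ cong (λ Ps → ⟦ any (λ P → onLine P m ∧ onLine P l) Ps ⟧) {Finite.elements finitePoint} {allPoints} elements-point ⟩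
      ⟦ any (λ P → onLine P m ∧ onLine P l) allPoints ⟧ ∎)
      where
      open ≡-Reasoning
      different : sameLine m l ≡ false
      different with sameLine m l in same
      ... | false = refl
      ... | true  = ⊥-elim (l≢m (sym (sameLine-sound m l same)))
      common : ∀ a b → 1 ≤ ⟦ a ∧ b ⟧ → a ≡ true × b ≡ true
      common true true _ = refl , refl
      one-point : ∀ {P Q} → 1 ≤ ⟦ onLine P m ∧ onLine P l ⟧ → 1 ≤ ⟦ onLine Q m ∧ onLine Q l ⟧ → P ≡ Q
      one-point {P} {Q} hP hQ = decide (Finite._≟_ finitePoint P Q) (common (onLine P m) (onLine P l) hP) (common (onLine Q m) (onLine Q l) hQ)
        where
        decide : Dec (P ≡ Q) → onLine P m ≡ true × onLine P l ≡ true → onLine Q m ≡ true × onLine Q l ≡ true → P ≡ Q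
        decide (yes P≡Q) _ _ = P≡Q
        decide (no  P≢Q) (P∈m , P∈l) (Q∈m , Q∈l) = ⊥-elim (l≢m (line-unique {P} {Q} {l} {m} P≢Q P∈l Q∈l P∈m Q∈m))

  meeting : ∀ l → Lns.Σ′ (λ m → ⟦ L m ⟧ * ⟦ not (sameLine m l) ∧ meets m l ⟧) ≡ ⟦ L l ⟧ * 15 + 35
  meeting l = begin
    Lns.Σ′ (λ m → ⟦ L m ⟧ * ⟦ not (sameLine m l) ∧ meets m l ⟧)
      ≡⟨ Lns.Σ-cong (λ m → sym (⟦∧⟧ (L m) (not (sameLine m l) ∧ meets m l))) ⟩
    Lns.Σ′ (λ m → ⟦ L m ∧ not (sameLine m l) ∧ meets m l ⟧)
      ≡⟨ cong (λ ls → ∑ ls (λ m → ⟦ L m ∧ not (sameLine m l) ∧ meets m l ⟧)) {Finite.elements finiteLine} {allLines} elements-line ⟩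
    ∑ allLines (λ m → ⟦ L m ∧ not (sameLine m l) ∧ meets m l ⟧)
      ≡⟨ length-filterᵇ allLines (λ m → L m ∧ not (sameLine m l) ∧ meets m l) ⟨
    countMeeting L l
      -- Here 35 = (q + 1) · 7 and 15 = q² - 1.
      ≡⟨ trans (cameron-liebler l) (cong (λ n → 35 + 15 * n) (if≡⟦⟧ (L l))) ⟩
    35 + 15 * ⟦ L l ⟧
      ≡⟨ trans (+-comm 35 _) (cong (_+ 35) (*-comm 15 ⟦ L l ⟧)) ⟩
    ⟦ L l ⟧ * 15 + 35 ∎
    where
    open ≡-Reasoning
    if≡⟦⟧ : ∀ b → (if b then 1 else 0) ≡ ⟦ b ⟧
    if≡⟦⟧ true  = refl
    if≡⟦⟧ false = refl

  line-condition : ∀ l → lineSum (λ P → Lns.Σ′ (λ m → ⟦ onLine P m ⟧ * ⟦ L m ⟧)) l ≡ ⟦ L l ⟧ * 20 + 35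
  line-condition l = begin
    lineSum (λ P → Lns.Σ′ (λ m → ⟦ onLine P m ⟧ * ⟦ L m ⟧)) l
      ≡⟨ ∑-adjoint (Finite.elements finitePoint) (Finite.elements finiteLine) (λ P → ⟦ onLine P l ⟧) (λ P m → ⟦ onLine P m ⟧) (λ m → ⟦ L m ⟧) ⟩
    Lns.Σ′ (λ m → ⟦ L m ⟧ * Pts.Σ′ (λ P → ⟦ onLine P l ⟧ * ⟦ onLine P m ⟧))
      ≡⟨ Lns.Σ-cong (λ m → trans (cong (⟦ L m ⟧ *_) (common-points l m)) (distrib ⟦ L m ⟧ _ (Lns.δ l m))) ⟩
    Lns.Σ′ (λ m → ⟦ L m ⟧ * ⟦ not (sameLine m l) ∧ meets m l ⟧ + ⟦ L m ⟧ * Lns.δ l m * 5)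
      ≡⟨ trans (Lns.Σ-+ _ _) (cong₂ _+_ (meeting l) (trans (Lns.Σ-*ʳ _ 5) (cong (_* 5) (Lns.Σ-δ l (λ m → ⟦ L m ⟧))))) ⟩
    (⟦ L l ⟧ * 15 + 35) + ⟦ L l ⟧ * 5
      ≡⟨ collect ⟦ L l ⟧ ⟩
    ⟦ L l ⟧ * 20 + 35 ∎
    where
    open ≡-Reasoning
    distrib : ∀ a b d → a * (b + d * 5) ≡ a * b + a * d * 5
    distrib = solve-∀
    collect : ∀ a → (a * 15 + 35) + a * 5 ≡ a * 20 + 35
    collect = solve-∀

theorem2 : (L : Line → Bool) → IsCameronLiebler 7 L →
    Σ Point (λ P → Σ Plane (λ π → Σ (Point → Bool) (λ O →
    ¬ InPlane P π × IsHyperovalIn π O ×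
    (∀ (l : Line) → (L l ≡ true) ⇔
    (InC P O l ⊎ IsTwoSecant P O l ⊎ (LineInPlane l π × MissesO O l))))))
theorem2 L CL = translate (hyperoval-cone PG34 L (weights PG34 L (line-condition L CL)))
  where
  translate : (∃ λ P → ∃ λ π → ∃ λ O → HyperovalCone.Describes PG34 P π O L) → _
  translate (P , π , O , describes) = P , π , O , apex-off , (planar , trans size six , hyperoval) ,
      λ l → mk⇔ (forth l ∘ Equivalence.to (lines l)) (Equivalence.from (lines l) ∘ back l)
    where
    open HyperovalCone PG34 P π O
    open Describes describes
    size : length (filterᵇ O allPoints) ≡ ∑ (Finite.elements finitePoint) (⟦_⟧ ∘ O)
    size = trans (length-filterᵇ allPoints O) (cong (λ Ps → ∑ Ps (⟦_⟧ ∘ O)) {allPoints} {Finite.elements finitePoint} (sym elements-point))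
    hyperoval : ∀ (Q₁ Q₂ Q₃ : Point) → O Q₁ ≡ true → O Q₂ ≡ true → O Q₃ ≡ true →
      proj₁ Q₁ ≢ proj₁ Q₂ → proj₁ Q₁ ≢ proj₁ Q₃ → proj₁ Q₂ ≢ proj₁ Q₃ →
      ¬ Σ Line (λ l → OnLine Q₁ l × OnLine Q₂ l × OnLine Q₃ l)
    hyperoval Q₁ Q₂ Q₃ O₁ O₂ O₃ ≢₁₂ ≢₁₃ ≢₂₃ = no-three Q₁ Q₂ Q₃ O₁ O₂ O₃
      (≢₁₂ ∘ cong proj₁) (≢₁₃ ∘ cong proj₁) (≢₂₃ ∘ cong proj₁)
    forth : ∀ l → InCone l ⊎ TwoSecant l ⊎ Planar l → InC P O l ⊎ IsTwoSecant P O l ⊎ (LineInPlane l π × MissesO O l)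
    forth l (inj₁ in-cone) = inj₁ in-cone
    forth l (inj₂ (inj₁ (P∉l , misses , c₁ , c₂ , c₁≢c₂ , rest))) = inj₂ (inj₁ (P∉l , misses , c₁ , c₂ , c₁≢c₂ ∘ Σ-T-≡ , rest))
    forth l (inj₂ (inj₂ planar)) = inj₂ (inj₂ planar)
    back : ∀ l → InC P O l ⊎ IsTwoSecant P O l ⊎ (LineInPlane l π × MissesO O l) → InCone l ⊎ TwoSecant l ⊎ Planar l
    back l (inj₁ in-cone) = inj₁ in-cone
    back l (inj₂ (inj₁ (P∉l , misses , c₁ , c₂ , c₁≢c₂ , rest))) = inj₂ (inj₁ (P∉l , misses , c₁ , c₂ , c₁≢c₂ ∘ cong proj₁ , rest))
    back l (inj₂ (inj₂ planar)) = inj₂ (inj₂ planar)
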